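{- Let $p$ be a prime number, let $s$ be an odd positive divisor of $p-1$, and let $\mathbb{K}$ be the unique subfield of $\mathbb{Q}(\zeta_p)$ with $[\mathbb{K}:\mathbb{Q}]=s$. Let $\tilde{\mathcal{M}}_p\subseteq\mathcal{O}_{\mathbb{K}}$ be the $\mathbb{Z}$-submodule and $\sigma$ the canonical embedding defined in the context. Then the center density of the lattice $\sigma(\tilde{\mathcal{M}}_p)\subset\mathbb{R}^s$ satisfies $$\delta(\sigma(\tilde{\mathcal{M}}_p))\geq\frac{1}{2^{\frac{s+2}{2}}}.$$
   Context: Here $\zeta_p$ is a primitive $p$-th root of unity, $\mathbb{L}=\mathbb{Q}(\zeta_p)$, and $\mathcal{O}_{\mathbb{K}}$ is the ring of algebraic integers of $\mathbb{K}$. Let $u$ be an integer whose class generates $(\mathbb{Z}/p\mathbb{Z})^{\star}$, let $\sigma_u$ be the automorphism of $\mathbb{L}$ with $\sigma_u(\zeta_p)=\zeta_p^u$, let $\theta=\sigma_u|_{\mathbb{K}}$ (a generator of $\mathrm{Gal}(\mathbb{K}/\mathbb{Q})$), and let $t=\mathrm{Tr}_{\mathbb{L}/\mathbb{K}}(\zeta_p)$. The map $(a_0,\ldots,a_{s-1})\mapsto\sum_{i=0}^{s-1}a_i\theta^i(t)$ is an isomorphism of $\mathbb{Z}$-modules $\mathbb{Z}^s\to\mathcal{O}_{\mathbb{K}}$, and through it elements ${\bf x}\in\mathcal{O}_{\mathbb{K}}$ are identified with their coordinate vectors ${\bf x}=(a_0,\ldots,a_{s-1})\in\mathbb{Z}^s$.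 Let $\beta\in\mathbb{Z}$ be a primitive root modulo $p$ (of multiplicative order $p-1$ modulo $p$), and put $\alpha=\beta^{(p-1)/s}$. For $i=0,1,\ldots,s-1$ let $\mu_i=(1,\alpha^i,\alpha^{2i},\ldots,\alpha^{(s-1)i})\in\mathbb{Z}^s$, and let $\cdot$ denote the usual dot product on $\mathbb{Z}^s$. For $s$ odd, $\mathcal{M}_p=\{{\bf x}\in\mathcal{O}_{\mathbb{K}}:{\bf x}\cdot\mu_i\equiv 0\pmod p\text{ for all } i=0,1,\ldots,\frac{s-1}{2}\}$ and $\tilde{\mathcal{M}}_p=\{{\bf x}=(a_0,\ldots,a_{s-1})\in\mathcal{M}_p:\sum_{i=0}^{s-1}a_i\equiv 0\pmod 2\}$. Canonical embedding: let $\sigma_1,\ldots,\sigma_s$ be the embeddings $\mathbb{K}\to\mathbb{C}$, with $\sigma_1,\ldots,\sigma_{r_1}$ real and $\sigma_{r_1+1},\ldots,\sigma_{r_1+r_2}$ representatives of the $r_2$ complex-conjugate pairs of non-real ones ($s=r_1+2r_2$). Then $\sigma:\mathbb{K}\to\mathbb{R}^s$ is $\sigma(x)=(\sigma_1(x),\ldots,\sigma_{r_1}(x),\mathrm{Re}\,\sigma_{r_1+1}(x),\mathrm{Im}\,\sigma_{r_1+1}(x),\ldots,\mathrm{Re}\,\sigma_{r_1+r_2}(x),\mathrm{Im}\,\sigma_{r_1+r_2}(x))$. For a full-rank lattice $\Lambda\subset\mathbb{R}^n$, the packing radius is $\rho=\frac12\min\{\|v\|:v\in\Lambda\setminus\{0\}\}$,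 the volume $\mathrm{vol}(\Lambda)$ is the square root of the determinant of a Gram matrix of a $\mathbb{Z}$-basis of $\Lambda$, and the center density is $\delta(\Lambda)=\rho^n/\mathrm{vol}(\Lambda)$. -}

module Defs where

open import Level using (0ℓ)
open import Algebra.Apartness.Bundles using (HeytingField)
open import Algebra.Bundles using (CommutativeRing)
open import Algebra.Bundles.Raw using (RawRing)
open import Algebra.Morphism.Structures using (module RingMorphisms)
import Algebra.Apartness.Properties.HeytingCommutativeRing as HeytingProperties
import Algebra.Definitions.RawSemiring as SemiringOps
import Algebra.Properties.Ring as RingProperties
open import Data.Fin.Base using (Fin; zero; suc; toℕ; punchIn)
open import Data.Integer.Base as ℤ using (ℤ; +_; -[1+_])
import Data.Integer.Divisibility as ℤ
import Data.Integer.Properties as ℤ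
open import Data.Nat.Base as ℕ using (ℕ; zero; suc)
open import Data.Nat.DivMod using (_/_)
open import Data.Nat.GeneralisedArithmetic using (iterate)
open import Data.Product.Base using (∃; _×_; _,_; proj₁; proj₂)
open import Data.Rational.Base as ℚ using (ℚ; 0ℚ)
open import Data.Sum.Base using (_⊎_; [_,_]′)
open import Data.Vec.Functional using (Vector; []; _∷_; _++_; concat)
open import Function.Base using (_∘_)
open import Function.Bundles using (_⇔_)
open import Relation.Binary.Core using (Rel)
open import Relation.Binary.Definitions using (Decidable)
open import Relation.Binary.PropositionalEquality using (_≡_)
open import Relation.Binary.Structures using (IsStrictPartialOrder)
open import Relation.Nullary.Negation using (¬_; contradiction)
open import Relation.Unary using (Pred)

------------------------------------------------------------------------
-- Linear algebra over a commutative ring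

module LinearAlgebra (R : CommutativeRing 0ℓ 0ℓ) where
  open CommutativeRing R hiding (zero)
  open SemiringOps (RawRing.rawSemiring rawRing) public using (sum; _^_) renaming (_×_ to _×ℕ_)

  fromℤ : ℤ → Carrier
  fromℤ (+ n)    = n ×ℕ 1#
  fromℤ -[1+ n ] = - (suc n ×ℕ 1#)

  infix 4 _≋_
  _≋_ : ∀ {n} → Rel (Vector Carrier n) 0ℓ
  v ≋ w = ∀ i → v i ≈ w i

  𝟎 : ∀ {n} → Vector Carrier n
  𝟎 _ = 0#

  infix 8 _·_
  _·_ : ∀ {n} → Vector Carrier n → Vector Carrier n → Carrier
  v · w = sum (λ i → v i * w i)

  linComb : ∀ {m n} → Vector Carrier m → Vector (Vector Carrier n) m → Vector Carrier n
  linComb c b k = sum (λ i → c i * b i k)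

  -- Laplace expansion along the first row.
  det : ∀ {n} → Vector (Vector Carrier n) n → Carrier
  det {zero}  M = 1#
  det {suc n} M =
    sum (λ j → ((- 1#) ^ toℕ j) * M zero j * det (λ i k → M (suc i) (punchIn j k)))

  gram : ∀ {m n} → Vector (Vector Carrier n) m → Vector (Vector Carrier m) m
  gram b i j = b i · b j

module ℤ-LinearAlgebra = LinearAlgebra ℤ.+-*-commutativeRing

------------------------------------------------------------------------
-- The real numbers: a Cauchy-complete Archimedean ordered (Heyting)
-- field.  These axioms determine ℝ up to isomorphism.

record RealNumbers : Set₁ where
  infix 4 _<_ _≤_
  field
    heytingField : HeytingField 0ℓ 0ℓ 0ℓ

  open HeytingField heytingField public hiding (zero)

  commutativeRing : CommutativeRing 0ℓ 0ℓ
  commutativeRing = record { isCommutativeRing = isCommutativeRing }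

  open LinearAlgebra commutativeRing public

  field
    _<_                  : Rel Carrier 0ℓ
    isStrictPartialOrder : IsStrictPartialOrder _≈_ _<_
    #⇒<⊎>                : ∀ {x y} → x # y → x < y ⊎ y < x
    <⇒#                  : ∀ {x y} → x < y → x # y
    +-monoˡ-<            : ∀ {x y} z → x < y → x + z < y + z
    *-pos                : ∀ {x y} → 0# < x → 0# < y → 0# < x * y
    archimedean          : ∀ x → ∃ λ n → x < n ×ℕ 1#

  -- ∣ x - y ∣ < 1 / (k + 1)
  Within : ℕ → Rel Carrier 0ℓ
  Within k x y = suc k ×ℕ (x - y) < 1# × suc k ×ℕ (y - x) < 1#

  field
    complete : (f : ℕ → Carrier) →
      (∀ k → ∃ λ N → ∀ m n → N ℕ.≤ m → N ℕ.≤ n → Within k (f m) (f n)) →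
      ∃ λ x → ∀ k → ∃ λ N → ∀ n → N ℕ.≤ n → Within k (f n) x

  _≤_ : Rel Carrier 0ℓ
  x ≤ y = ¬ (y < x)

  -- Square roots of nonnegative elements exist by completeness; they are
  -- recorded as a total operation (such as √ ∣ x ∣) so that norms and volumes
  -- can be written as functions.  Its values at negative arguments are not
  -- specified.
  field
    √_       : Carrier → Carrier
    √-cong   : ∀ {x y} → x ≈ y → √ x ≈ √ y
    √-nonneg : ∀ x → 0# ≤ √ x
    √-square : ∀ {x} → 0# ≤ x → √ x * √ x ≈ x

  infix 9 √_

  inverse : ∀ x → x # 0# → Carrier
  inverse x x#0 = proj₁ (#⇒invertible x#0)

module RealProperties (ℝ : RealNumbers) where
  open RealNumbers ℝ
  open CommutativeRing commutativeRing using (ring)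
  open RingProperties ring using (-1*x≈-x; -‿involutive)
  open HeytingProperties (HeytingField.heytingCommutativeRing heytingField)
  open IsStrictPartialOrder isStrictPartialOrder
    using (<-respˡ-≈; <-respʳ-≈; asym) renaming (trans to <-trans)

  0<1 : 0# < 1#
  0<1 = [ (λ 1<0 → contradiction (0<1′ 1<0) (asym 1<0)) , (λ 0<1 → 0<1) ]′ (#⇒<⊎> 1#0)
    where
    0<1′ : 1# < 0# → 0# < 1#
    0<1′ 1<0 = <-respʳ-≈ (trans (-1*x≈-x (- 1#)) (-‿involutive 1#)) (*-pos 0<-1 0<-1)
      where
      0<-1 : 0# < - 1#
      0<-1 = <-respˡ-≈ (-‿inverseʳ 1#) (<-respʳ-≈ (+-identityˡ (- 1#)) (+-monoˡ-< (- 1#) 1<0))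

  2# : Carrier
  2# = 1# + 1#

  0<2^ : ∀ n → 0# < 2# ^ n
  0<2^ zero    = 0<1
  0<2^ (suc n) = *-pos 0<2 (0<2^ n)
    where
    0<2 : 0# < 2#
    0<2 = <-trans 0<1 (<-respˡ-≈ (+-identityˡ 1#) (+-monoˡ-< 1# 0<1))

  √-pos⇒#0 : ∀ {x} → 0# < x → √ x # 0#
  √-pos⇒#0 {x} 0<x = square#0 (#-congʳ (sym (√-square (asym 0<x))) (#-sym (<⇒# 0<x)))
    where
    square#0 : ∀ {y} → y * y # 0# → y # 0#
    square#0 {y} y²#0 = invertibleʳ⇒# (y * z ,
      trans (*-congʳ (x-0≈x y))
        (trans (sym (*-assoc y y z))
          (trans (*-congʳ (sym (x-0≈x (y * y)))) (proj₂ (proj₂ (#⇒invertible y²#0))))))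
      where
      z = inverse (y * y) y²#0

  -- 1 / 2^(k/2)
  1/2^½_ : ℕ → Carrier
  1/2^½ k = inverse (√ (2# ^ k)) (√-pos⇒#0 (0<2^ k))

------------------------------------------------------------------------
-- Lattices in ℝⁿ

module Lattices (ℝ : RealNumbers) where
  open RealNumbers ℝ
  open RealProperties ℝ using (2#)

  ‖_‖ : ∀ {n} → Vector Carrier n → Carrier
  ‖ v ‖ = √ (v · v)

  record IsFullRankBasis {n} (Λ : Pred (Vector Carrier n) 0ℓ)
                         (b : Vector (Vector Carrier n) n) : Set where
    field
      generates   : ∀ v → Λ v ⇔ (∃ λ (c : Vector ℤ n) → v ≋ linComb (fromℤ ∘ c) b)
      independent : ∀ (r : Vector Carrier n) → linComb r b ≋ 𝟎 → r ≋ 𝟎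

  vol : ∀ {n} → Vector (Vector Carrier n) n → Carrier
  vol b = √ det (gram b)

  IsPackingRadius : ∀ {n} → Pred (Vector Carrier n) 0ℓ → Carrier → Set
  IsPackingRadius Λ ρ = ∃ λ v →
    Λ v × ¬ (v ≋ 𝟎) × (∀ w → Λ w → ¬ (w ≋ 𝟎) → ‖ v ‖ ≤ ‖ w ‖) × 2# * ρ ≈ ‖ v ‖

  record IsCenterDensity {n} (Λ : Pred (Vector Carrier n) 0ℓ) (δ : Carrier) : Set where
    field
      basis           : Vector (Vector Carrier n) n
      isFullRankBasis : IsFullRankBasis Λ basis
      ρ               : Carrier
      isPackingRadius : IsPackingRadius Λ ρ
      vol#0           : vol basis # 0#
      δ≈ρⁿ/vol        : δ ≈ ρ ^ n * inverse (vol basis) vol#0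

------------------------------------------------------------------------
-- Number fields.  Equality of algebraic numbers is decidable, so _#_ is
-- required to be.

record FieldOverℚ : Set₁ where
  infix 4 _#?_
  field
    heytingField : HeytingField 0ℓ 0ℓ 0ℓ

  open HeytingField heytingField public hiding (zero)

  commutativeRing : CommutativeRing 0ℓ 0ℓ
  commutativeRing = record { isCommutativeRing = isCommutativeRing }

  open CommutativeRing commutativeRing public using (rawRing)
  open LinearAlgebra commutativeRing public using (sum; _^_; fromℤ)

  field
    _#?_ : Decidable _#_
    ι    : ℚ → Carrier
    ι-isRingHomomorphism :
      RingMorphisms.IsRingHomomorphism ℚ.+-*-rawRing rawRing ι

∣_∣ᶠ : FieldOverℚ → Set
∣ F ∣ᶠ = FieldOverℚ.Carrier F

module _ (F : FieldOverℚ) where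
  open FieldOverℚ F

  IsPrimitiveRootOfUnity : ℕ → Carrier → Set
  IsPrimitiveRootOfUnity n ζ =
    ζ ^ n ≈ 1# × (∀ k → 0 ℕ.< k → k ℕ.< n → ¬ (ζ ^ k ≈ 1#))

  -- The subfield ℚ(z), as the closure of ℚ ∪ {z} under the field operations.
  data Adjoin (z : Carrier) : Carrier → Set where
    rational : ∀ q → Adjoin z (ι q)
    gen      : Adjoin z z
    add      : ∀ {x y} → Adjoin z x → Adjoin z y → Adjoin z (x + y)
    mul      : ∀ {x y} → Adjoin z x → Adjoin z y → Adjoin z (x * y)
    neg      : ∀ {x} → Adjoin z x → Adjoin z (- x)
    inv      : ∀ {x y} → x * y ≈ 1# → Adjoin z x → Adjoin z y
    resp     : ∀ {x y} → x ≈ y → Adjoin z x → Adjoin z y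

  HasDegree : ℕ → Set
  HasDegree n = ∃ λ (b : Vector Carrier n) →
      (∀ x → ∃ λ (q : Vector ℚ n) → x ≈ sum (λ i → ι (q i) * b i))
    × (∀ (q : Vector ℚ n) → sum (λ i → ι (q i) * b i) ≈ 0# → ∀ i → q i ≡ 0ℚ)

  IsAlgebraicInteger : Carrier → Set
  IsAlgebraicInteger x = ∃ λ n → ∃ λ (c : Vector ℤ n) →
    x ^ n + sum (λ i → fromℤ (c i) * x ^ toℕ i) ≈ 0#

  IsAutomorphism : (Carrier → Carrier) → Set
  IsAutomorphism = RingMorphisms.IsRingIsomorphism rawRing rawRing

-- A homomorphism of fields is injective, so a subfield of L is given by a
-- field K together with a ring homomorphism K → L.
IsFieldEmbedding : (K L : FieldOverℚ) → (∣ K ∣ᶠ → ∣ L ∣ᶠ) → Set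
IsFieldEmbedding K L =
  RingMorphisms.IsRingHomomorphism (FieldOverℚ.rawRing K) (FieldOverℚ.rawRing L)

module Relative (K L : FieldOverℚ) (j : ∣ K ∣ᶠ → ∣ L ∣ᶠ) where
  open FieldOverℚ L

  record Gal : Set where
    field
      map            : Carrier → Carrier
      isAutomorphism : IsAutomorphism L map
      fixes          : ∀ x → map (j x) ≈ j x

  _≗ᴳ_ : Rel Gal 0ℓ
  g ≗ᴳ h = ∀ x → Gal.map g x ≈ Gal.map h x

  IsEnumeration : ∀ {n} → Vector Gal n → Set
  IsEnumeration g = (∀ i k → g i ≗ᴳ g k → i ≡ k) × (∀ h → ∃ λ i → h ≗ᴳ g i)

  -- Tr(x) = Σ g(x) over g ∈ Gal(L/K), for L/K Galois.
  IsTrace : Carrier → ∣ K ∣ᶠ → Set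
  IsTrace x t = ∃ λ n → ∃ λ (g : Vector Gal n) →
    IsEnumeration g × j t ≈ sum (λ i → Gal.map (g i) x)

------------------------------------------------------------------------
-- The canonical embedding

module Complex (ℝ : RealNumbers) where
  open RealNumbers ℝ

  ℂ : RawRing 0ℓ 0ℓ
  ℂ = record
    { Carrier = Carrier × Carrier
    ; _≈_ = λ (a , b) (c , d) → a ≈ c × b ≈ d
    ; _+_ = λ (a , b) (c , d) → a + c , b + d
    ; _*_ = λ (a , b) (c , d) → a * c - b * d , a * d + b * c
    ; -_  = λ (a , b) → - a , - b
    ; 0#  = 0# , 0#
    ; 1#  = 1# , 0#
    }

  conj : RawRing.Carrier ℂ → RawRing.Carrier ℂ
  conj (a , b) = a , - b

module CanonicalEmbedding (ℝ : RealNumbers) (K : FieldOverℚ) where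
  open RealNumbers ℝ using (Carrier; _≈_; _#_; 0#)
  open Complex ℝ
  open RawRing ℂ using () renaming (_≈_ to _≈ℂ_; Carrier to ∣ℂ∣)

  record Embedding : Set where
    field
      map                : ∣ K ∣ᶠ → ∣ℂ∣
      isRingHomomorphism :
        RingMorphisms.IsRingHomomorphism (FieldOverℚ.rawRing K) ℂ map

    re im : ∣ K ∣ᶠ → Carrier
    re = proj₁ ∘ map
    im = proj₂ ∘ map

  open Embedding

  _≗ᴱ_ _≗ᴱ-conj_ : Rel Embedding 0ℓ
  φ ≗ᴱ ψ      = ∀ x → map φ x ≈ℂ map ψ x
  φ ≗ᴱ-conj ψ = ∀ x → map φ x ≈ℂ conj (map ψ x)

  record Embeddings (s : ℕ) : Set where
    field
      r₁ r₂        : ℕ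
      s≡r₁+2r₂     : s ≡ r₁ ℕ.+ 2 ℕ.* r₂
      realσ        : Vector Embedding r₁
      complexσ     : Vector Embedding r₂
      real         : ∀ i x → im (realσ i) x ≈ 0#
      nonreal      : ∀ i → ∃ λ x → im (complexσ i) x # 0#
      real-inj     : ∀ i k → realσ i ≗ᴱ realσ k → i ≡ k
      complex-inj  : ∀ i k → complexσ i ≗ᴱ complexσ k ⊎ complexσ i ≗ᴱ-conj complexσ k →
                     i ≡ k
      exhaustive   : ∀ φ → (∃ λ i → φ ≗ᴱ realσ i)
                         ⊎ (∃ λ i → φ ≗ᴱ complexσ i ⊎ φ ≗ᴱ-conj complexσ i)

    dim : ℕ
    dim = r₁ ℕ.+ r₂ ℕ.* 2

    canonical : ∣ K ∣ᶠ → Vector Carrier dim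
    canonical x =
      (λ i → re (realσ i) x) ++ concat (λ i → re (complexσ i) x ∷ im (complexσ i) x ∷ [])

  image : ∀ {n} → (∣ K ∣ᶠ → Vector Carrier n) → Pred ∣ K ∣ᶠ 0ℓ → Pred (Vector Carrier n) 0ℓ
  image σ M v = ∃ λ x → M x × v ≋ σ x
    where open RealNumbers ℝ using (_≋_)

------------------------------------------------------------------------
-- The ℤ-modules 𝓜 and 𝓜̃

infix 4 _≡_[mod_]
_≡_[mod_] : ℤ → ℤ → ℕ → Set
a ≡ b [mod n ] = + n ℤ.∣ a ℤ.- b

GeneratesUnits : ℕ → ℤ → Set
GeneratesUnits p u = ¬ (+ p ℤ.∣ u) ×
  (∀ a → ¬ (+ p ℤ.∣ a) → ∃ λ k → u ℤ.^ k ≡ a [mod p ])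

HasOrder : ℕ → ℤ → ℕ → Set
HasOrder p b n = b ℤ.^ n ≡ + 1 [mod p ] ×
  (∀ k → 0 ℕ.< k → k ℕ.< n → ¬ (b ℤ.^ k ≡ + 1 [mod p ]))

μ : ∀ {s} → ℤ → ℕ → Vector ℤ s
μ α i k = α ℤ.^ (toℕ k ℕ.* i)

module Modules (K : FieldOverℚ) (θ : ∣ K ∣ᶠ → ∣ K ∣ᶠ) (t : ∣ K ∣ᶠ)
               (p s : ℕ) (α : ℤ) where
  open FieldOverℚ K
  open ℤ-LinearAlgebra using (_·_) renaming (sum to sumℤ)

  HasCoordinates : Carrier → Vector ℤ s → Set
  HasCoordinates x a = x ≈ sum (λ i → fromℤ (a i) * iterate θ t (toℕ i))

  𝓜-coordinates : Pred (Vector ℤ s) 0ℓ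
  𝓜-coordinates a = ∀ i → i ℕ.≤ (s ℕ.∸ 1) / 2 → a · μ α i ≡ + 0 [mod p ]

  𝓜 : Pred Carrier 0ℓ
  𝓜 x = IsAlgebraicInteger K x × ∃ λ a → HasCoordinates x a × 𝓜-coordinates a

  𝓜̃ : Pred Carrier 0ℓ
  𝓜̃ x = 𝓜 x × ∃ λ a → HasCoordinates x a × sumℤ a ≡ + 0 [mod 2 ]

{-# OPTIONS --safe #-}

-- Write N = p - 1 = m s. Since 𝕃 has the automorphisms σᵤᵉ, the conjugates of ζ are a basis of 𝕃 over ℚ,
-- Gal (𝕃 / 𝕂) is generated by σᵤˢ, and t is a sum of conjugates ζ^(u^(h s)). Hence Tr (x²) = p Σ aᵢ² - m (Σ aᵢ)²
-- for x with coordinates a; here s odd is used for -1 being an s-th power modulo p. As s is odd, 𝕂 has a real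
-- embedding, and composing it with the powers of θ gives all embeddings, so ‖σ(x)‖² = Tr (x²).
--
-- If x ∈ 𝓜, Parseval's identity over ℤ/p for the discrete Fourier transform a ↦ (a · μᵢ)ᵢ gives p ∣ Σ aᵢ², whence
-- p² ∣ Tr (x²); if moreover Σ aᵢ is even and p odd, 2p² ∣ Tr (x²). So ρ ≥ p / √2. Every congruence modulo a prime q
-- multiplies the discriminant, which is p^(s-1) for all of 𝒪_𝕂, by at most q², so vol ≤ 2pˢ.
module Submission where

open import Defs
open import Level using (0ℓ)
open import Algebra.Apartness.Bundles using (HeytingField)
import Algebra.Apartness.Properties.HeytingCommutativeRing as HeytingProperties
open import Algebra.Bundles using (CommutativeRing)
import Algebra.Morphism.Construct.Composition as Composition
import Algebra.Morphism.Construct.Identity as Identity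
open import Algebra.Morphism.Structures using (module RingMorphisms)
import Algebra.Properties.CommutativeSemiring.Exp as Exp
import Algebra.Properties.Ring as RingProperties
import Algebra.Properties.Semiring.Mult as SemiringMult
import Algebra.Properties.Semiring.Mult.TCOptimised as SemiringMult′
import Algebra.Properties.Semiring.Sum as SemiringSum
import Algebra.Solver.Ring as RingSolver
open import Algebra.Solver.Ring.AlmostCommutativeRing using (_-Raw-AlmostCommutative⟶_; fromCommutativeRing)
open import Data.Bool.Base using (if_then_else_)
open import Data.Fin.Base as Fin using (Fin; zero; suc; toℕ; fromℕ; fromℕ<; inject₁; punchIn; punchOut; splitAt; finToFun; funToFin)
import Data.Fin.Permutation as Perm
import Data.Fin.Properties as Fin
open import Data.Integer.Base as ℤ using (ℤ; +_; -[1+_]; _%ℕ_; _/ℕ_)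
open import Data.Integer.Divisibility.Signed as ℤ∣ using (divides; ∣ᵤ⇒∣; ∣⇒∣ᵤ) renaming (_∣_ to _∣ℤ_)
import Data.Integer.DivMod as ℤ
import Data.Integer.Properties as ℤ
open import Data.Maybe.Base using (Maybe; just; nothing)
open import Data.Nat.Base as ℕ using (ℕ; zero; suc; z≤n; s≤s; _%_)
open import Data.Nat.Coprimality using (Coprime; coprime-divisor; coprime-Bézout; prime⇒coprime)
open import Data.Nat.Divisibility as ℕ∣ using () renaming (_∣_ to _∣ₙ_)
open import Data.Nat.DivMod using (_mod_; m%n<n; m≡m%n+[m/n]*n; m<n⇒m%n≡m; [m+kn]%n≡m%n; m*n/n≡m)
open import Data.Nat.GCD using (module Bézout)
open import Data.Nat.GeneralisedArithmetic using (iterate)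
open import Data.Nat.Primality using (Prime; euclidsLemma; prime⇒nonTrivial; prime[2]; prime⇒irreducible; ¬prime[0])
import Data.Nat.Properties as ℕ
open import Data.Nat.Solver using (module +-*-Solver)
open import Data.Product.Base using (∃; _×_; _,_; proj₁; proj₂)
open import Data.Rational.Base as ℚ using (ℚ; mkℚ; ↥_; ↧_; 0ℚ; 1ℚ)
import Data.Rational.Properties as ℚ
open import Data.Rational.Unnormalised.Base as ℚᵘ using (mkℚᵘ; *≡*)
import Data.Rational.Unnormalised.Properties as ℚᵘ
open import Data.Sum.Base using (_⊎_; inj₁; inj₂)
open import Data.Unit.Base using (⊤; tt)
open import Data.Vec.Functional using (Vector; _++_; concat; _∷_; [])
open import Function.Base using (_∘_; flip)
open import Function.Bundles using (mk⇔)
open import Relation.Binary.PropositionalEquality as ≡ using (_≡_; _≢_; _≗_; module ≡-Reasoning)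
import Relation.Binary.Reasoning.Setoid as SetoidReasoning
open import Relation.Binary.Structures using (IsStrictPartialOrder)
open import Relation.Nullary.Decidable using (Dec; yes; no; does; ¬?; map′; _×-dec_; decidable-stable)
open import Relation.Nullary.Negation using (¬_; contradiction)

-- Sums, determinants and integrality over a commutative ring

-- The parity condition is where the constant comes from. For odd p it doubles the lower bound p²
-- for the squared length, gaining 2^(s/2) in ρˢ, and costs at most a factor 2 in the volume; so ρˢ
-- / vol ≥ (p / √2)ˢ / (2 pˢ) = 2^(-(s+2)/2).
--
-- A packing radius has to be an attained minimum, and comparisons of reals are not decidable. The
-- geometry is therefore done over ℤ, with the form p (a · b) - m (Σ a)(Σ b) on coordinate vectors:
-- since p = m s + 1, Cauchy-Schwarz bounds it below by a · a, so a shortest vector can be found by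
-- finite search. The reals enter only through the squared inequality 2ˢ D ≤ 4 Mˢ, where M is the
-- least value of the form and D the determinant of its Gram matrix.
--
-- The degree of 𝕂 is given by some basis of s elements, with no relation to θ. That θ has order s
-- is obtained by comparing that basis with the conjugates of t, whose number is the order of θ.

module RingTheory (R : CommutativeRing 0ℓ 0ℓ) where
  open CommutativeRing R hiding (zero)
  open LinearAlgebra R
  open RingProperties ring public
    using (-‿involutive; -0#≈0#; -‿distribˡ-*; -‿distribʳ-*; -‿+-comm; x∙y⁻¹≈ε⇒x≈y; x≈y⇒x∙y⁻¹≈ε; +-cancelʳ)
  open SemiringSum semiring public
    using (sum-cong-≋; ∑-distrib-+; ∑-comm; *-distribˡ-sum; *-distribʳ-sum; sum-permute; sum-replicate; sum-cong-≗)
  open Exp commutativeSemiring public using (^-congˡ; ^-homo-*; ^-assocʳ; ^-distrib-*)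
  open SemiringMult semiring public using (×-homo-+; ×1-homo-*; ×-assoc-*; ×-cong)
  open SetoidReasoning setoid

  fromℤ-⊖ : ∀ m n → fromℤ (m ℤ.⊖ n) ≈ m ×ℕ 1# - n ×ℕ 1#
  fromℤ-⊖ m       zero    = sym (trans (+-congˡ -0#≈0#) (+-identityʳ _))
  fromℤ-⊖ zero    (suc n) = sym (+-identityˡ _)
  fromℤ-⊖ (suc m) (suc n) = begin
    fromℤ (suc m ℤ.⊖ suc n) ≡⟨ ≡.cong fromℤ (ℤ.[1+m]⊖[1+n]≡m⊖n m n) ⟩
    fromℤ (m ℤ.⊖ n) ≈⟨ fromℤ-⊖ m n ⟩
    M - N ≈⟨ +-identityˡ _ ⟨
    0# + (M - N) ≈⟨ +-congʳ (-‿inverseʳ 1#) ⟨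
    (1# - 1#) + (M - N) ≈⟨ +-assoc 1# (- 1#) _ ⟩
    1# + (- 1# + (M - N)) ≈⟨ +-congˡ (trans (sym (+-assoc _ _ _)) (trans (+-congʳ (+-comm _ _)) (+-assoc _ _ _))) ⟩
    1# + (M + (- 1# - N)) ≈⟨ +-assoc 1# M _ ⟨
    (1# + M) + (- 1# - N) ≈⟨ +-congˡ (-‿+-comm 1# N) ⟩
    suc m ×ℕ 1# - suc n ×ℕ 1# ∎
    where
    M = m ×ℕ 1#
    N = n ×ℕ 1#

  fromℤ-+ : ∀ x y → fromℤ (x ℤ.+ y) ≈ fromℤ x + fromℤ y
  fromℤ-+ (+ m)    (+ n)    = ×-homo-+ 1# m n
  fromℤ-+ (+ m)    -[1+ n ] = fromℤ-⊖ m (suc n)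
  fromℤ-+ -[1+ m ] (+ n)    = trans (fromℤ-⊖ n (suc m)) (+-comm _ _)
  fromℤ-+ -[1+ m ] -[1+ n ] = begin
    - (suc (suc (m ℕ.+ n)) ×ℕ 1#) ≡⟨ ≡.cong (λ k → - (k ×ℕ 1#)) (ℕ.+-suc (suc m) n) ⟨
    - ((suc m ℕ.+ suc n) ×ℕ 1#) ≈⟨ -‿cong (×-homo-+ 1# (suc m) (suc n)) ⟩
    - (suc m ×ℕ 1# + suc n ×ℕ 1#) ≈⟨ -‿+-comm _ _ ⟨
    - (suc m ×ℕ 1#) - suc n ×ℕ 1# ∎

  fromℤ-neg : ∀ x → fromℤ (ℤ.- x) ≈ - fromℤ x
  fromℤ-neg (+ zero)  = sym -0#≈0#
  fromℤ-neg (+ suc n) = refl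
  fromℤ-neg -[1+ n ]  = sym (-‿involutive _)

  private
    fromℤ-*⁺ : ∀ m y → fromℤ (+ m ℤ.* y) ≈ fromℤ (+ m) * fromℤ y
    fromℤ-*⁺ m (+ n) = trans (reflexive (≡.cong fromℤ (≡.sym (ℤ.pos-* m n)))) (×1-homo-* m n)
    fromℤ-*⁺ m -[1+ n ] = begin
      fromℤ (+ m ℤ.* ℤ.- (+ suc n)) ≡⟨ ≡.cong fromℤ (ℤ.neg-distribʳ-* (+ m) (+ suc n)) ⟨
      fromℤ (ℤ.- (+ m ℤ.* + suc n)) ≈⟨ fromℤ-neg (+ m ℤ.* + suc n) ⟩
      - fromℤ (+ m ℤ.* + suc n) ≈⟨ -‿cong (fromℤ-*⁺ m (+ suc n)) ⟩
      - (fromℤ (+ m) * fromℤ (+ suc n)) ≈⟨ -‿distribʳ-* _ _ ⟩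
      fromℤ (+ m) * - fromℤ (+ suc n) ∎

  fromℤ-* : ∀ x y → fromℤ (x ℤ.* y) ≈ fromℤ x * fromℤ y
  fromℤ-* (+ m)    y = fromℤ-*⁺ m y
  fromℤ-* -[1+ m ] y = begin
    fromℤ (ℤ.- (+ suc m) ℤ.* y) ≡⟨ ≡.cong fromℤ (ℤ.neg-distribˡ-* (+ suc m) y) ⟨
    fromℤ (ℤ.- (+ suc m ℤ.* y)) ≈⟨ fromℤ-neg (+ suc m ℤ.* y) ⟩
    - fromℤ (+ suc m ℤ.* y) ≈⟨ -‿cong (fromℤ-*⁺ (suc m) y) ⟩
    - (fromℤ (+ suc m) * fromℤ y) ≈⟨ -‿distribˡ-* _ _ ⟩
    - fromℤ (+ suc m) * fromℤ y ∎

  fromℤ-1 : fromℤ (+ 1) ≈ 1#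
  fromℤ-1 = +-identityʳ 1#

  fromℤ-sub : ∀ x y → fromℤ (x ℤ.- y) ≈ fromℤ x - fromℤ y
  fromℤ-sub x y = trans (fromℤ-+ x (ℤ.- y)) (+-congˡ (fromℤ-neg y))

  fromℤ-sum : ∀ {n} (f : Vector ℤ n) → fromℤ (ℤ-LinearAlgebra.sum f) ≈ sum (fromℤ ∘ f)
  fromℤ-sum {zero}  f = refl
  fromℤ-sum {suc n} f = trans (fromℤ-+ (f zero) _) (+-congˡ (fromℤ-sum (f ∘ suc)))

  -- The solver reads constants with the optimised multiplication _×′_, for which
  -- 1 ×′ 1# and 2 ×′ 1# reduce to 1# and 1# + 1#.
  private
    open SemiringMult′ semiring using () renaming (_×_ to _×′_; ×ᵤ≈× to ×≈×′)

    const : ℤ → Carrier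
    const (+ n)    = n ×′ 1#
    const -[1+ n ] = - (suc n ×′ 1#)

    const≈ : ∀ x → const x ≈ fromℤ x
    const≈ (+ n)    = sym (×≈×′ n 1#)
    const≈ -[1+ n ] = -‿cong (sym (×≈×′ (suc n) 1#))

    const-morphism : ℤ.+-*-rawRing -Raw-AlmostCommutative⟶ fromCommutativeRing R
    const-morphism = record
      { ⟦_⟧    = const
      ; +-homo = λ x y → trans (const≈ (x ℤ.+ y)) (trans (fromℤ-+ x y) (sym (+-cong (const≈ x) (const≈ y))))
      ; *-homo = λ x y → trans (const≈ (x ℤ.* y)) (trans (fromℤ-* x y) (sym (*-cong (const≈ x) (const≈ y))))
      ; -‿homo = λ x → trans (const≈ (ℤ.- x)) (trans (fromℤ-neg x) (sym (-‿cong (const≈ x))))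
      ; 0-homo = refl
      ; 1-homo = refl
      }

    const-≟ : ∀ x y → Maybe (const x ≈ const y)
    const-≟ x y with x ℤ.≟ y
    ... | yes x≡y = just (reflexive (≡.cong const x≡y))
    ... | no _    = nothing

  module Solver = RingSolver ℤ.+-*-rawRing (fromCommutativeRing R) const-morphism const-≟

  open Solver using (solve; _:=_; _:+_; _:*_; _:-_; :-_; con)

  x-y≈0⇒x≈y : ∀ {x y} → x - y ≈ 0# → x ≈ y
  x-y≈0⇒x≈y {x} {y} = x∙y⁻¹≈ε⇒x≈y x y

  x≈y⇒x-y≈0 : ∀ {x y} → x ≈ y → x - y ≈ 0#
  x≈y⇒x-y≈0 = x≈y⇒x∙y⁻¹≈ε

  ×ℕ≈* : ∀ n x → n ×ℕ x ≈ (n ×ℕ 1#) * x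
  ×ℕ≈* n x = sym (trans (×-assoc-* n 1# x) (×-cong (≡.refl {x = n}) (*-identityˡ x)))

  1^n≈1 : ∀ n → 1# ^ n ≈ 1#
  1^n≈1 zero    = refl
  1^n≈1 (suc n) = trans (*-identityˡ _) (1^n≈1 n)

  sum-zero : ∀ {n} {f : Vector Carrier n} → (∀ i → f i ≈ 0#) → sum f ≈ 0#
  sum-zero {zero}  f≈0 = refl
  sum-zero {suc n} f≈0 = trans (+-cong (f≈0 zero) (sum-zero (f≈0 ∘ suc))) (+-identityˡ 0#)

  sum-neg : ∀ {n} (f : Vector Carrier n) → sum (λ i → - f i) ≈ - sum f
  sum-neg {zero}  f = sym -0#≈0#
  sum-neg {suc n} f = trans (+-congˡ (sum-neg (f ∘ suc))) (-‿+-comm _ _)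

  sum-sub : ∀ {n} (f g : Vector Carrier n) → sum (λ i → f i - g i) ≈ sum f - sum g
  sum-sub f g = trans (∑-distrib-+ f (λ i → - g i)) (+-congˡ (sum-neg g))

  sum-const : ∀ {n} x → sum {n} (λ _ → x) ≈ (n ×ℕ 1#) * x
  sum-const {n} x = trans (sum-replicate n) (×ℕ≈* n x)

  sum-single : ∀ {n} (f : Vector Carrier n) i → (∀ j → j ≢ i → f j ≈ 0#) → sum f ≈ f i
  sum-single f zero    f≈0 = trans (+-congˡ (sum-zero (λ j → f≈0 (suc j) λ ()))) (+-identityʳ _)
  sum-single f (suc i) f≈0 = trans
    (+-cong (f≈0 zero λ ()) (sum-single (f ∘ suc) i (λ j j≢i → f≈0 (suc j) (j≢i ∘ Fin.suc-injective))))
    (+-identityˡ _)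

  δ : ∀ {n} → Fin n → Fin n → Carrier
  δ i j = if does (i Fin.≟ j) then 1# else 0#

  δ-diag : ∀ {n} (i : Fin n) → δ i i ≈ 1#
  δ-diag i with i Fin.≟ i
  ... | yes _   = refl
  ... | no i≢i = contradiction ≡.refl i≢i

  δ-off : ∀ {n} {i j : Fin n} → i ≢ j → δ i j ≈ 0#
  δ-off {i = i} {j} i≢j with i Fin.≟ j
  ... | yes i≡j = contradiction i≡j i≢j
  ... | no _    = refl

  δ-sym : ∀ {n} (i j : Fin n) → δ i j ≈ δ j i
  δ-sym i j with i Fin.≟ j
  ... | yes ≡.refl = sym (δ-diag i)
  ... | no i≢j     = sym (δ-off (i≢j ∘ ≡.sym))

  sum-δʳ : ∀ {n} (f : Vector Carrier n) i → sum (λ j → f j * δ j i) ≈ f i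
  sum-δʳ f i = trans
    (sum-single (λ j → f j * δ j i) i (λ j j≢i → trans (*-congˡ (δ-off j≢i)) (zeroʳ _)))
    (trans (*-congˡ (δ-diag i)) (*-identityʳ _))

  sum-δˡ : ∀ {n} (f : Vector Carrier n) i → sum (λ j → δ i j * f j) ≈ f i
  sum-δˡ {n} f i = trans (sum-cong-≋ {n} (λ j → trans (*-comm _ _) (*-congˡ (δ-sym i j)))) (sum-δʳ f i)

  sum-suc : ∀ n (f : ℕ → Carrier) → sum {n} (λ i → f (suc (toℕ i))) + f 0 ≈ sum {n} (λ i → f (toℕ i)) + f n
  sum-suc zero    f = refl
  sum-suc (suc n) f = begin
    (f 1 + S) + f 0 ≈⟨ +-comm _ _ ⟩
    f 0 + (f 1 + S) ≈⟨ +-congˡ (trans (+-comm _ _) (sum-suc n (f ∘ suc))) ⟩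
    f 0 + (S′ + f (suc n)) ≈⟨ +-assoc _ _ _ ⟨
    (f 0 + S′) + f (suc n) ∎
    where
    S  = sum {n} (λ i → f (suc (suc (toℕ i))))
    S′ = sum {n} (λ i → f (suc (toℕ i)))

  -- Moving the window by one trades `f k` for `f (k + n)`, which are equal by periodicity. This is
  -- the reindexing behind all sums over exponents of ζ modulo p and over powers of σ modulo N.
  sum-shift : ∀ n (f : ℕ → Carrier) → (∀ e → f (e ℕ.+ n) ≈ f e) →
              ∀ k → sum {n} (λ i → f (toℕ i ℕ.+ k)) ≈ sum {n} (f ∘ toℕ)
  sum-shift n f per zero    = sum-cong-≋ {n} (λ i → reflexive (≡.cong f (ℕ.+-identityʳ (toℕ i))))
  sum-shift n f per (suc k) = begin
    sum {n} (λ i → f (toℕ i ℕ.+ suc k)) ≡⟨ sum-cong-≗ {n} (λ i → ≡.cong f (ℕ.+-suc (toℕ i) k)) ⟩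
    sum {n} (λ i → g (suc (toℕ i))) ≈⟨ +-cancelʳ (g 0) _ _ (trans (sum-suc n g) (+-congˡ gn≈g0)) ⟩
    sum {n} (g ∘ toℕ) ≈⟨ sum-shift n f per k ⟩
    sum {n} (f ∘ toℕ) ∎
    where
    g : ℕ → Carrier
    g e = f (e ℕ.+ k)
    gn≈g0 : g n ≈ g 0
    gn≈g0 = trans (reflexive (≡.cong f (ℕ.+-comm n k))) (per k)

  sum-++ : ∀ m n (f : ℕ → Carrier) →
           sum {m ℕ.+ n} (f ∘ toℕ) ≈ sum {m} (f ∘ toℕ) + sum {n} (λ i → f (m ℕ.+ toℕ i))
  sum-++ zero    n f = sym (+-identityˡ _)
  sum-++ (suc m) n f = trans (+-congˡ (sum-++ m n (f ∘ suc))) (sym (+-assoc _ _ _))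

  sum-blocks : ∀ m d (f : ℕ → Carrier) →
               sum {m ℕ.* d} (f ∘ toℕ) ≈ sum {m} (λ h → sum {d} (λ i → f (toℕ h ℕ.* d ℕ.+ toℕ i)))
  sum-blocks zero    d f = refl
  sum-blocks (suc m) d f = trans (sum-++ d (m ℕ.* d) f) (+-congˡ (trans
    (sum-blocks m d (f ∘ (d ℕ.+_)))
    (sum-cong-≋ {m} λ h → sum-cong-≋ {d} λ i → reflexive (≡.cong f (≡.sym (ℕ.+-assoc d (toℕ h ℕ.* d) (toℕ i)))))))

  -- The exponents add up to `n` instead of `n - 1`, hence the extra factor `b`. In this form it
  -- matches the products of the Fourier coefficients at i and s - i; the right side vanishes for
  -- two s-th roots of unity.
  sum-geometric : ∀ a b n →
    (a - b) * sum {n} (λ i → a ^ toℕ i * b ^ (n ℕ.∸ toℕ i)) ≈ b * (a ^ n - b ^ n)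
  sum-geometric a b zero    = trans (zeroʳ _) (sym (trans (*-congˡ (-‿inverseʳ 1#)) (zeroʳ b)))
  sum-geometric a b (suc n) = begin
    (a - b) * (1# * b ^ suc n + sum {n} (λ i → (a * a ^ toℕ i) * b ^ (n ℕ.∸ toℕ i)))
      ≈⟨ *-congˡ (+-congˡ (trans (sum-cong-≋ {n} (λ i → *-assoc a _ _)) (sym (*-distribˡ-sum {n} a _)))) ⟩
    (a - b) * (1# * (b * b ^ n) + a * S)
      ≈⟨ solve 4 (λ a b B S → (a :- b) :* (con (+ 1) :* (b :* B) :+ a :* S) := (a :- b) :* (b :* B) :+ a :* ((a :- b) :* S)) refl a b (b ^ n) S ⟩
    (a - b) * (b * b ^ n) + a * ((a - b) * S)
      ≈⟨ +-congˡ (*-congˡ (sum-geometric a b n)) ⟩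
    (a - b) * (b * b ^ n) + a * (b * (a ^ n - b ^ n))
      ≈⟨ solve 4 (λ a b A B → (a :- b) :* (b :* B) :+ a :* (b :* (A :- B)) := b :* (a :* A :- b :* B)) refl a b (a ^ n) (b ^ n) ⟩
    b * (a ^ suc n - b ^ suc n) ∎
    where
    S = sum {n} (λ i → a ^ toℕ i * b ^ (n ℕ.∸ toℕ i))

module _ (R : CommutativeRing 0ℓ 0ℓ) where
  open CommutativeRing R hiding (zero)
  open LinearAlgebra R
  open RingTheory R

  fromℤ-isRingHomomorphism : RingMorphisms.IsRingHomomorphism ℤ.+-*-rawRing rawRing fromℤ
  fromℤ-isRingHomomorphism = record
    { isSemiringHomomorphism = record
      { isNearSemiringHomomorphism = record
        { +-isMonoidHomomorphism = record
          { isMagmaHomomorphism = record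
            { isRelHomomorphism = record { cong = λ { ≡.refl → refl } }
            ; homo = fromℤ-+
            }
          ; ε-homo = refl
          }
        ; *-homo = fromℤ-*
        }
      ; 1#-homo = fromℤ-1
      }
    ; -‿homo = fromℤ-neg
    }

  fromℤ-δ : ∀ {n} (i j : Fin n) → fromℤ (RingTheory.δ ℤ.+-*-commutativeRing i j) ≈ δ i j
  fromℤ-δ i j with i Fin.≟ j
  ... | yes _ = fromℤ-1
  ... | no _  = refl

module ℤ-Ring = RingTheory ℤ.+-*-commutativeRing

-- Determinants from the Laplace expansion

module Determinant (R : CommutativeRing 0ℓ 0ℓ) where
  open CommutativeRing R hiding (zero)
  open LinearAlgebra R
  open RingTheory R
  open SetoidReasoning setoid
  open Solver using (solve; _:=_; _:+_; _:*_; _:-_; :-_; con)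

  Matrix : ℕ → Set
  Matrix n = Vector (Vector Carrier n) n

  det-cong : ∀ n {M M′ : Matrix n} → (∀ i k → M i k ≈ M′ i k) → det M ≈ det M′
  det-cong zero    M≈M′ = refl
  det-cong (suc n) M≈M′ = sum-cong-≋ {suc n} λ j →
    *-cong (*-congˡ {x = (- 1#) ^ toℕ j} (M≈M′ zero j)) (det-cong n (λ i k → M≈M′ (suc i) (punchIn j k)))

  -- Three matrices related entrywise, instead of a replaced row in one matrix: the hypotheses pass
  -- to the minors unchanged, which is what the induction needs when `r` is not the first row.
  det-linear : ∀ n (r : Fin n) x y {M M′ M″ : Matrix n} →
               (∀ k → M r k ≈ x * M′ r k + y * M″ r k) →
               (∀ i → i ≢ r → ∀ k → M i k ≈ M′ i k) →
               (∀ i → i ≢ r → ∀ k → M i k ≈ M″ i k) →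
               det M ≈ x * det M′ + y * det M″
  det-linear (suc n) r x y {M} {M′} {M″} row-r M≈M′ M≈M″ = begin
    sum (λ j → s j * M zero j * D M j)
      ≈⟨ sum-cong-≋ {suc n} (term r row-r M≈M′ M≈M″) ⟩
    sum (λ j → x * (s j * M′ zero j * D M′ j) + y * (s j * M″ zero j * D M″ j))
      ≈⟨ ∑-distrib-+ {suc n} (λ j → x * t M′ j) (λ j → y * t M″ j) ⟩
    sum (λ j → x * t M′ j) + sum (λ j → y * t M″ j)
      ≈⟨ +-cong (*-distribˡ-sum {suc n} x (t M′)) (*-distribˡ-sum {suc n} y (t M″)) ⟨
    x * det M′ + y * det M″ ∎
    where
    s : Fin (suc n) → Carrier
    s j = (- 1#) ^ toℕ j
    D : Matrix (suc n) → Fin (suc n) → Carrier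
    D M j = det (λ i k → M (suc i) (punchIn j k))
    t : Matrix (suc n) → Fin (suc n) → Carrier
    t M j = s j * M zero j * D M j
    term : ∀ r → (∀ k → M r k ≈ x * M′ r k + y * M″ r k) →
           (∀ i → i ≢ r → ∀ k → M i k ≈ M′ i k) →
           (∀ i → i ≢ r → ∀ k → M i k ≈ M″ i k) → ∀ j →
           s j * M zero j * D M j ≈ x * (s j * M′ zero j * D M′ j) + y * (s j * M″ zero j * D M″ j)
    term zero row-r M≈M′ M≈M″ j = begin
      s j * M zero j * D M j
        ≈⟨ *-congʳ (*-congˡ (row-r j)) ⟩
      s j * (x * M′ zero j + y * M″ zero j) * D M j
        ≈⟨ solve 6 (λ s x y a b d → s :* (x :* a :+ y :* b) :* d := x :* (s :* a :* d) :+ y :* (s :* b :* d)) refl (s j) x y _ _ _ ⟩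
      x * (s j * M′ zero j * D M j) + y * (s j * M″ zero j * D M j)
        ≈⟨ +-cong (*-congˡ (*-congˡ (det-cong n (λ i k → M≈M′ (suc i) (λ ()) _))))
                  (*-congˡ (*-congˡ (det-cong n (λ i k → M≈M″ (suc i) (λ ()) _)))) ⟩
      x * (s j * M′ zero j * D M′ j) + y * (s j * M″ zero j * D M″ j) ∎
    term (suc r) row-r M≈M′ M≈M″ j = begin
      s j * M zero j * D M j
        ≈⟨ *-congˡ (det-linear n r x y (λ k → row-r _)
             (λ i i≢r k → M≈M′ (suc i) (i≢r ∘ Fin.suc-injective) _)
             (λ i i≢r k → M≈M″ (suc i) (i≢r ∘ Fin.suc-injective) _)) ⟩
      s j * M zero j * (x * D M′ j + y * D M″ j)
        ≈⟨ solve 6 (λ s x y a d e → s :* a :* (x :* d :+ y :* e) := x :* (s :* a :* d) :+ y :* (s :* a :* e)) refl (s j) x y _ _ _ ⟩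
      x * (s j * M zero j * D M′ j) + y * (s j * M zero j * D M″ j)
        ≈⟨ +-cong (*-congˡ (*-congʳ (*-congˡ (M≈M′ zero (λ ()) j))))
                  (*-congˡ (*-congʳ (*-congˡ (M≈M″ zero (λ ()) j)))) ⟩
      x * (s j * M′ zero j * D M′ j) + y * (s j * M″ zero j * D M″ j) ∎

  det-zero-row : ∀ n (r : Fin n) (M : Matrix n) → (∀ k → M r k ≈ 0#) → det M ≈ 0#
  det-zero-row n r M Mr≈0 = trans
    (det-linear n r 0# 0# (λ k → trans (Mr≈0 k) (sym 0+0)) (λ _ _ _ → refl) (λ _ _ _ → refl))
    0+0
    where
    0+0 : ∀ {x y} → 0# * x + 0# * y ≈ 0#
    0+0 = trans (+-cong (zeroˡ _) (zeroˡ _)) (+-identityˡ _)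

  -- The terms at the corner agree. In the others, expanding each minor along its own first column
  -- gives a double sum over a row and a column to be deleted, and exchanging the two sums gives the
  -- expansion by columns.
  det-expand-column : ∀ n (M : Matrix (suc n)) →
    det M ≈ sum (λ i → (- 1#) ^ toℕ i * M i zero * det (λ r k → M (punchIn i r) (suc k)))
  det-expand-column zero    M = refl
  det-expand-column (suc n) M = +-congˡ (begin
    sum (λ j → A j * det (λ i k → M (suc i) (punchIn (suc j) k)))
      ≈⟨ sum-cong-≋ {suc n} (λ j → *-congˡ {x = A j} (det-expand-column n (λ i k → M (suc i) (punchIn (suc j) k)))) ⟩
    sum (λ j → A j * sum (λ i → s i * b i * D i j))
      ≈⟨ sum-cong-≋ {suc n} (λ j → *-distribˡ-sum {suc n} (A j) (λ i → s i * b i * D i j)) ⟩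
    sum (λ j → sum (λ i → A j * (s i * b i * D i j)))
      ≈⟨ ∑-comm {suc n} {suc n} (λ j i → A j * (s i * b i * D i j)) ⟩
    sum (λ i → sum (λ j → A j * (s i * b i * D i j)))
      ≈⟨ sum-cong-≋ {suc n} (λ i → sum-cong-≋ {suc n} (λ j →
           solve 6 (λ u s a t b d → u :* s :* a :* (t :* b :* d) := u :* t :* b :* (s :* a :* d))
             refl (- 1#) (s j) (a j) (s i) (b i) (D i j))) ⟩
    sum (λ i → sum (λ j → B i * (s j * a j * D i j)))
      ≈⟨ sum-cong-≋ {suc n} (λ i → *-distribˡ-sum {suc n} (B i) (λ j → s j * a j * D i j)) ⟨
    sum (λ i → B i * sum (λ j → s j * a j * D i j)) ∎)
    where
    s : Fin (suc n) → Carrier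
    s j = (- 1#) ^ toℕ j
    a b A B : Fin (suc n) → Carrier
    a j = M zero (suc j)
    b i = M (suc i) zero
    A j = - 1# * s j * a j
    B i = - 1# * s i * b i
    D : Fin (suc n) → Fin (suc n) → Carrier
    D i j = det (λ r k → M (suc (punchIn i r)) (suc (punchIn j k)))

  det-transpose : ∀ n (M : Matrix n) → det M ≈ det (flip M)
  det-transpose zero    M = refl
  det-transpose (suc n) M = trans (det-expand-column n M)
    (sum-cong-≋ {suc n} (λ i → *-congˡ {x = (- 1#) ^ toℕ i * M i zero} (det-transpose n (λ r k → M (punchIn i r) (suc k)))))

  setRow : ∀ {n} → Matrix n → Fin n → Vector Carrier n → Matrix n
  setRow M r v i = if does (i Fin.≟ r) then v else M i

  setRow-≡ : ∀ {n} (M : Matrix n) r v → setRow M r v r ≡ v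
  setRow-≡ M r v with r Fin.≟ r
  ... | yes _   = ≡.refl
  ... | no r≢r = contradiction ≡.refl r≢r

  setRow-≢ : ∀ {n} (M : Matrix n) {r} v {i} → i ≢ r → setRow M r v i ≡ M i
  setRow-≢ M {r} v {i} i≢r with i Fin.≟ r
  ... | yes i≡r = contradiction i≡r i≢r
  ... | no _    = ≡.refl

  private
    at : ∀ {n} {v w : Vector Carrier n} → v ≡ w → ∀ k → v k ≈ w k
    at ≡.refl k = refl

  Alternating : ℕ → Set
  Alternating n = ∀ (M : Matrix n) a b → a ≢ b → (∀ k → M a k ≈ M b k) → det M ≈ 0#

  private
    addRow : ∀ n → Alternating n → ∀ c (a b : Fin n) → a ≢ b → (M M′ : Matrix n) →
             (∀ k → M′ a k ≈ M a k + c * M b k) → (∀ i → i ≢ a → ∀ k → M′ i k ≈ M i k) →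
             det M′ ≈ det M
    addRow n alt c a b a≢b M M′ row-a M′≈M = begin
      det M′ ≈⟨ det-linear n a 1# c {M′} {M} {M″}
                                 (λ k → trans (row-a k) (+-cong (sym (*-identityˡ _))
                                   (*-congˡ (sym (at (setRow-≡ M a (M b)) k)))))
                                 M′≈M
                                 (λ i i≢a k → trans (M′≈M i i≢a k) (sym (at (setRow-≢ M (M b) i≢a) k))) ⟩
      1# * det M + c * det M″ ≈⟨ +-cong (*-identityˡ _) (trans (*-congˡ M″≈0) (zeroʳ c)) ⟩
      det M + 0# ≈⟨ +-identityʳ _ ⟩
      det M ∎
      where
      M″ = setRow M a (M b)
      M″≈0 : det M″ ≈ 0#
      M″≈0 = alt M″ a b a≢b (λ k → trans (at (setRow-≡ M a (M b)) k)
                                         (sym (at (setRow-≢ M (M b) (a≢b ∘ ≡.sym)) k)))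

    -- Both rows lie below the first one, so the operation happens inside the minors and requires
    -- alternation only in size `n`. This keeps the induction for size `n + 1` from being circular.
    addRow-suc : ∀ n → Alternating n → ∀ c (a b : Fin n) → a ≢ b → (M M′ : Matrix (suc n)) →
                 (∀ k → M′ (suc a) k ≈ M (suc a) k + c * M (suc b) k) →
                 (∀ i → i ≢ suc a → ∀ k → M′ i k ≈ M i k) → det M′ ≈ det M
    addRow-suc n alt c a b a≢b M M′ row-a M′≈M = sum-cong-≋ {suc n} λ j →
      *-cong (*-congˡ {x = (- 1#) ^ toℕ j} (M′≈M zero (λ ()) j))
        (addRow n alt c a b a≢b (λ i k → M (suc i) (punchIn j k)) (λ i k → M′ (suc i) (punchIn j k)) (λ k → row-a _)
          (λ i i≢a k → M′≈M (suc i) (i≢a ∘ Fin.suc-injective) _))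

    -- In the expansion along the first column the first two terms cancel, and every other minor
    -- again has two equal rows on top.
    alternating-01 : ∀ n (M : Matrix (suc (suc n))) → (∀ k → M zero k ≈ M (suc zero) k) → det M ≈ 0#
    alternating-01 n M M0≈M1 = begin
      det M ≈⟨ det-expand-column (suc n) M ⟩
      1# * M zero zero * D zero + (- 1# * 1# * M (suc zero) zero * D (suc zero) + sum (λ i → T (suc (suc i))))
        ≈⟨ +-cong (*-cong (*-congˡ (M0≈M1 zero)) (det-cong (suc n) minors)) (+-congˡ (sum-zero {n} (rest n M M0≈M1))) ⟩
      1# * M (suc zero) zero * D (suc zero) + (- 1# * 1# * M (suc zero) zero * D (suc zero) + 0#)
        ≈⟨ solve 2 (λ a d → con (+ 1) :* a :* d :+ (:- con (+ 1) :* con (+ 1) :* a :* d :+ con (+ 0)) := con (+ 0)) refl _ _ ⟩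
      0# ∎
      where
      D T : Fin (suc (suc n)) → Carrier
      D i = det (λ r k → M (punchIn i r) (suc k))
      T i = (- 1#) ^ toℕ i * M i zero * D i
      minors : ∀ r k → M (punchIn zero r) (suc k) ≈ M (punchIn (suc zero) r) (suc k)
      minors zero    k = sym (M0≈M1 (suc k))
      minors (suc r) k = refl
      rest : ∀ n (M : Matrix (suc (suc n))) → (∀ k → M zero k ≈ M (suc zero) k) → ∀ (i : Fin n) →
             (- 1#) ^ toℕ (suc (suc i)) * M (suc (suc i)) zero * det (λ r k → M (punchIn (suc (suc i)) r) (suc k)) ≈ 0#
      rest (suc n) M M0≈M1 i = trans (*-congˡ (alternating-01 n (λ r k → M (punchIn (suc (suc i)) r) (suc k)) (λ k → M0≈M1 (suc k)))) (zeroʳ _)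

    -- Three row operations below the first row bring row `suc b` up to row 1: the pair (A, B)
    -- becomes (A + B, B), then (A + B, -A), then (B, -A).
    alternating-0 : ∀ n → Alternating n → (M : Matrix (suc n)) → ∀ b → (∀ k → M zero k ≈ M (suc b) k) → det M ≈ 0#
    alternating-0 (suc n) alt M zero    M0≈Mb = alternating-01 n M M0≈Mb
    alternating-0 (suc n) alt M (suc b) M0≈Mb = begin
      det M ≈⟨ addRow-suc (suc n) alt 1# x y (λ ()) M M₁ (at₁ (setRow-≡ M (suc x) _)) (λ i i≢ → at (setRow-≢ M _ i≢)) ⟨
      det M₁ ≈⟨ addRow-suc (suc n) alt (- 1#) y x (λ ()) M₁ M₂ (at₁ (setRow-≡ M₁ (suc y) _)) (λ i i≢ → at (setRow-≢ M₁ _ i≢)) ⟨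
      det M₂ ≈⟨ addRow-suc (suc n) alt 1# x y (λ ()) M₂ M₃ (at₁ (setRow-≡ M₂ (suc x) _)) (λ i i≢ → at (setRow-≢ M₂ _ i≢)) ⟨
      det M₃ ≈⟨ alternating-01 n M₃ (λ k → begin
                  M₂ zero k ≡⟨⟩
                  M zero k ≈⟨ M0≈Mb k ⟩
                  B k ≈⟨ solve 2 (λ a b → b := (a :+ con (+ 1) :* b) :+ con (+ 1) :* (b :+ :- con (+ 1) :* (a :+ con (+ 1) :* b))) refl (A k) (B k) ⟩
                  (A k + 1# * B k) + 1# * (B k + - 1# * (A k + 1# * B k)) ≈⟨ +-congˡ (*-congˡ (at₁ (setRow-≡ M₁ (suc y) (λ k → M₁ (suc y) k + - 1# * M₁ (suc x) k)) k)) ⟨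
                  M₃ (suc zero) k ∎) ⟩
      0# ∎
      where
      x y : Fin (suc n)
      x = zero
      y = suc b
      A B : Vector Carrier (suc (suc n))
      A = M (suc x)
      B = M (suc y)
      M₁ M₂ M₃ : Matrix (suc (suc n))
      M₁ = setRow M (suc x) (λ k → M (suc x) k + 1# * M (suc y) k)
      M₂ = setRow M₁ (suc y) (λ k → M₁ (suc y) k + - 1# * M₁ (suc x) k)
      M₃ = setRow M₂ (suc x) (λ k → M₂ (suc x) k + 1# * M₂ (suc y) k)
      at₁ : ∀ {v w : Vector Carrier (suc (suc n))} → v ≡ w → ∀ k → v k ≈ w k
      at₁ = at

  det-alternating : ∀ n → Alternating n
  det-alternating (suc n) M zero    zero    a≢b _ = contradiction ≡.refl a≢b
  det-alternating (suc n) M zero    (suc b) a≢b Ma≈Mb = alternating-0 n (det-alternating n) M b Ma≈Mb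
  det-alternating (suc n) M (suc a) zero    a≢b Ma≈Mb = alternating-0 n (det-alternating n) M a (sym ∘ Ma≈Mb)
  det-alternating (suc n) M (suc a) (suc b) a≢b Ma≈Mb = sum-zero {suc n} λ j →
    trans (*-congˡ (det-alternating n (λ i k → M (suc i) (punchIn j k)) a b (a≢b ∘ ≡.cong suc) (λ k → Ma≈Mb _))) (zeroʳ ((- 1#) ^ toℕ j * M zero j))

  private
    det-sum-row : ∀ n m (M : Matrix n) r x (u : Vector (Vector Carrier n) m) →
                  det (setRow M r (linComb x u)) ≈ sum (λ i → x i * det (setRow M r (u i)))
    det-sum-row n zero    M r x u = det-zero-row n r (setRow M r (linComb x u)) (at (setRow-≡ M r _))
    det-sum-row n (suc m) M r x u = trans
      (det-linear n r (x zero) 1# {setRow M r (linComb x u)} {setRow M r (u zero)} {setRow M r (linComb (x ∘ suc) (u ∘ suc))}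
        (λ k → trans (at (setRow-≡ M r _) k) (sym (+-cong (*-congˡ (at (setRow-≡ M r _) k))
                 (trans (*-identityˡ _) (at (setRow-≡ M r _) k)))))
        (λ i i≢r k → trans (at (setRow-≢ M _ i≢r) k) (sym (at (setRow-≢ M _ i≢r) k)))
        (λ i i≢r k → trans (at (setRow-≢ M _ i≢r) k) (sym (at (setRow-≢ M _ i≢r) k))))
      (+-congˡ (trans (*-identityˡ _) (det-sum-row n m M r (x ∘ suc) (u ∘ suc))))

  det-setRow-linComb : ∀ n (M : Matrix n) r x → det (setRow M r (linComb x M)) ≈ x r * det M
  det-setRow-linComb n M r x = begin
    det (setRow M r (linComb x M)) ≈⟨ det-sum-row n n M r x M ⟩
    sum (λ i → x i * det (setRow M r (M i))) ≈⟨ sum-single {n} _ r (λ i i≢r → trans (*-congˡ (repeated i i≢r)) (zeroʳ _)) ⟩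
    x r * det (setRow M r (M r)) ≈⟨ *-congˡ (det-cong n same) ⟩
    x r * det M ∎
    where
    repeated : ∀ i → i ≢ r → det (setRow M r (M i)) ≈ 0#
    repeated i i≢r = det-alternating n (setRow M r (M i)) r i (i≢r ∘ ≡.sym) (λ k →
      trans (at (setRow-≡ M r (M i)) k) (sym (at (setRow-≢ M (M i) i≢r) k)))
    same : ∀ i k → setRow M r (M r) i k ≈ M i k
    same i k with i Fin.≟ r
    ... | yes ≡.refl = refl
    ... | no _       = refl

  -- Replacing row `r` by the combination multiplies the determinant by `x r`, and here the new row
  -- is zero.
  cramer : ∀ n (M : Matrix n) x → linComb x M ≋ 𝟎 → ∀ r → x r * det M ≈ 0#
  cramer n M x xM≈0 r = trans (sym (det-setRow-linComb n M r x))
    (det-zero-row n r (setRow M r (linComb x M)) (λ k → trans (at (setRow-≡ M r (linComb x M)) k) (xM≈0 k)))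

  -- Row `r` is not exempt: it becomes `1 - v r` times itself. One vector `v` thus describes an
  -- elimination together with a rescaling of the pivot row.
  subtractRow : ∀ {n} → Fin n → Vector Carrier n → Matrix n → Matrix n
  subtractRow r v M i k = M i k - v i * M r k

  private
    -- Quantifying over all `M`, with row `r` kept fixed by `v r ≈ 0`, makes the property additive
    -- in `v`. A general `v` is then the sum of its components, each of which is an elementary row
    -- operation.
    Invariant : ∀ n → Fin n → Vector Carrier n → Set
    Invariant n r v = v r ≈ 0# × (∀ M → det (subtractRow r v M) ≈ det M)

    invariant-0 : ∀ n r v → (∀ i → v i ≈ 0#) → Invariant n r v
    invariant-0 n r v v≈0 = v≈0 r , λ M → det-cong n (λ i k →
      trans (+-congˡ (-‿cong (trans (*-congʳ (v≈0 i)) (zeroˡ _)))) (trans (+-congˡ -0#≈0#) (+-identityʳ _)))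

    invariant-+ : ∀ n r v w → Invariant n r v → Invariant n r w → Invariant n r (λ i → v i + w i)
    invariant-+ n r v w (vr≈0 , det-v) (wr≈0 , det-w) =
      trans (+-cong vr≈0 wr≈0) (+-identityˡ _) , λ M → begin
        det (subtractRow r (λ i → v i + w i) M) ≈⟨ det-cong n (λ i k → begin
          M i k - (v i + w i) * M r k ≈⟨ solve 4 (λ a v w b → a :- (v :+ w) :* b := (a :- v :* b) :- w :* (b :- con (+ 0) :* b)) refl _ _ _ _ ⟩
          (M i k - v i * M r k) - w i * (M r k - 0# * M r k) ≈⟨ +-congˡ (-‿cong (*-congˡ (+-congˡ (-‿cong (*-congʳ vr≈0))))) ⟨
          subtractRow r w (subtractRow r v M) i k ∎) ⟩
        det (subtractRow r w (subtractRow r v M)) ≈⟨ det-w _ ⟩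
        det (subtractRow r v M) ≈⟨ det-v M ⟩
        det M ∎

    invariant-sum : ∀ n r m (vs : Vector (Vector Carrier n) m) → (∀ j → Invariant n r (vs j)) →
                    Invariant n r (λ i → sum (λ j → vs j i))
    invariant-sum n r zero    vs ok = invariant-0 n r _ (λ _ → refl)
    invariant-sum n r (suc m) vs ok =
      invariant-+ n r (vs zero) _ (ok zero) (invariant-sum n r m (vs ∘ suc) (ok ∘ suc))

    invariant-δ : ∀ n (r : Fin n) (v : Vector Carrier n) → v r ≈ 0# → ∀ j → Invariant n r (λ i → δ i j * v j)
    invariant-δ n r v vr≈0 j with j Fin.≟ r
    ... | yes ≡.refl = invariant-0 n r _ (λ i → trans (*-congˡ vr≈0) (zeroʳ _))
    ... | no j≢r    = trans (*-congʳ (δ-off (j≢r ∘ ≡.sym))) (zeroˡ _) , λ M →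
      addRow n (det-alternating n) (- v j) j r j≢r M _
        (λ k → +-congˡ (trans (-‿cong (*-congʳ (trans (*-congʳ (δ-diag j)) (*-identityˡ _)))) (-‿distribˡ-* _ _)))
        (λ i i≢j k → trans (+-congˡ (trans (-‿cong (trans (*-congʳ (trans (*-congʳ (δ-off i≢j)) (zeroˡ _))) (zeroˡ _))) -0#≈0#)) (+-identityʳ _))

    det-subtractRow₀ : ∀ n (r : Fin n) (v : Vector Carrier n) → v r ≈ 0# → ∀ M → det (subtractRow r v M) ≈ det M
    det-subtractRow₀ n r v vr≈0 M = trans
      (det-cong n (λ i k → +-congˡ (-‿cong (*-congʳ (sym (sum-δˡ v i))))))
      (proj₂ (invariant-sum n r n (λ j i → δ i j * v j) (invariant-δ n r v vr≈0)) M)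

  -- Removing the entry of `v` at `r` changes only row `r` of the result, by the factor `1 - v r`.
  -- Linearity in that row is used with second coefficient 0, that is, as homogeneity.
  det-subtractRow : ∀ n r v (M : Matrix n) → det (subtractRow r v M) ≈ (1# - v r) * det M
  det-subtractRow n r v M = begin
    det (subtractRow r v M) ≈⟨ det-linear n r (1# - v r) 0#
                                                           {subtractRow r v M} {subtractRow r w M} {subtractRow r w M} row-r others others ⟩
    (1# - v r) * det (subtractRow r w M) + 0# * det (subtractRow r w M) ≈⟨ trans (+-congˡ (zeroˡ _)) (+-identityʳ _) ⟩
    (1# - v r) * det (subtractRow r w M) ≈⟨ *-congˡ (det-subtractRow₀ n r w wr≈0 M) ⟩
    (1# - v r) * det M ∎
    where
    w : Vector Carrier n
    w i = v i - δ i r * v r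
    wr≈0 : w r ≈ 0#
    wr≈0 = trans (+-congˡ (-‿cong (trans (*-congʳ (δ-diag r)) (*-identityˡ _)))) (-‿inverseʳ _)
    row-r : ∀ k → subtractRow r v M r k ≈ (1# - v r) * subtractRow r w M r k + 0# * subtractRow r w M r k
    row-r k = begin
      M r k - v r * M r k ≈⟨ solve 2 (λ v a → a :- v :* a := (con (+ 1) :- v) :* (a :- con (+ 0) :* a)) refl (v r) (M r k) ⟩
      (1# - v r) * (M r k - 0# * M r k) ≈⟨ *-congˡ (+-congˡ (-‿cong (*-congʳ wr≈0))) ⟨
      (1# - v r) * subtractRow r w M r k ≈⟨ trans (+-congˡ (zeroˡ _)) (+-identityʳ _) ⟨
      (1# - v r) * subtractRow r w M r k + 0# * subtractRow r w M r k ∎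
    others : ∀ i → i ≢ r → ∀ k → subtractRow r v M i k ≈ subtractRow r w M i k
    others i i≢r k = +-congˡ (-‿cong (*-congʳ (sym (begin
      v i - δ i r * v r ≈⟨ +-congˡ (-‿cong (trans (*-congʳ (δ-off i≢r)) (zeroˡ _))) ⟩
      v i - 0# ≈⟨ trans (+-congˡ -0#≈0#) (+-identityʳ _) ⟩
      v i ∎))))

  -- For a Gram matrix `G` this is the effect of replacing each basis vector bᵢ by bᵢ - vᵢ bᵣ: the
  -- same update acts once on the rows and once on the columns.
  det-congruence : ∀ n r v (G : Matrix n) →
    det (λ i k → (G i k - v i * G r k) - v k * (G i r - v i * G r r)) ≈ (1# - v r) * (1# - v r) * det G
  det-congruence n r v G = begin
    det (λ i k → H i k - v k * H i r) ≈⟨ det-transpose n _ ⟩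
    det (subtractRow r v (flip H)) ≈⟨ det-subtractRow n r v (flip H) ⟩
    (1# - v r) * det (flip H) ≈⟨ *-congˡ (trans (sym (det-transpose n H)) (det-subtractRow n r v G)) ⟩
    (1# - v r) * ((1# - v r) * det G) ≈⟨ *-assoc _ _ _ ⟨
    (1# - v r) * (1# - v r) * det G ∎
    where
    H : Matrix n
    H = subtractRow r v G

  det-scalar : ∀ n a → det {n} (λ i k → a * δ i k) ≈ a ^ n
  det-scalar zero    a = refl
  det-scalar (suc n) a = begin
    1# * (a * 1#) * det {n} (λ i k → a * δ i k) + sum {n} (λ j → T (suc j)) ≈⟨ +-cong (*-cong (trans (*-identityˡ _) (*-identityʳ a)) (det-scalar n a)) (sum-zero {n} T≈0) ⟩
    a * a ^ n + 0# ≈⟨ +-identityʳ _ ⟩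
    a * a ^ n ∎
    where
    T : Fin (suc n) → Carrier
    T j = (- 1#) ^ toℕ j * (a * δ zero j) * det {n} (λ i k → a * δ (suc i) (punchIn j k))
    T≈0 : ∀ j → T (suc j) ≈ 0#
    T≈0 j = trans (*-congʳ (trans (*-congˡ (zeroʳ a)) (zeroʳ _))) (zeroˡ _)

  -- Adding all rows to the first one makes it constant, equal to a - (n + 1) b.
  det-scalar-minus-constant : ∀ n a b → a - (suc n ×ℕ 1#) * b ≈ 1# →
    det {suc n} (λ i k → a * δ i k - b) ≈ a ^ n
  det-scalar-minus-constant n a b a-nb≈1 = begin
    det G ≈⟨ trans (det-setRow-linComb (suc n) G zero (λ _ → 1#)) (*-identityˡ _) ⟨
    det (setRow G zero (linComb (λ _ → 1#) G)) ≈⟨ det-cong (suc n) rows ⟩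
    det (subtractRow zero v U) ≈⟨ det-subtractRow (suc n) zero v U ⟩
    (1# - 0#) * det U ≈⟨ trans (*-congʳ (trans (+-congˡ -0#≈0#) (+-identityʳ _))) (*-identityˡ _) ⟩
    1# * 1# * det {n} (λ i k → a * δ i k) + sum {n} (λ j → T (suc j)) ≈⟨ +-cong (trans (*-congʳ (*-identityˡ 1#)) (trans (*-identityˡ _) (det-scalar n a))) (sum-zero {n} (T≈0 n)) ⟩
    a ^ n + 0# ≈⟨ +-identityʳ _ ⟩
    a ^ n ∎
    where
    G U : Matrix (suc n)
    G i k = a * δ i k - b
    U zero    k = 1#
    U (suc i) k = a * δ (suc i) k
    v : Vector Carrier (suc n)
    v zero    = 0#
    v (suc _) = b
    T : Fin (suc n) → Carrier
    T j = (- 1#) ^ toℕ j * 1# * det {n} (λ i k → a * δ (suc i) (punchIn j k))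
    -- Deleting a column other than the first keeps the first column, which is zero below the first
    -- row.
    T≈0 : ∀ n (j : Fin n) → (- 1#) ^ toℕ (suc j) * 1# * det {n} (λ i k → a * δ (suc i) (punchIn (suc j) k)) ≈ 0#
    T≈0 (suc n) j = trans (*-congˡ (trans (det-transpose (suc n) (λ i k → a * δ (suc i) (punchIn (suc j) k)))
      (det-zero-row (suc n) zero (λ i k → a * δ (suc k) (punchIn (suc j) i)) (λ k → zeroʳ a)))) (zeroʳ _)
    rows : ∀ i k → setRow G zero (linComb (λ _ → 1#) G) i k ≈ subtractRow zero v U i k
    rows zero    k = begin
      sum (λ i → 1# * (a * δ i k - b)) ≈⟨ sum-cong-≋ {suc n} (λ i → *-identityˡ (a * δ i k - b)) ⟩
      sum (λ i → a * δ i k - b) ≈⟨ sum-sub {suc n} (λ i → a * δ i k) (λ _ → b) ⟩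
      sum (λ i → a * δ i k) - sum {suc n} (λ _ → b) ≈⟨ +-cong (sum-δʳ {suc n} (λ _ → a) k) (-‿cong (sum-const {suc n} b)) ⟩
      a - (suc n ×ℕ 1#) * b ≈⟨ a-nb≈1 ⟩
      1# ≈⟨ solve 0 (con (+ 1) := con (+ 1) :- con (+ 0) :* con (+ 1)) refl ⟩
      1# - 0# * 1# ∎
    rows (suc i) k = +-congˡ (-‿cong (sym (*-identityʳ b)))

  det-fromℤ : ∀ n (M : Vector (Vector ℤ n) n) → fromℤ (ℤ-LinearAlgebra.det M) ≈ det (λ i k → fromℤ (M i k))
  det-fromℤ zero    M = fromℤ-1
  det-fromℤ (suc n) M = trans (fromℤ-sum {suc n} (λ j → t j ℤ.* M zero j ℤ.* D j)) (sum-cong-≋ {suc n} (λ j →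
    trans (fromℤ-* (t j ℤ.* M zero j) (D j)) (*-cong
      (trans (fromℤ-* (t j) (M zero j)) (*-congʳ (sign (toℕ j))))
      (det-fromℤ n (λ i k → M (suc i) (punchIn j k))))))
    where
    module Z = ℤ-LinearAlgebra
    t D : Fin (suc n) → ℤ
    t j = (ℤ.- + 1) Z.^ toℕ j
    D j = Z.det (λ i k → M (suc i) (punchIn j k))
    sign : ∀ k → fromℤ ((ℤ.- + 1) Z.^ k) ≈ (- 1#) ^ k
    sign zero    = fromℤ-1
    sign (suc k) = trans (fromℤ-* (ℤ.- + 1) ((ℤ.- + 1) Z.^ k)) (*-cong (trans (fromℤ-neg (+ 1)) (-‿cong fromℤ-1)) (sign k))

-- Linear combinations with coefficients from another ring, used for ℤ and ℚ

module LinearCombinations (S R : CommutativeRing 0ℓ 0ℓ)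
  (f : CommutativeRing.Carrier S → CommutativeRing.Carrier R)
  (f-hom : RingMorphisms.IsRingHomomorphism (CommutativeRing.rawRing S) (CommutativeRing.rawRing R) f) where
  private
    module S = CommutativeRing S
    module SR = RingTheory S
  open CommutativeRing R hiding (zero)
  open LinearAlgebra R
  open RingTheory R
  open RingMorphisms.IsRingHomomorphism f-hom
  open SetoidReasoning setoid
  open Solver using (solve; _:=_; _:+_; _:*_; _:-_; :-_; con)

  infix 4 _∈⟨_⟩
  record _∈⟨_⟩ {n} (z : Carrier) (v : Vector Carrier n) : Set where
    constructor combination
    field
      coefficients : Vector S.Carrier n
      proof        : z ≈ sum (λ i → f (coefficients i) * v i)
  open _∈⟨_⟩ public

  module _ {n} {v : Vector Carrier n} where
    ∈-resp : ∀ {x y} → x ≈ y → x ∈⟨ v ⟩ → y ∈⟨ v ⟩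
    ∈-resp x≈y (combination c x≈cv) = combination c (trans (sym x≈y) x≈cv)

    ∈-+ : ∀ {x y} → x ∈⟨ v ⟩ → y ∈⟨ v ⟩ → x + y ∈⟨ v ⟩
    ∈-+ (combination c x≈cv) (combination d y≈dv) = combination (λ i → c i S.+ d i) (trans (+-cong x≈cv y≈dv) (trans
      (sym (∑-distrib-+ {n} _ _))
      (sum-cong-≋ {n} (λ i → trans (sym (distribʳ _ _ _)) (*-congʳ (sym (+-homo (c i) (d i))))))))

    ∈-scale : ∀ a {x} → x ∈⟨ v ⟩ → f a * x ∈⟨ v ⟩
    ∈-scale a (combination c x≈cv) = combination (λ i → a S.* c i) (trans (*-congˡ x≈cv) (trans
      (*-distribˡ-sum {n} _ _)
      (sum-cong-≋ {n} (λ i → trans (sym (*-assoc _ _ _)) (*-congʳ (sym (*-homo a (c i))))))))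

    ∈-neg : ∀ {x} → x ∈⟨ v ⟩ → - x ∈⟨ v ⟩
    ∈-neg {x} x∈v = ∈-resp (solve 1 (λ x → :- con (+ 1) :* x := :- x) refl x)
      (∈-resp (*-congʳ (trans (-‿homo S.1#) (-‿cong 1#-homo))) (∈-scale (S.- S.1#) x∈v))

    ∈-0 : 0# ∈⟨ v ⟩
    ∈-0 = combination (λ _ → S.0#) (sym (sum-zero {n} (λ i → trans (*-congʳ 0#-homo) (zeroˡ (v i)))))

    ∈-sum : ∀ {m} (g : Vector Carrier m) → (∀ i → g i ∈⟨ v ⟩) → sum g ∈⟨ v ⟩
    ∈-sum {zero}  g g∈v = ∈-0
    ∈-sum {suc m} g g∈v = ∈-+ (g∈v zero) (∈-sum (g ∘ suc) (g∈v ∘ suc))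

    ∈-sign : ∀ k {x} → x ∈⟨ v ⟩ → (- 1#) ^ k * x ∈⟨ v ⟩
    ∈-sign zero    x∈v = ∈-resp (sym (*-identityˡ _)) x∈v
    ∈-sign (suc k) x∈v = ∈-resp
      (solve 2 (λ s x → :- (s :* x) := :- con (+ 1) :* s :* x) refl _ _) (∈-neg (∈-sign k x∈v))

    ∈-generator : ∀ i → v i ∈⟨ v ⟩
    ∈-generator i = combination (SR.δ i) (sym (begin
      sum (λ j → f (SR.δ i j) * v j) ≈⟨ sum-cong-≋ {n} (λ j → *-congʳ (f-δ i j)) ⟩
      sum (λ j → δ i j * v j) ≈⟨ sum-δˡ {n} v i ⟩
      v i ∎))
      where
      f-δ : ∀ i j → f (SR.δ i j) ≈ δ i j
      f-δ i j with i Fin.≟ j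
      ... | yes _ = 1#-homo
      ... | no _  = 0#-homo

  ∈-trans : ∀ {m n} {v : Vector Carrier m} {w : Vector Carrier n} {x} →
            (∀ i → v i ∈⟨ w ⟩) → x ∈⟨ v ⟩ → x ∈⟨ w ⟩
  ∈-trans v∈w (combination c x≈cv) = ∈-resp (sym x≈cv) (∈-sum _ (λ i → ∈-scale (c i) (v∈w i)))

module IntegerCombinations (R : CommutativeRing 0ℓ 0ℓ) =
  LinearCombinations ℤ.+-*-commutativeRing R (LinearAlgebra.fromℤ R) (fromℤ-isRingHomomorphism R)

-- Eigenvalues of integer matrices are integral

module Integrality (R : CommutativeRing 0ℓ 0ℓ) (y : CommutativeRing.Carrier R) where
  open CommutativeRing R hiding (zero)
  open LinearAlgebra R
  open RingTheory R
  open Determinant R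
  open IntegerCombinations R
  open SetoidReasoning setoid
  open Solver using (solve; _:=_; _:+_; _:*_; _:-_; :-_; con)

  private
    -- Polynomials are represented by their values at `y`: membership in `⟨ Powers n ⟩` means being
    -- the value of an integer polynomial of degree less than `n`.
    Powers : ∀ n → Vector Carrier n
    Powers n i = y ^ toℕ i

    weaken : ∀ {n x} → x ∈⟨ Powers n ⟩ → x ∈⟨ Powers (suc n) ⟩
    weaken = ∈-trans (λ i → ∈-resp (reflexive (≡.cong (y ^_) (Fin.toℕ-inject₁ i))) (∈-generator (inject₁ i)))

    power : ∀ n → y ^ n ∈⟨ Powers (suc n) ⟩
    power n = ∈-resp (reflexive (≡.cong (y ^_) (Fin.toℕ-fromℕ n))) (∈-generator (fromℕ n))

    times-y : ∀ {n x} → x ∈⟨ Powers n ⟩ → y * x ∈⟨ Powers (suc n) ⟩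
    times-y {n} {x} (combination c x≈cv) = ∈-resp (begin
      sum (λ i → y * (fromℤ (c i) * y ^ toℕ i)) ≈⟨ *-distribˡ-sum {n} y _ ⟨
      y * sum (λ i → fromℤ (c i) * y ^ toℕ i) ≈⟨ *-congˡ x≈cv ⟨
      y * x ∎)
      (∈-sum _ (λ i → ∈-resp
        (solve 3 (λ c y z → c :* (y :* z) := y :* (c :* z)) refl (fromℤ (c i)) y (y ^ toℕ i))
        (∈-scale (c i) (∈-generator (suc i)))))

    det-degree : ∀ n (M : Matrix n) → (a b : Fin n → Fin n → ℤ) →
                 (∀ i k → M i k ≈ fromℤ (a i k) + fromℤ (b i k) * y) → det M ∈⟨ Powers (suc n) ⟩
    det-degree zero    M a b M≈ = power 0
    det-degree (suc n) M a b M≈ = ∈-sum (λ j → (- 1#) ^ toℕ j * M zero j * D j) (λ j →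
      ∈-resp (sym (*-assoc _ _ _)) (∈-sign (toℕ j) (∈-resp (term j) (∈-+
        (∈-scale (a zero j) (weaken (minor j)))
        (∈-scale (b zero j) (times-y (minor j)))))))
      where
      D : Fin (suc n) → Carrier
      D j = det (λ i k → M (suc i) (punchIn j k))
      minor : ∀ j → D j ∈⟨ Powers (suc n) ⟩
      minor j = det-degree n (λ i k → M (suc i) (punchIn j k)) (λ i k → a (suc i) (punchIn j k))
        (λ i k → b (suc i) (punchIn j k)) (λ i k → M≈ (suc i) (punchIn j k))
      term : ∀ j → fromℤ (a zero j) * D j + fromℤ (b zero j) * (y * D j) ≈ M zero j * D j
      term j = trans (solve 4 (λ a b y d → a :* d :+ b :* (y :* d) := (a :+ b :* y) :* d) refl _ _ _ _)
                     (*-congʳ (sym (M≈ zero j)))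

    -- Only the corner entry of the first row contains `y`. The remaining terms multiply a constant
    -- by a minor of degree at most `n`, so the leading term comes from the corner and its minor.
    det-monic : ∀ n (C : Fin n → Fin n → ℤ) →
                det {n} (λ i k → y * δ i k - fromℤ (C i k)) - y ^ n ∈⟨ Powers n ⟩
    det-monic zero    C = ∈-resp (sym (-‿inverseʳ 1#)) ∈-0
    det-monic (suc n) C = ∈-resp (begin
      E + F ≈⟨ solve 5 (λ y c D z F → (y :* (D :- z) :- (c :* (D :- z) :+ c :* z)) :+ F := (con (+ 1) :* (y :* con (+ 1) :- c) :* D :+ F) :- y :* z) refl y c (D zero) (y ^ n) F ⟩
      (1# * (y * 1# - c) * D zero + F) - y * y ^ n ∎)
      (∈-+ (∈-+ (times-y minor₀) (∈-neg (∈-+ (∈-scale (C zero zero) (weaken minor₀)) (∈-scale (C zero zero) (power n)))))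
        (∈-sum (λ j → (- 1#) ^ toℕ (suc j) * M zero (suc j) * D (suc j)) (λ j →
          ∈-resp (sym (*-assoc _ _ _)) (∈-sign (toℕ (suc j)) (∈-resp
            (*-congʳ (trans (fromℤ-neg (C zero (suc j))) (sym (trans (+-congʳ (zeroʳ y)) (+-identityˡ _)))))
            (∈-scale (ℤ.- C zero (suc j)) (minor j)))))))
      where
      M : Matrix (suc n)
      M i k = y * δ i k - fromℤ (C i k)
      c = fromℤ (C zero zero)
      D : Fin (suc n) → Carrier
      D j = det (λ i k → M (suc i) (punchIn j k))
      E F : Carrier
      E = y * (D zero - y ^ n) - (c * (D zero - y ^ n) + c * y ^ n)
      F = sum {n} (λ j → (- 1#) ^ toℕ (suc j) * M zero (suc j) * D (suc j))
      minor₀ : D zero - y ^ n ∈⟨ Powers n ⟩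
      minor₀ = det-monic n (λ i k → C (suc i) (suc k))
      minor : ∀ j → D (suc j) ∈⟨ Powers (suc n) ⟩
      minor j = det-degree n (λ i k → M (suc i) (punchIn (suc j) k))
        (λ i k → ℤ.- C (suc i) (punchIn (suc j) k)) (λ i k → ℤ-Ring.δ (suc i) (punchIn (suc j) k))
        (λ i k → begin
          y * δ (suc i) (punchIn (suc j) k) - fromℤ (C (suc i) (punchIn (suc j) k))
            ≈⟨ +-comm _ _ ⟩
          - fromℤ (C (suc i) (punchIn (suc j) k)) + y * δ (suc i) (punchIn (suc j) k)
            ≈⟨ +-cong (sym (fromℤ-neg (C (suc i) (punchIn (suc j) k)))) (trans (*-comm _ _) (*-congʳ (sym (fromℤ-δ R (suc i) (punchIn (suc j) k))))) ⟩
          _ ∎)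

  -- `y` is a root of the characteristic polynomial of `C`, which is monic over ℤ. The coordinate
  -- equal to 1 stands in for a nonzero eigenvector: over a ring, `cramer` only yields
  -- `v i * det ≈ 0#`.
  eigenvalue-integral : ∀ n (v : Vector Carrier n) i → v i ≈ 1# → (C : Fin n → Fin n → ℤ) →
    (∀ k → y * v k ≈ sum (λ l → fromℤ (C k l) * v l)) →
    ∃ λ (c : Vector ℤ n) → y ^ n + sum (λ i → fromℤ (c i) * y ^ toℕ i) ≈ 0#
  eigenvalue-integral n v i vi≈1 C yv≈Cv = c , (begin
    y ^ n + sum (λ i → fromℤ (c i) * y ^ toℕ i) ≈⟨ +-congˡ (_∈⟨_⟩.proof monic) ⟨
    y ^ n + (det M - y ^ n) ≈⟨ solve 2 (λ a b → a :+ (b :- a) := b) refl (y ^ n) (det M) ⟩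
    det M ≈⟨ det-transpose n M ⟩
    det (flip M) ≈⟨ *-identityˡ _ ⟨
    1# * det (flip M) ≈⟨ *-congʳ vi≈1 ⟨
    v i * det (flip M) ≈⟨ cramer n (flip M) v vM≈0 i ⟩
    0# ∎)
    where
    M : Matrix n
    M i k = y * δ i k - fromℤ (C i k)
    monic = det-monic n C
    c = _∈⟨_⟩.coefficients monic
    vM≈0 : linComb v (flip M) ≋ 𝟎
    vM≈0 k = begin
      sum (λ l → v l * (y * δ k l - fromℤ (C k l)))
        ≈⟨ sum-cong-≋ {n} (λ l → solve 4 (λ v y d c → v :* (y :* d :- c) := d :* (y :* v) :- c :* v) refl (v l) y (δ k l) (fromℤ (C k l))) ⟩
      sum (λ l → δ k l * (y * v l) - fromℤ (C k l) * v l)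
        ≈⟨ sum-sub {n} _ _ ⟩
      sum (λ l → δ k l * (y * v l)) - sum (λ l → fromℤ (C k l) * v l)
        ≈⟨ +-congʳ (sum-δˡ {n} (λ l → y * v l) k) ⟩
      y * v k - sum (λ l → fromℤ (C k l) * v l)
        ≈⟨ x≈y⇒x-y≈0 (yv≈Cv k) ⟩
      0# ∎

-- Number fields and their homomorphisms

module RingHomomorphism (R S : CommutativeRing 0ℓ 0ℓ) (f : CommutativeRing.Carrier R → CommutativeRing.Carrier S)
  (f-hom : RingMorphisms.IsRingHomomorphism (CommutativeRing.rawRing R) (CommutativeRing.rawRing S) f) where
  private
    module R = CommutativeRing R
    module S = CommutativeRing S
    module RL = LinearAlgebra R
    module SL = LinearAlgebra S
  open RingMorphisms.IsRingHomomorphism f-hom public using (⟦⟧-cong; +-homo; *-homo; 0#-homo; 1#-homo; -‿homo)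

  sum-homo : ∀ {n} (v : Vector R.Carrier n) → f (RL.sum v) S.≈ SL.sum (f ∘ v)
  sum-homo {zero}  v = 0#-homo
  sum-homo {suc n} v = S.trans (+-homo _ _) (S.+-congˡ (sum-homo (v ∘ suc)))

  ^-homo : ∀ x n → f (x RL.^ n) S.≈ f x SL.^ n
  ^-homo x zero    = 1#-homo
  ^-homo x (suc n) = S.trans (*-homo _ _) (S.*-congˡ (^-homo x n))

  ×ℕ1-homo : ∀ n → f (n RL.×ℕ R.1#) S.≈ n SL.×ℕ S.1#
  ×ℕ1-homo zero    = 0#-homo
  ×ℕ1-homo (suc n) = S.trans (+-homo _ _) (S.+-cong 1#-homo (×ℕ1-homo n))

  fromℤ-homo : ∀ z → f (RL.fromℤ z) S.≈ SL.fromℤ z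
  fromℤ-homo (+ n)    = ×ℕ1-homo n
  fromℤ-homo -[1+ n ] = S.trans (-‿homo _) (S.-‿cong (×ℕ1-homo (suc n)))

  sub-homo : ∀ x y → f (x R.- y) S.≈ f x S.- f y
  sub-homo x y = S.trans (+-homo _ _) (S.+-congˡ (-‿homo y))

module ℚ-LinearAlgebra = LinearAlgebra ℚ.+-*-commutativeRing

private
  fromℕ-toℚᵘ : ∀ n → ℚ.toℚᵘ (n ℚ-LinearAlgebra.×ℕ 1ℚ) ℚᵘ.≃ mkℚᵘ (+ n) 0
  fromℕ-toℚᵘ zero    = *≡* ≡.refl
  fromℕ-toℚᵘ (suc n) = ℚᵘ.≃-trans (ℚ.toℚᵘ-homo-+ 1ℚ (n ℚ-LinearAlgebra.×ℕ 1ℚ))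
    (ℚᵘ.≃-trans (ℚᵘ.+-congʳ ℚᵘ.1ℚᵘ (fromℕ-toℚᵘ n)) (*≡* (solve 1 (λ n →
      (con (+ 1) :* con (+ 1) :+ n :* con (+ 1)) :* con (+ 1) := (con (+ 1) :+ n) :* con (+ 1)) ≡.refl (+ n))))
    where open ℤ-Ring.Solver

  fromℤ-toℚᵘ : ∀ z → ℚ.toℚᵘ (ℚ-LinearAlgebra.fromℤ z) ℚᵘ.≃ mkℚᵘ z 0
  fromℤ-toℚᵘ (+ n)    = fromℕ-toℚᵘ n
  fromℤ-toℚᵘ -[1+ n ] = ℚᵘ.≃-trans (ℚ.toℚᵘ-homo‿- (suc n ℚ-LinearAlgebra.×ℕ 1ℚ)) (ℚᵘ.-‿cong (fromℕ-toℚᵘ (suc n)))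

q*↧q≡↥q : ∀ q → q ℚ.* ℚ-LinearAlgebra.fromℤ (↧ q) ≡ ℚ-LinearAlgebra.fromℤ (↥ q)
q*↧q≡↥q q@(mkℚ n d-1 _) = ℚ.toℚᵘ-injective (ℚᵘ.≃-trans (ℚ.toℚᵘ-homo-* q (ℚ-LinearAlgebra.fromℤ (↧ q)))
  (ℚᵘ.≃-trans (ℚᵘ.*-congˡ {ℚ.toℚᵘ q} (fromℤ-toℚᵘ (↧ q))) (ℚᵘ.≃-trans
    (*≡* (≡.trans (ℤ.*-identityʳ _) (≡.cong (λ d → n ℤ.* + d) (≡.sym (ℕ.*-identityʳ (suc d-1))))))
    (ℚᵘ.≃-sym (fromℤ-toℚᵘ n)))))

fromℤ-ℚ-injective : ∀ {x y} → ℚ-LinearAlgebra.fromℤ x ≡ ℚ-LinearAlgebra.fromℤ y → x ≡ y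
fromℤ-ℚ-injective {x} {y} eq
  with ℚᵘ.≃-trans (ℚᵘ.≃-sym (fromℤ-toℚᵘ x)) (ℚᵘ.≃-trans (ℚ.toℚᵘ-cong eq) (fromℤ-toℚᵘ y))
... | *≡* x1≡y1 = ≡.trans (≡.sym (ℤ.*-identityʳ x)) (≡.trans x1≡y1 (ℤ.*-identityʳ y))

module FieldTheory (F : FieldOverℚ) where
  open FieldOverℚ F
  open LinearAlgebra commutativeRing using (_×ℕ_)
  open RingTheory commutativeRing
  open HeytingProperties (HeytingField.heytingCommutativeRing heytingField) using (1#0; x-0≈x)
  open SetoidReasoning (CommutativeRing.setoid commutativeRing)
  module ι = RingHomomorphism ℚ.+-*-commutativeRing commutativeRing ι ι-isRingHomomorphism

  infix 4 _≟_
  _≟_ : ∀ x y → Dec (x ≈ y)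
  x ≟ y with x #? y
  ... | yes x#y = no (λ x≈y → #-irrefl x≈y x#y)
  ... | no ¬x#y = yes (proj₁ (tight x y) ¬x#y)

  1≉0 : ¬ (1# ≈ 0#)
  1≉0 1≈0 = #-irrefl 1≈0 1#0

  inverse : ∀ {x} → ¬ (x ≈ 0#) → ∃ λ y → x * y ≈ 1#
  inverse {x} x≉0 with x #? 0#
  ... | no ¬x#0 = contradiction (proj₁ (tight x 0#) ¬x#0) x≉0
  ... | yes x#0 with #⇒invertible x#0
  ...   | y , _ , x-0*y≈1 = y , trans (*-congʳ (sym (x-0≈x x))) x-0*y≈1

  x*y≈0⇒y≈0 : ∀ {x y} → ¬ (x ≈ 0#) → x * y ≈ 0# → y ≈ 0#
  x*y≈0⇒y≈0 {x} {y} x≉0 xy≈0 with inverse x≉0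
  ... | z , xz≈1 = begin
    y ≈⟨ *-identityˡ y ⟨
    1# * y ≈⟨ *-congʳ xz≈1 ⟨
    (x * z) * y ≈⟨ Solver.solve 3 (λ x y z → (x :* z) :* y := z :* (x :* y)) refl x y z ⟩
    z * (x * y) ≈⟨ *-congˡ xy≈0 ⟩
    z * 0# ≈⟨ zeroʳ z ⟩
    0# ∎
    where open Solver using (_:=_; _:*_)

  *-cancelˡ : ∀ {x y z} → ¬ (x ≈ 0#) → x * y ≈ x * z → y ≈ z
  *-cancelˡ {x} {y} {z} x≉0 xy≈xz = x-y≈0⇒x≈y (x*y≈0⇒y≈0 x≉0 (begin
    x * (y - z) ≈⟨ Solver.solve 3 (λ x y z → x :* (y :- z) := x :* y :- x :* z) refl x y z ⟩
    x * y - x * z ≈⟨ x≈y⇒x-y≈0 xy≈xz ⟩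
    0# ∎))
    where open Solver using (_:=_; _:*_; _:-_)

  ι-fraction : ∀ q → ι q * fromℤ (↧ q) ≈ fromℤ (↥ q)
  ι-fraction q = begin
    ι q * fromℤ (↧ q) ≈⟨ *-congˡ (ι.fromℤ-homo (↧ q)) ⟨
    ι q * ι (ℚ-LinearAlgebra.fromℤ (↧ q)) ≈⟨ ι.*-homo q _ ⟨
    ι (q ℚ.* ℚ-LinearAlgebra.fromℤ (↧ q)) ≡⟨ ≡.cong ι (q*↧q≡↥q q) ⟩
    ι (ℚ-LinearAlgebra.fromℤ (↥ q)) ≈⟨ ι.fromℤ-homo (↥ q) ⟩
    fromℤ (↥ q) ∎

  ι-nonzero : ∀ {q} → q ≢ 0ℚ → ¬ (ι q ≈ 0#)
  ι-nonzero {q} q≢0 ιq≈0 = 1≉0 (begin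
    1# ≈⟨ ι.1#-homo ⟨
    ι 1ℚ ≡⟨ ≡.cong ι (ℚ.*-inverseʳ q) ⟨
    ι (q ℚ.* (ℚ.1/ q)) ≈⟨ ι.*-homo q _ ⟩
    ι q * ι (ℚ.1/ q) ≈⟨ *-congʳ ιq≈0 ⟩
    0# * ι (ℚ.1/ q) ≈⟨ zeroˡ _ ⟩
    0# ∎)
    where
    instance
      q-nonZero : ℚ.NonZero q
      q-nonZero = ℚ.≢-nonZero q≢0

  fromℤ-nonzero : ∀ {z} → z ≢ + 0 → ¬ (fromℤ z ≈ 0#)
  fromℤ-nonzero {z} z≢0 z≈0 = ι-nonzero (z≢0 ∘ fromℤ-ℚ-injective) (trans (ι.fromℤ-homo z) z≈0)

  fromℤ-injective : ∀ {x y} → fromℤ x ≈ fromℤ y → x ≡ y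
  fromℤ-injective {x} {y} x≈y with x ℤ.- y ℤ.≟ + 0
  ... | yes x-y≡0 = ℤ.i-j≡0⇒i≡j x y x-y≡0
  ... | no x-y≢0 = contradiction (trans (fromℤ-sub x y) (x≈y⇒x-y≈0 x≈y)) (fromℤ-nonzero x-y≢0)

  reciprocal : ∀ {n} → 0 ℕ.< n → ∃ λ q → ι q * (n ×ℕ 1#) ≈ 1#
  reciprocal {n} 0<n = ℚ.1/ nℚ , (begin
    ι (ℚ.1/ nℚ) * (n ×ℕ 1#) ≈⟨ *-congˡ (ι.fromℤ-homo (+ n)) ⟨
    ι (ℚ.1/ nℚ) * ι nℚ ≈⟨ ι.*-homo (ℚ.1/ nℚ) nℚ ⟨
    ι (ℚ.1/ nℚ ℚ.* nℚ) ≡⟨ ≡.cong ι (ℚ.*-inverseˡ nℚ) ⟩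
    ι 1ℚ ≈⟨ ι.1#-homo ⟩
    1# ∎)
    where
    nℚ : ℚ
    nℚ = ℚ-LinearAlgebra.fromℤ (+ n)
    instance
      nℚ-nonZero : ℚ.NonZero nℚ
      nℚ-nonZero = ℚ.≢-nonZero λ n≡0 → ℕ.<⇒≢ 0<n (≡.sym (ℤ.+-injective (fromℤ-ℚ-injective {+ n} {+ 0} n≡0)))

  ι-injective : ∀ {q r} → ι q ≈ ι r → q ≡ r
  ι-injective {q} {r} ιq≈ιr with q ℚ.- r ℚ.≟ 0ℚ
  ... | yes q-r≡0 = RingTheory.x-y≈0⇒x≈y ℚ.+-*-commutativeRing q-r≡0
  ... | no q-r≢0 = contradiction (trans (ι.sub-homo q r) (x≈y⇒x-y≈0 ιq≈ιr)) (ι-nonzero q-r≢0)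

-- The target is only asked to be a nontrivial ring, so that the same facts apply to 𝕂 inside 𝕃 and
-- to 𝕂 inside ℝ.
module FieldEmbedding (F : FieldOverℚ) (S : CommutativeRing 0ℓ 0ℓ)
  (1≉0 : ¬ (CommutativeRing._≈_ S (CommutativeRing.1# S) (CommutativeRing.0# S)))
  (f : ∣ F ∣ᶠ → CommutativeRing.Carrier S)
  (f-hom : RingMorphisms.IsRingHomomorphism (FieldOverℚ.rawRing F) (CommutativeRing.rawRing S) f) where
  private
    module F = FieldOverℚ F
    module S = CommutativeRing S
    module FT = FieldTheory F
  open RingHomomorphism F.commutativeRing S f f-hom public

  injective : ∀ {x y} → f x S.≈ f y → x F.≈ y
  injective {x} {y} fx≈fy with x FT.≟ y
  ... | yes x≈y = x≈y
  ... | no x≉y with FT.inverse (x≉y ∘ RingTheory.x-y≈0⇒x≈y F.commutativeRing)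
  ...   | z , [x-y]z≈1 = contradiction (begin
    S.1# ≈⟨ 1#-homo ⟨
    f F.1# ≈⟨ ⟦⟧-cong [x-y]z≈1 ⟨
    f ((x F.- y) F.* z) ≈⟨ *-homo _ _ ⟩
    f (x F.- y) S.* f z ≈⟨ S.*-congʳ (S.trans (sub-homo x y) (RingTheory.x≈y⇒x-y≈0 S fx≈fy)) ⟩
    S.0# S.* f z ≈⟨ S.zeroˡ _ ⟩
    S.0# ∎) 1≉0
    where open SetoidReasoning S.setoid

module FieldHomomorphism (F G : FieldOverℚ) (f : ∣ F ∣ᶠ → ∣ G ∣ᶠ) (f-hom : IsFieldEmbedding F G f) where
  private
    module F = FieldOverℚ F
    module G = FieldOverℚ G
    module FT = FieldTheory F
    module GT = FieldTheory G
  open FieldEmbedding F G.commutativeRing GT.1≉0 f f-hom public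

  -- Homomorphisms preserve integers, and multiplying either side by the denominator of `q` gives
  -- the numerator.
  ι-homo : ∀ q → f (F.ι q) G.≈ G.ι q
  ι-homo q = GT.*-cancelˡ (GT.fromℤ-nonzero {↧ q} (λ ())) (begin
    G.fromℤ (↧ q) G.* f (F.ι q) ≈⟨ G.*-comm _ _ ⟩
    f (F.ι q) G.* G.fromℤ (↧ q) ≈⟨ G.*-congˡ (fromℤ-homo (↧ q)) ⟨
    f (F.ι q) G.* f (F.fromℤ (↧ q)) ≈⟨ *-homo _ _ ⟨
    f (F.ι q F.* F.fromℤ (↧ q)) ≈⟨ ⟦⟧-cong (FT.ι-fraction q) ⟩
    f (F.fromℤ (↥ q)) ≈⟨ fromℤ-homo (↥ q) ⟩
    G.fromℤ (↥ q) ≈⟨ GT.ι-fraction q ⟨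
    G.ι q G.* G.fromℤ (↧ q) ≈⟨ G.*-comm _ _ ⟩
    G.fromℤ (↧ q) G.* G.ι q ∎)
    where open SetoidReasoning (CommutativeRing.setoid G.commutativeRing)

-- Residues modulo a prime

least : (P : ℕ → Set) → (∀ n → Dec (P n)) → ∀ n → P n →
        ∃ λ m → P m × m ℕ.≤ n × (∀ k → k ℕ.< m → ¬ P k)
least P P? n Pn with P? 0
... | yes P0 = 0 , P0 , z≤n , λ k ()
least P P? zero    P0 | no ¬P0 = contradiction P0 ¬P0
least P P? (suc n) Pn | no ¬P0 with least (P ∘ suc) (P? ∘ suc) n Pn
... | m , Pm , m≤n , minimal = suc m , Pm , s≤s m≤n , λ where
  zero    _         → ¬P0
  (suc k) (s≤s k<m) → minimal k k<m

module Modular (n : ℕ) where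
  infix 4 _≋ₙ_
  record _≋ₙ_ (a b : ℤ) : Set where
    constructor congruent
    field
      difference : + n ∣ℤ a ℤ.- b
  open _≋ₙ_ public

  private
    open ℤ-Ring.Solver

    abstract
      reflexive′ : ∀ {a b} → a ≡ b → a ≋ₙ b
      reflexive′ {a} ≡.refl = congruent (divides (+ 0) (ℤ.+-inverseʳ a))

      sym′ : ∀ {a b} → a ≋ₙ b → b ≋ₙ a
      sym′ {a} {b} (congruent n∣) = congruent (≡.subst (+ n ∣ℤ_)
        (solve 2 (λ a b → :- (a :- b) := b :- a) ≡.refl a b) (ℤ∣.∣m⇒∣-m n∣))

      trans′ : ∀ {a b c} → a ≋ₙ b → b ≋ₙ c → a ≋ₙ c
      trans′ {a} {b} {c} (congruent n∣) (congruent n∣′) = congruent (≡.subst (+ n ∣ℤ_)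
        (solve 3 (λ a b c → (a :- b) :+ (b :- c) := a :- c) ≡.refl a b c) (ℤ∣.∣m∣n⇒∣m+n n∣ n∣′))

      +-cong′ : ∀ {a b c d} → a ≋ₙ b → c ≋ₙ d → a ℤ.+ c ≋ₙ b ℤ.+ d
      +-cong′ {a} {b} {c} {d} (congruent n∣) (congruent n∣′) = congruent (≡.subst (+ n ∣ℤ_)
        (solve 4 (λ a b c d → (a :- b) :+ (c :- d) := (a :+ c) :- (b :+ d)) ≡.refl a b c d) (ℤ∣.∣m∣n⇒∣m+n n∣ n∣′))

      *-cong′ : ∀ {a b c d} → a ≋ₙ b → c ≋ₙ d → a ℤ.* c ≋ₙ b ℤ.* d
      *-cong′ {a} {b} {c} {d} (congruent n∣) (congruent n∣′) = congruent (≡.subst (+ n ∣ℤ_)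
        (solve 4 (λ a b c d → (a :- b) :* c :+ b :* (c :- d) := (a :* c) :- (b :* d)) ≡.refl a b c d)
        (ℤ∣.∣m∣n⇒∣m+n (ℤ∣.∣m⇒∣m*n c n∣) (ℤ∣.∣n⇒∣m*n b n∣′)))

      -‿cong′ : ∀ {a b} → a ≋ₙ b → ℤ.- a ≋ₙ ℤ.- b
      -‿cong′ {a} {b} (congruent n∣) = congruent (≡.subst (+ n ∣ℤ_)
        (solve 2 (λ a b → :- (a :- b) := :- a :- (:- b)) ≡.refl a b) (ℤ∣.∣m⇒∣-m n∣))

  -- ℤ/n with carrier ℤ and congruence as equality: integer expressions, sums and dot products can
  -- be read modulo n as they stand.
  ring : CommutativeRing 0ℓ 0ℓ
  ring = record
    { Carrier = ℤ ; _≈_ = _≋ₙ_ ; _+_ = ℤ._+_ ; _*_ = ℤ._*_ ; -_ = ℤ.-_ ; 0# = + 0 ; 1# = + 1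
    ; isCommutativeRing = record
      { isRing = record
        { +-isAbelianGroup = record
          { isGroup = record
            { isMonoid = record
              { isSemigroup = record
                { isMagma = record
                  { isEquivalence = record { refl = reflexive′ ≡.refl ; sym = sym′ ; trans = trans′ }
                  ; ∙-cong = +-cong′
                  }
                ; assoc = λ a b c → reflexive′ (ℤ.+-assoc a b c)
                }
              ; identity = (λ a → reflexive′ (ℤ.+-identityˡ a)) , (λ a → reflexive′ (ℤ.+-identityʳ a))
              }
            ; inverse = (λ a → reflexive′ (ℤ.+-inverseˡ a)) , (λ a → reflexive′ (ℤ.+-inverseʳ a))
            ; ⁻¹-cong = -‿cong′
            }
          ; comm = λ a b → reflexive′ (ℤ.+-comm a b)
          }
        ; *-cong = *-cong′
        ; *-assoc = λ a b c → reflexive′ (ℤ.*-assoc a b c)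
        ; *-identity = (λ a → reflexive′ (ℤ.*-identityˡ a)) , (λ a → reflexive′ (ℤ.*-identityʳ a))
        ; distrib = (λ a b c → reflexive′ (ℤ.*-distribˡ-+ a b c)) , (λ a b c → reflexive′ (ℤ.*-distribʳ-+ a b c))
        }
      ; *-comm = λ a b → reflexive′ (ℤ.*-comm a b)
      }
    }

  open CommutativeRing ring using (_≈_; refl; sym; trans)
  open LinearAlgebra ring using (_^_)

  abstract
    ∣⇒≈0 : ∀ {a} → + n ∣ℤ a → a ≈ + 0
    ∣⇒≈0 {a} n∣a = congruent (≡.subst (+ n ∣ℤ_) (≡.sym (ℤ.+-identityʳ a)) n∣a)

    ≈0⇒∣ : ∀ {a} → a ≈ + 0 → + n ∣ℤ a
    ≈0⇒∣ {a} (congruent n∣) = ≡.subst (+ n ∣ℤ_) (ℤ.+-identityʳ a) n∣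

    mod⇒≈ : ∀ {a b} → a ≡ b [mod n ] → a ≈ b
    mod⇒≈ = congruent ∘ ∣ᵤ⇒∣

    ≈⇒mod : ∀ {a b} → a ≈ b → a ≡ b [mod n ]
    ≈⇒mod = ∣⇒∣ᵤ ∘ difference

    ^≡^ : ∀ a k → a ℤ.^ k ≡ a ^ k
    ^≡^ a zero    = ≡.refl
    ^≡^ a (suc k) = ≡.cong (a ℤ.*_) (^≡^ a k)

    ≈-% : .{{_ : ℕ.NonZero n}} → ∀ a → a ≈ + (a %ℕ n)
    ≈-% a = congruent (divides (a /ℕ n) (≡.trans (≡.cong (ℤ._- + (a %ℕ n)) (ℤ.a≡a%ℕn+[a/ℕn]*n a n))
      (solve 2 (λ r k → (r :+ k) :- r := k) ≡.refl (+ (a %ℕ n)) (a /ℕ n ℤ.* + n))))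
      where open ℤ-Ring.Solver

  private
    small : ∀ d → d ℕ.< n → n ∣ₙ d → d ≡ 0
    small zero    d<n n∣d = ≡.refl
    small (suc d) d<n n∣d = contradiction (ℕ∣.∣⇒≤ n∣d) (ℕ.<⇒≱ d<n)

    ordered : ∀ {a b} → a ℕ.≤ b → b ℕ.< n → + b ≈ + a → a ≡ b
    ordered {a} {b} a≤b b<n (congruent n∣) = ℕ.≤-antisym a≤b (ℕ.m∸n≡0⇒m≤n (small (b ℕ.∸ a)
      (ℕ.≤-<-trans (ℕ.m∸n≤m b a) b<n)
      (≡.subst (n ∣ₙ_) (≡.cong ℤ.∣_∣ (≡.trans (ℤ.m-n≡m⊖n b a) (ℤ.⊖-≥ a≤b))) (∣⇒∣ᵤ n∣))))

  abstract
    residue-unique : ∀ {a b} → a ℕ.< n → b ℕ.< n → + a ≈ + b → a ≡ b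
    residue-unique {a} {b} a<n b<n a≈b with ℕ.≤-total a b
    ... | inj₁ a≤b = ordered a≤b b<n (sym a≈b)
    ... | inj₂ b≤a = ≡.sym (ordered b≤a a<n a≈b)


module PrimeField (N : ℕ) (p-prime : Prime (suc N)) where
  private p = suc N
  open Modular p public
  open CommutativeRing ring hiding (zero; ring; _+_; _*_; -_; _-_)
  open LinearAlgebra ring
  open RingTheory ring
  open SetoidReasoning setoid

  abstract
    _≈?0 : ∀ a → Dec (a ≈ + 0)
    a ≈?0 with + p ℤ∣.∣? a
    ... | yes p∣a = yes (∣⇒≈0 p∣a)
    ... | no p∤a = no (p∤a ∘ ≈0⇒∣)

    x*y≈0⇒y≈0 : ∀ {x y} → ¬ (x ≈ + 0) → x ℤ.* y ≈ + 0 → y ≈ + 0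
    x*y≈0⇒y≈0 {x} {y} x≉0 xy≈0
      with euclidsLemma ℤ.∣ x ∣ ℤ.∣ y ∣ p-prime (≡.subst (p ∣ₙ_) (ℤ.abs-* x y) (∣⇒∣ᵤ (≈0⇒∣ xy≈0)))
    ... | inj₁ p∣x = contradiction (∣⇒≈0 (∣ᵤ⇒∣ p∣x)) x≉0
    ... | inj₂ p∣y = ∣⇒≈0 (∣ᵤ⇒∣ p∣y)

    *-cancelˡ : ∀ {x y z} → ¬ (x ≈ + 0) → x ℤ.* y ≈ x ℤ.* z → y ≈ z
    *-cancelˡ {x} {y} {z} x≉0 xy≈xz = x-y≈0⇒x≈y (x*y≈0⇒y≈0 x≉0
      (trans (Solver.solve 3 (λ x y z → x :* (y :- z) := x :* y :- x :* z) refl x y z) (x≈y⇒x-y≈0 xy≈xz)))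
      where open Solver using (_:=_; _:*_; _:-_)

  abstract
    1<p : 1 ℕ.< p
    1<p = ℕ.nonTrivial⇒n>1 p {{prime⇒nonTrivial p-prime}}

    1≉0 : ¬ (+ 1 ≈ + 0)
    1≉0 1≈0 with residue-unique 1<p (s≤s z≤n) 1≈0
    ... | ()

    ^-nonzero : ∀ {x} → ¬ (x ≈ + 0) → ∀ k → ¬ (x ^ k ≈ + 0)
    ^-nonzero x≉0 zero    = 1≉0
    ^-nonzero x≉0 (suc k) = ^-nonzero x≉0 k ∘ x*y≈0⇒y≈0 x≉0

    +-nonzero : ∀ {n} → 0 ℕ.< n → n ℕ.< p → ¬ (+ n ≈ + 0)
    +-nonzero 0<n n<p n≈0 with residue-unique n<p (s≤s z≤n) n≈0
    +-nonzero () n<p n≈0 | ≡.refl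

    inverse : ∀ {x} → ¬ (x ≈ + 0) → ∃ λ y → y ℤ.* x ≈ + 1
    inverse {x} x≉0 with x %ℕ p in eq
    ... | zero = contradiction (trans (≈-% x) (reflexive (≡.cong +_ eq))) x≉0
    ... | suc r = proj₁ inverse-r , trans (*-congˡ {proj₁ inverse-r} (trans (≈-% x) (reflexive (≡.cong (λ z → + z) eq)))) (proj₂ inverse-r)
      where
      r<p : suc r ℕ.< p
      r<p = ≡.subst (ℕ._< p) eq (ℤ.n%ℕd<d x p)
      inverse-r : ∃ λ y → y ℤ.* + suc r ≈ + 1
      inverse-r with coprime-Bézout (prime⇒coprime p-prime r<p)
      ... | Bézout.+- a b 1+br≡ap = ℤ.- (+ b) , (begin
        ℤ.- + b ℤ.* + suc r ≈⟨ Solver.solve 2 (λ b r → :- b :* r := con (+ 1) :- (con (+ 1) :+ b :* r)) refl (+ b) (+ suc r) ⟩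
        + 1 ℤ.- (+ 1 ℤ.+ + b ℤ.* + suc r) ≈⟨ +-congˡ {+ 1} (-‿cong {+ 1 ℤ.+ + b ℤ.* + suc r} {+ 0} (∣⇒≈0 (divides (+ a) (≡.trans
                                                  (≡.cong (λ z → + 1 ℤ.+ z) (≡.sym (ℤ.pos-* b (suc r))))
                                                  (≡.trans (≡.cong +_ 1+br≡ap) (ℤ.pos-* a p)))))) ⟩
        + 1 ∎)
        where open Solver using (_:=_; _:*_; _:-_; _:+_; :-_; con)
      ... | Bézout.-+ a b 1+ap≡br = + b , (begin
        + b ℤ.* + suc r ≡⟨ ≡.trans (≡.sym (ℤ.pos-* b (suc r))) (≡.trans (≡.cong +_ (≡.sym 1+ap≡br)) (≡.cong (λ z → + 1 ℤ.+ z) (ℤ.pos-* a p))) ⟩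
        + 1 ℤ.+ + a ℤ.* + p ≈⟨ +-congˡ {+ 1} {+ a ℤ.* + p} {+ 0} (∣⇒≈0 (divides (+ a) ≡.refl)) ⟩
        + 1 ∎)


-- Powers and discrete logarithms of a generator of the units modulo p

module Generator (N : ℕ) (p-prime : Prime (suc N)) (u : ℤ) (u-generates : GeneratesUnits (suc N) u) where
  private p = suc N
  open PrimeField N p-prime
  open CommutativeRing ring hiding (zero; ring; _+_; _*_; -_; _-_)
  open LinearAlgebra ring
  open RingTheory ring
  open SetoidReasoning setoid

  abstract
    u≉0 : ¬ (u ≈ + 0)
    u≉0 u≈0 = proj₁ u-generates (∣⇒∣ᵤ (≈0⇒∣ u≈0))

    log : ∀ {a} → ¬ (a ≈ + 0) → ∃ λ k → u ^ k ≈ a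
    log {a} a≉0 with proj₂ u-generates a (λ p∣a → a≉0 (∣⇒≈0 (∣ᵤ⇒∣ p∣a)))
    ... | k , u^k≡a = k , trans (reflexive (≡.sym (^≡^ u k))) (mod⇒≈ u^k≡a)

    ^-% : ∀ o .{{_ : ℕ.NonZero o}} → u ^ o ≈ + 1 → ∀ k → u ^ k ≈ u ^ (k % o)
    ^-% o u^o≈1 k = begin
      u ^ k ≡⟨ ≡.cong (u ^_) (m≡m%n+[m/n]*n k o) ⟩
      u ^ (k % o ℕ.+ q ℕ.* o) ≈⟨ ^-homo-* u (k % o) (q ℕ.* o) ⟩
      u ^ (k % o) ℤ.* u ^ (q ℕ.* o) ≡⟨ ≡.cong (λ e → u ^ (k % o) ℤ.* u ^ e) (ℕ.*-comm q o) ⟩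
      u ^ (k % o) ℤ.* u ^ (o ℕ.* q) ≈⟨ *-congˡ {u ^ (k % o)} (trans (sym (^-assocʳ u o q)) (trans (^-congˡ q u^o≈1) (1^n≈1 q))) ⟩
      u ^ (k % o) ℤ.* + 1 ≈⟨ *-identityʳ _ ⟩
      u ^ (k % o) ∎
      where
      q : ℕ
      q = k ℕ./ o

    -- Discrete logarithms modulo o embed the N nonzero residues into Fin o.
    period-≥ : ∀ {o} → 0 ℕ.< o → u ^ o ≈ + 1 → N ℕ.≤ o
    period-≥ {o@(suc _)} _ u^o≈1 = Fin.injective⇒≤ {f = f} f-injective
      where
      a≉0 : ∀ (a : Fin N) → ¬ (+ suc (toℕ a) ≈ + 0)
      a≉0 a = +-nonzero (s≤s z≤n) (s≤s (Fin.toℕ<n a))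
      f : Fin N → Fin o
      f a = fromℕ< (m%n<n (proj₁ (log (a≉0 a))) o)
      recover : ∀ a → u ^ toℕ (f a) ≈ + suc (toℕ a)
      recover a = begin
        u ^ toℕ (f a) ≡⟨ ≡.cong (u ^_) (Fin.toℕ-fromℕ< (m%n<n (proj₁ (log (a≉0 a))) o)) ⟩
        u ^ (proj₁ (log (a≉0 a)) % o) ≈⟨ ^-% o u^o≈1 (proj₁ (log (a≉0 a))) ⟨
        u ^ proj₁ (log (a≉0 a)) ≈⟨ proj₂ (log (a≉0 a)) ⟩
        + suc (toℕ a) ∎
      f-injective : ∀ {a b} → f a ≡ f b → a ≡ b
      f-injective {a} {b} fa≡fb = Fin.toℕ-injective (ℕ.suc-injective (residue-unique
        (s≤s (Fin.toℕ<n a)) (s≤s (Fin.toℕ<n b))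
        (trans (sym (recover a)) (trans (reflexive (≡.cong (λ i → u ^ toℕ i) fa≡fb)) (recover b)))))

    ^-cancel : ∀ {i j} → i ℕ.≤ j → u ^ i ≈ u ^ j → u ^ (j ℕ.∸ i) ≈ + 1
    ^-cancel {i} {j} i≤j u^i≈u^j = *-cancelˡ (^-nonzero u≉0 i) (begin
      u ^ i ℤ.* u ^ (j ℕ.∸ i) ≈⟨ ^-homo-* u i (j ℕ.∸ i) ⟨
      u ^ (i ℕ.+ (j ℕ.∸ i)) ≡⟨ ≡.cong (u ^_) (ℕ.m+[n∸m]≡n i≤j) ⟩
      u ^ j ≈⟨ u^i≈u^j ⟨
      u ^ i ≈⟨ *-identityʳ _ ⟨
      u ^ i ℤ.* + 1 ∎)

  private
    residue : Fin (suc N) → Fin (suc N)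
    residue i = fromℕ< (ℤ.n%ℕd<d (u ^ toℕ i) p)

    toℕ-residue : ∀ i → toℕ (residue i) ≡ u ^ toℕ i %ℕ p
    toℕ-residue i = Fin.toℕ-fromℕ< (ℤ.n%ℕd<d (u ^ toℕ i) p)

    abstract
      residue≢0 : ∀ i → zero ≢ residue i
      residue≢0 i 0≡r = ^-nonzero u≉0 (toℕ i) (trans (≈-% (u ^ toℕ i)) (reflexive (≡.cong (λ z → + z)
        (≡.trans (≡.sym (toℕ-residue i)) (≡.cong toℕ (≡.sym 0≡r))))))

  abstract
    -- The exponents 0, ..., N give N + 1 powers among N nonzero residues. Two of them coincide,
    -- their difference is a period of at most N, and `period-≥` leaves only N.
    u^N≈1 : u ^ N ≈ + 1
    u^N≈1 with Fin.pigeonhole (ℕ.n<1+n N) (λ i → punchOut (residue≢0 i))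
    ... | i , j , i<j , fi≡fj = ≡.subst (λ e → u ^ e ≈ + 1) (ℕ.≤-antisym j-i≤N (period-≥ (ℕ.m<n⇒0<n∸m i<j) u^[j-i]≈1)) u^[j-i]≈1
      where
      residues : u ^ toℕ i %ℕ p ≡ u ^ toℕ j %ℕ p
      residues = ≡.trans (≡.sym (toℕ-residue i)) (≡.trans (≡.cong toℕ (Fin.punchOut-injective (residue≢0 i) (residue≢0 j) fi≡fj)) (toℕ-residue j))
      u^[j-i]≈1 : u ^ (toℕ j ℕ.∸ toℕ i) ≈ + 1
      u^[j-i]≈1 = ^-cancel (ℕ.<⇒≤ i<j) (trans (≈-% (u ^ toℕ i)) (trans (reflexive (≡.cong (λ z → + z) residues)) (sym (≈-% (u ^ toℕ j)))))
      j-i≤N : toℕ j ℕ.∸ toℕ i ℕ.≤ N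
      j-i≤N = ℕ.≤-trans (ℕ.m∸n≤m (toℕ j) (toℕ i)) (ℕ.≤-pred (Fin.toℕ<n j))

  instance
    N-nonZero : ℕ.NonZero N
    N-nonZero = ℕ.>-nonZero (ℕ.≤-pred 1<p)

  abstract
    ^-periodic : ∀ e → u ^ (e ℕ.+ N) ≈ u ^ e
    ^-periodic e = trans (^-homo-* u e N) (trans (*-congˡ {u ^ e} u^N≈1) (*-identityʳ (u ^ e)))

    order-divides : ∀ {e} → u ^ e ≈ + 1 → N ∣ₙ e
    order-divides {e} u^e≈1 = ℕ∣.m%n≡0⇒n∣m e N (remainder (e % N) (m%n<n e N) (trans (sym (^-% N u^N≈1 e)) u^e≈1))
      where
      remainder : ∀ r → r ℕ.< N → u ^ r ≈ + 1 → r ≡ 0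
      remainder zero    r<N _     = ≡.refl
      remainder (suc r) r<N u^r≈1 = contradiction (period-≥ (s≤s z≤n) u^r≈1) (ℕ.<⇒≱ r<N)

    log< : ∀ {a} → ¬ (a ≈ + 0) → ∃ λ (k : Fin N) → u ^ toℕ k ≈ a
    log< a≉0 with log a≉0
    ... | k , u^k≈a = fromℕ< (m%n<n k N) ,
      trans (reflexive (≡.cong (u ^_) (Fin.toℕ-fromℕ< (m%n<n k N)))) (trans (sym (^-% N u^N≈1 k)) u^k≈a)

  private
    ordered : ∀ {i j} → i ℕ.≤ j → j ℕ.< N → u ^ i ≈ u ^ j → i ≡ j
    ordered {i} {j} i≤j j<N u^i≈u^j with j ℕ.∸ i in eq
    ... | zero  = ℕ.≤-antisym i≤j (ℕ.m∸n≡0⇒m≤n eq)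
    ... | suc d = contradiction (period-≥ (s≤s z≤n) (≡.subst (λ e → u ^ e ≈ + 1) eq (^-cancel i≤j u^i≈u^j)))
                    (ℕ.<⇒≱ (≡.subst (ℕ._< N) eq (ℕ.≤-<-trans (ℕ.m∸n≤m j i) j<N)))

  ^-injective : ∀ {i j} → i ℕ.< N → j ℕ.< N → u ^ i ≈ u ^ j → i ≡ j
  ^-injective {i} {j} i<N j<N u^i≈u^j with ℕ.≤-total i j
  ... | inj₁ i≤j = ordered i≤j j<N u^i≈u^j
  ... | inj₂ j≤i = ≡.sym (ordered j≤i i<N (sym u^i≈u^j))

odd⇒coprime-2 : ∀ {s} → ¬ (2 ∣ₙ s) → Coprime s 2
odd⇒coprime-2 2∤s (d∣s , d∣2) with prime⇒irreducible prime[2] d∣2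
... | inj₁ d≡1    = d≡1
... | inj₂ ≡.refl = contradiction d∣s 2∤s

odd⇒1+2* : ∀ {s} → ¬ (2 ∣ₙ s) → ∃ λ h → s ≡ suc (h ℕ.* 2)
odd⇒1+2* {s} 2∤s with s % 2 in eq | m%n<n s 2 | m≡m%n+[m/n]*n s 2
... | 0           | _               | _  = contradiction (ℕ∣.m%n≡0⇒n∣m s 2 eq) 2∤s
... | 1           | _               | s≡ = s ℕ./ 2 , s≡
... | suc (suc _) | s≤s (s≤s ()) | _

half : ∀ {s} → ¬ (2 ∣ₙ s) → ∀ i → i ℕ.≤ (s ℕ.∸ 1) ℕ./ 2 ⊎ s ℕ.∸ i ℕ.≤ (s ℕ.∸ 1) ℕ./ 2
half {s} 2∤s i = ≡.subst₂ (λ s′ h′ → i ℕ.≤ h′ ⊎ s′ ℕ.∸ i ℕ.≤ h′) (≡.sym s≡1+2h)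
  (≡.sym (≡.trans (≡.cong (λ s′ → (s′ ℕ.∸ 1) ℕ./ 2) s≡1+2h) (m*n/n≡m h 2))) (compare (i ℕ.≤? h))
  where
  h = proj₁ (odd⇒1+2* 2∤s)
  s≡1+2h = proj₂ (odd⇒1+2* 2∤s)
  compare : Dec (i ℕ.≤ h) → i ℕ.≤ h ⊎ suc (h ℕ.* 2) ℕ.∸ i ℕ.≤ h
  compare (yes i≤h) = inj₁ i≤h
  compare (no i≰h)  = inj₂ (ℕ.≤-trans (ℕ.∸-monoʳ-≤ (suc (h ℕ.* 2)) (ℕ.≰⇒> i≰h))
    (ℕ.≤-reflexive (≡.trans (≡.cong (ℕ._∸ h) (≡.trans (ℕ.*-comm h 2) (≡.cong (h ℕ.+_) (ℕ.+-identityʳ h)))) (ℕ.m+n∸n≡m h h))))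

block-index : ∀ {N m s} → N ≡ m ℕ.* s → ∀ e → e ℕ.< N → s ∣ₙ e → ∃ λ (h : Fin m) → e ≡ toℕ h ℕ.* s
block-index {N} {m} {s} N≡ms e e<N (ℕ∣.divides h e≡hs) =
  fromℕ< h<m , ≡.trans e≡hs (≡.cong (ℕ._* s) (≡.sym (Fin.toℕ-fromℕ< h<m)))
  where
  h<m : h ℕ.< m
  h<m = ℕ.*-cancelʳ-< s h m (≡.subst₂ ℕ._<_ e≡hs N≡ms e<N)

-- Solutions of uᵏ + u^(h s + l) = 0 modulo p

module ExponentCount (N : ℕ) (p-prime : Prime (suc N)) (u : ℤ) (u-generates : GeneratesUnits (suc N) u)
  (m s : ℕ) (N≡ms : N ≡ m ℕ.* s) (2∤s : ¬ (2 ∣ₙ s)) where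
  open PrimeField N p-prime
  open Generator N p-prime u u-generates
  open CommutativeRing ring hiding (zero; ring; _+_; _*_; -_; _-_)
  open LinearAlgebra ring using (_^_)
  open RingTheory ring
  open SetoidReasoning setoid
  private module S = Modular s
  private module SR = CommutativeRing S.ring

  private
    s∣N : s ∣ₙ N
    s∣N = ℕ∣.divides m N≡ms

    ordered : ∀ {i j} → i ℕ.≤ j → u ^ i ≈ u ^ j → + j S.≋ₙ + i
    ordered {i} {j} i≤j u^i≈u^j = S.congruent (∣ᵤ⇒∣ (≡.subst (s ∣ₙ_)
      (≡.sym (≡.cong ℤ.∣_∣ (≡.trans (ℤ.m-n≡m⊖n j i) (ℤ.⊖-≥ i≤j))))
      (ℕ∣.∣-trans s∣N (order-divides (^-cancel i≤j u^i≈u^j)))))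

    exponents : ∀ i j → u ^ i ≈ u ^ j → + i S.≋ₙ + j
    exponents i j u^i≈u^j with ℕ.≤-total i j
    ... | inj₁ i≤j = SR.sym (ordered i≤j u^i≈u^j)
    ... | inj₂ j≤i = ordered j≤i (sym u^i≈u^j)

    halve : ∀ {i j} → + (i ℕ.+ i) S.≋ₙ + (j ℕ.+ j) → + i S.≋ₙ + j
    halve {i} {j} (S.congruent s∣) = S.congruent (∣ᵤ⇒∣ (coprime-divisor (odd⇒coprime-2 2∤s)
      (≡.subst (s ∣ₙ_) (≡.trans (≡.cong ℤ.∣_∣ double) (ℤ.abs-* (+ 2) (+ i ℤ.- + j))) (∣⇒∣ᵤ s∣))))
      where
      double : + (i ℕ.+ i) ℤ.- + (j ℕ.+ j) ≡ + 2 ℤ.* (+ i ℤ.- + j)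
      double = ℤ-Ring.Solver.solve 2 (λ i j → (i :+ i) :- (j :+ j) := con (+ 2) :* (i :- j)) ≡.refl (+ i) (+ j)
        where open ℤ-Ring.Solver using (_:=_; _:*_; _:-_; _:+_; con)

    square : ∀ i j → u ^ i ℤ.+ u ^ j ≈ + 0 → u ^ (i ℕ.+ i) ≈ u ^ (j ℕ.+ j)
    square i j x+y≈0 = begin
      u ^ (i ℕ.+ i) ≈⟨ ^-homo-* u i i ⟩
      u ^ i ℤ.* u ^ i ≈⟨ x-y≈0⇒x≈y (trans (Solver.solve 2 (λ x y → x :* x :- y :* y := (x :- y) :* (x :+ y)) refl (u ^ i) (u ^ j)) (trans (*-congˡ {u ^ i ℤ.- u ^ j} x+y≈0) (zeroʳ (u ^ i ℤ.- u ^ j)))) ⟩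
      u ^ j ℤ.* u ^ j ≈⟨ ^-homo-* u j j ⟨
      u ^ (j ℕ.+ j) ∎
      where open Solver using (_:=_; _:*_; _:-_; _:+_)

    block : ∀ h l → + (h ℕ.* s ℕ.+ l) S.≋ₙ + l
    block h l = S.congruent (divides (+ h) (≡.trans
      (≡.cong (λ z → z ℤ.+ + l ℤ.- + l) (ℤ.pos-* h s))
      (ℤ-Ring.Solver.solve 2 (λ z l → z :+ l :- l := z) ≡.refl (+ h ℤ.* + s) (+ l))))
      where open ℤ-Ring.Solver using (_:=_; _:-_; _:+_)

  -- Squaring removes the sign: the exponents 2k and 2(h s + l) agree modulo N, hence modulo s, and
  -- 2 is invertible modulo the odd number s.
  opposite-blocks : ∀ {k l} → k ℕ.< s → l ℕ.< s → ∀ h → u ^ k ℤ.+ u ^ (h ℕ.* s ℕ.+ l) ≈ + 0 → k ≡ l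
  opposite-blocks {k} {l} k<s l<s h opposite = S.residue-unique k<s l<s
    (SR.trans (halve {k} {h ℕ.* s ℕ.+ l} (exponents _ _ (square k (h ℕ.* s ℕ.+ l) opposite))) (block h l))

  private
    -1≉0 : ¬ (ℤ.- + 1 ≈ + 0)
    -1≉0 -1≈0 = 1≉0 (-‿cong -1≈0)

    -- From (-1)² = 1 one gets s ∣ 2g, and s is odd. So -1 is an s-th power modulo p.
    minus-one-exponent : ∀ g → u ^ g ≈ ℤ.- + 1 → s ∣ₙ g
    minus-one-exponent g u^g≈-1 = ∣⇒∣ᵤ (S.≈0⇒∣ {+ g} (halve {g} {0} (exponents (g ℕ.+ g) 0 (square g 0 opposite))))
      where
      opposite : u ^ g ℤ.+ u ^ 0 ≈ + 0
      opposite = +-congʳ {+ 1} {u ^ g} {ℤ.- + 1} u^g≈-1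

    minus-one : ∃ λ (h : Fin m) → u ^ (toℕ h ℕ.* s) ≈ ℤ.- + 1
    minus-one = proj₁ index , trans (reflexive (≡.cong (u ^_) (≡.sym (proj₂ index)))) (proj₂ g)
      where
      g : ∃ λ (k : Fin N) → u ^ toℕ k ≈ ℤ.- + 1
      g = log< -1≉0
      index : ∃ λ (h : Fin m) → toℕ (proj₁ g) ≡ toℕ h ℕ.* s
      index = block-index N≡ms (toℕ (proj₁ g)) (Fin.toℕ<n (proj₁ g)) (minus-one-exponent (toℕ (proj₁ g)) (proj₂ g))

  private
    h₀ : Fin m
    h₀ = proj₁ minus-one

    w : Fin m → ℤ
    w h = u ^ (toℕ h ℕ.* s)

    factor : ∀ h k → u ^ k ℤ.+ u ^ (toℕ h ℕ.* s ℕ.+ k) ≈ u ^ k ℤ.* (w h ℤ.+ + 1)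
    factor h k = begin
      u ^ k ℤ.+ u ^ (toℕ h ℕ.* s ℕ.+ k) ≈⟨ +-congˡ {u ^ k} (^-homo-* u (toℕ h ℕ.* s) k) ⟩
      u ^ k ℤ.+ w h ℤ.* u ^ k ≈⟨ Solver.solve 2 (λ x y → x :+ y :* x := x :* (y :+ con (+ 1))) refl (u ^ k) (w h) ⟩
      u ^ k ℤ.* (w h ℤ.+ + 1) ∎
      where open Solver using (_:=_; _:*_; _:+_; con)

    s-nonZero : ℕ.NonZero s
    s-nonZero = ℕ.≢-nonZero λ s≡0 → 2∤s (≡.subst (2 ∣ₙ_) (≡.sym s≡0) (2 ℕ∣.∣0))

    bound : ∀ (h : Fin m) → toℕ h ℕ.* s ℕ.< N
    bound h = ≡.subst (toℕ h ℕ.* s ℕ.<_) (≡.sym N≡ms) (ℕ.*-monoˡ-< s {{s-nonZero}} (Fin.toℕ<n h))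

    opposite-h₀ : ∀ k → u ^ k ℤ.+ u ^ (toℕ h₀ ℕ.* s ℕ.+ k) ≈ + 0
    opposite-h₀ k = begin
      u ^ k ℤ.+ u ^ (toℕ h₀ ℕ.* s ℕ.+ k) ≈⟨ factor h₀ k ⟩
      u ^ k ℤ.* (w h₀ ℤ.+ + 1) ≈⟨ *-congˡ {u ^ k} {w h₀ ℤ.+ + 1} {+ 0} (+-congʳ {+ 1} {w h₀} {ℤ.- + 1} (proj₂ minus-one)) ⟩
      u ^ k ℤ.* + 0 ≈⟨ zeroʳ (u ^ k) ⟩
      + 0 ∎

    opposite-unique : ∀ h k → u ^ k ℤ.+ u ^ (toℕ h ℕ.* s ℕ.+ k) ≈ + 0 → h ≡ h₀
    opposite-unique h k opposite = Fin.toℕ-injective (ℕ.*-cancelʳ-≡ (toℕ h) (toℕ h₀) s {{s-nonZero}}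
      (^-injective (bound h) (bound h₀) (trans w≈-1 (sym (proj₂ minus-one)))))
      where
      w+1≈0 : w h ℤ.+ + 1 ≈ + 0
      w+1≈0 = x*y≈0⇒y≈0 (^-nonzero u≉0 k) (trans (sym (factor h k)) opposite)
      w≈-1 : w h ≈ ℤ.- + 1
      w≈-1 = x-y≈0⇒x≈y {w h} {ℤ.- + 1} w+1≈0

  -- Dividing by uᵏ leaves u^(h s) = -1. This has exactly one solution because h s < N, and the
  -- solution does not depend on `k`.
  opposite-block : ∃ λ (h₀ : Fin m) → (∀ k → u ^ k ℤ.+ u ^ (toℕ h₀ ℕ.* s ℕ.+ k) ≈ + 0) ×
                   (∀ (h : Fin m) k → u ^ k ℤ.+ u ^ (toℕ h ℕ.* s ℕ.+ k) ≈ + 0 → h ≡ h₀)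
  opposite-block = h₀ , opposite-h₀ , opposite-unique

-- Over ℤ/p the vectors μ₀, …, μ_{s-1} are, up to scaling, dual to μ₀, μ₋₁, …, so that
-- s Σ aₖ² = Σᵢ (a · μᵢ) (a · μ₋ᵢ), and one of i, s - i is at most (s - 1) / 2.
module Parseval (N : ℕ) (p-prime : Prime (suc N)) (β : ℤ) (β-order : HasOrder (suc N) β N)
  (m s : ℕ) (N≡ms : N ≡ m ℕ.* s) (2∤s : ¬ (2 ∣ₙ s)) where
  open PrimeField N p-prime
  open CommutativeRing ring hiding (zero; ring; _+_; _*_; -_; _-_)
  open LinearAlgebra ring using (_^_; sum; _·_)
  open RingTheory ring
  open SetoidReasoning setoid

  private
    α : ℤ
    α = β ℤ.^ m

    β^N≈1 : β ^ N ≈ + 1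
    β^N≈1 = trans (reflexive (≡.sym (^≡^ β N))) (mod⇒≈ (proj₁ β-order))

    β-minimal : ∀ k → 0 ℕ.< k → k ℕ.< N → ¬ (β ^ k ≈ + 1)
    β-minimal k 0<k k<N β^k≈1 = proj₂ β-order k 0<k k<N (≈⇒mod (trans (reflexive (^≡^ β k)) β^k≈1))

    α^≈ : ∀ k → α ^ k ≈ β ^ (m ℕ.* k)
    α^≈ k = trans (^-congˡ k (reflexive (^≡^ β m))) (^-assocʳ β m k)

    α^s≈1 : α ^ s ≈ + 1
    α^s≈1 = trans (α^≈ s) (trans (reflexive (≡.cong (β ^_) (≡.sym N≡ms))) β^N≈1)

    0<s : 0 ℕ.< s
    0<s = ℕ.n≢0⇒n>0 λ s≡0 → 2∤s (≡.subst (2 ∣ₙ_) (≡.sym s≡0) (2 ℕ∣.∣0))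

    0<N : 0 ℕ.< N
    0<N = ℕ.≤-pred 1<p

    0<m : 0 ℕ.< m
    0<m = ℕ.n≢0⇒n>0 λ m≡0 → ℕ.<⇒≢ 0<N (≡.sym (≡.trans N≡ms (≡.cong (ℕ._* s) m≡0)))

    α-minimal : ∀ k → 0 ℕ.< k → k ℕ.< s → ¬ (α ^ k ≈ + 1)
    α-minimal k 0<k k<s α^k≈1 = β-minimal (m ℕ.* k)
      (ℕ.*-mono-< 0<m 0<k) (≡.subst (m ℕ.* k ℕ.<_) (≡.sym N≡ms) (ℕ.*-monoʳ-< m {{ℕ.>-nonZero 0<m}} k<s))
      (trans (sym (α^≈ k)) α^k≈1)

    α≉0 : ¬ (α ≈ + 0)
    α≉0 α≈0 = 1≉0 (trans (sym α^s≈1) (power-zero s 0<s))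
      where
      power-zero : ∀ s → 0 ℕ.< s → α ^ s ≈ + 0
      power-zero (suc s) _ = trans (*-congʳ {α ^ s} α≈0) (zeroˡ (α ^ s))

    ordered : ∀ {k l} → k ℕ.≤ l → l ℕ.< s → α ^ k ≈ α ^ l → k ≡ l
    ordered {k} {l} k≤l l<s α^k≈α^l with l ℕ.∸ k in eq
    ... | zero  = ℕ.≤-antisym k≤l (ℕ.m∸n≡0⇒m≤n eq)
    ... | suc d = contradiction
      (*-cancelˡ (^-nonzero α≉0 k) (begin
        α ^ k ℤ.* α ^ suc d ≡⟨ ≡.cong (λ e → α ^ k ℤ.* α ^ e) eq ⟨
        α ^ k ℤ.* α ^ (l ℕ.∸ k) ≈⟨ ^-homo-* α k (l ℕ.∸ k) ⟨
        α ^ (k ℕ.+ (l ℕ.∸ k)) ≡⟨ ≡.cong (α ^_) (ℕ.m+[n∸m]≡n k≤l) ⟩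
        α ^ l ≈⟨ α^k≈α^l ⟨
        α ^ k ≈⟨ *-identityʳ (α ^ k) ⟨
        α ^ k ℤ.* + 1 ∎))
      (α-minimal (suc d) (s≤s z≤n) (≡.subst (ℕ._< s) eq (ℕ.≤-<-trans (ℕ.m∸n≤m l k) l<s)))

    α^-injective : ∀ (k l : Fin s) → α ^ toℕ k ≈ α ^ toℕ l → k ≡ l
    α^-injective k l α^k≈α^l with ℕ.≤-total (toℕ k) (toℕ l)
    ... | inj₁ k≤l = Fin.toℕ-injective (ordered k≤l (Fin.toℕ<n l) α^k≈α^l)
    ... | inj₂ l≤k = ≡.sym (Fin.toℕ-injective (ordered l≤k (Fin.toℕ<n k) (sym α^k≈α^l)))

    x : Fin s → ℤ
    x k = α ^ toℕ k

    x^s≈1 : ∀ k → x k ^ s ≈ + 1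
    x^s≈1 k = begin
      (α ^ toℕ k) ^ s ≈⟨ ^-assocʳ α (toℕ k) s ⟩
      α ^ (toℕ k ℕ.* s) ≡⟨ ≡.cong (α ^_) (ℕ.*-comm (toℕ k) s) ⟩
      α ^ (s ℕ.* toℕ k) ≈⟨ ^-assocʳ α s (toℕ k) ⟨
      (α ^ s) ^ toℕ k ≈⟨ ^-congˡ (toℕ k) α^s≈1 ⟩
      (+ 1) ^ toℕ k ≈⟨ 1^n≈1 (toℕ k) ⟩
      + 1 ∎

    -- The orthogonality relation of the characters: since the `x l` are s-th roots of unity, the
    -- exponent s - i plays the role of -i. The index i = 0 is paired with s.
    X : Fin s → Fin s → ℤ
    X k l = sum {s} (λ i → x k ^ toℕ i ℤ.* x l ^ (s ℕ.∸ toℕ i))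

    X-off : ∀ {k l} → k ≢ l → X k l ≈ + 0
    X-off {k} {l} k≢l = x*y≈0⇒y≈0 {x k ℤ.- x l} (k≢l ∘ α^-injective k l ∘ x-y≈0⇒x≈y) (begin
      (x k ℤ.- x l) ℤ.* X k l ≈⟨ sum-geometric (x k) (x l) s ⟩
      x l ℤ.* (x k ^ s ℤ.- x l ^ s) ≈⟨ *-congˡ {x l} (x≈y⇒x-y≈0 (trans (x^s≈1 k) (sym (x^s≈1 l)))) ⟩
      x l ℤ.* + 0 ≈⟨ zeroʳ (x l) ⟩
      + 0 ∎)

    X-diag : ∀ k → X k k ≈ + s
    X-diag k = begin
      X k k ≈⟨ sum-cong-≋ {s} (λ i → trans (sym (^-homo-* (x k) (toℕ i) (s ℕ.∸ toℕ i)))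
                                              (trans (reflexive (≡.cong (x k ^_) (ℕ.m+[n∸m]≡n (ℕ.<⇒≤ (Fin.toℕ<n i))))) (x^s≈1 k))) ⟩
      sum {s} (λ _ → + 1) ≡⟨ ones s ⟩
      + s ∎
      where
      ones : ∀ s → sum {s} (λ _ → + 1) ≡ + s
      ones zero    = ≡.refl
      ones (suc s) = ≡.cong (λ z → + 1 ℤ.+ z) (ones s)

    s≉0 : ¬ (+ s ≈ + 0)
    s≉0 = +-nonzero 0<s (s≤s (ℕ∣.∣⇒≤ {{ℕ.>-nonZero 0<N}} (ℕ∣.divides m N≡ms)))

  module _ (a : Vector ℤ s) (a∈𝓜 : ∀ i → i ℕ.≤ (s ℕ.∸ 1) ℕ./ 2 → a · μ α i ≡ + 0 [mod suc N ]) where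
    private
      â : ℕ → ℤ
      â i = sum {s} (λ k → a k ℤ.* x k ^ i)

      â≈0 : ∀ i → i ℕ.≤ (s ℕ.∸ 1) ℕ./ 2 → â i ≈ + 0
      â≈0 i i≤ = trans (sum-cong-≋ {s} (λ k → *-congˡ {a k} (trans (^-assocʳ α (toℕ k) i) (reflexive (≡.sym (^≡^ α (toℕ k ℕ.* i)))))))
                       (mod⇒≈ (a∈𝓜 i i≤))

      products≈0 : ∀ (i : Fin s) → â (toℕ i) ℤ.* â (s ℕ.∸ toℕ i) ≈ + 0
      products≈0 i with half 2∤s (toℕ i)
      ... | inj₁ i≤ = trans (*-congʳ {â (s ℕ.∸ toℕ i)} (â≈0 (toℕ i) i≤)) (zeroˡ (â (s ℕ.∸ toℕ i)))
      ... | inj₂ ≤i = trans (*-congˡ {â (toℕ i)} (â≈0 (s ℕ.∸ toℕ i) ≤i)) (zeroʳ (â (toℕ i)))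

      term : Fin s → Fin s → Fin s → ℤ
      term i k l = (a k ℤ.* a l) ℤ.* (x k ^ toℕ i ℤ.* x l ^ (s ℕ.∸ toℕ i))

      expand : ∀ i → â (toℕ i) ℤ.* â (s ℕ.∸ toℕ i) ≈ sum {s} (λ k → sum {s} (λ l → term i k l))
      expand i = trans (*-distribʳ-sum {s} (â (s ℕ.∸ toℕ i)) (λ k → a k ℤ.* x k ^ toℕ i)) (sum-cong-≋ {s} λ k →
        trans (*-distribˡ-sum {s} (a k ℤ.* x k ^ toℕ i) (λ l → a l ℤ.* x l ^ (s ℕ.∸ toℕ i))) (sum-cong-≋ {s} λ l →
          Solver.solve 4 (λ a x b y → (a :* x) :* (b :* y) := (a :* b) :* (x :* y)) refl (a k) (x k ^ toℕ i) (a l) (x l ^ (s ℕ.∸ toℕ i))))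
        where open Solver using (_:=_; _:*_)

      sum-squares : sum {s} (λ i → â (toℕ i) ℤ.* â (s ℕ.∸ toℕ i)) ≈ + s ℤ.* (a · a)
      sum-squares = begin
        sum {s} (λ i → â (toℕ i) ℤ.* â (s ℕ.∸ toℕ i))
          ≈⟨ sum-cong-≋ {s} expand ⟩
        sum {s} (λ i → sum {s} (λ k → sum {s} (λ l → term i k l)))
          ≈⟨ ∑-comm {s} {s} (λ i k → sum {s} (λ l → term i k l)) ⟩
        sum {s} (λ k → sum {s} (λ i → sum {s} (λ l → term i k l)))
          ≈⟨ sum-cong-≋ {s} (λ k → ∑-comm {s} {s} (λ i l → term i k l)) ⟩
        sum {s} (λ k → sum {s} (λ l → sum {s} (λ i → term i k l)))
          ≈⟨ sum-cong-≋ {s} (λ k → sum-cong-≋ {s} (λ l → sym (*-distribˡ-sum {s} (a k ℤ.* a l) (λ i → x k ^ toℕ i ℤ.* x l ^ (s ℕ.∸ toℕ i))))) ⟩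
        sum {s} (λ k → sum {s} (λ l → (a k ℤ.* a l) ℤ.* X k l))
          ≈⟨ sum-cong-≋ {s} (λ k → trans (sum-single {s} (λ l → (a k ℤ.* a l) ℤ.* X k l) k
               (λ l l≢k → trans (*-congˡ {a k ℤ.* a l} (X-off (l≢k ∘ ≡.sym))) (zeroʳ (a k ℤ.* a l))))
               (trans (*-congˡ {a k ℤ.* a k} (X-diag k)) (*-comm (a k ℤ.* a k) (+ s)))) ⟩
        sum {s} (λ k → + s ℤ.* (a k ℤ.* a k))
          ≈⟨ *-distribˡ-sum {s} (+ s) (λ k → a k ℤ.* a k) ⟨
        + s ℤ.* (a · a) ∎

    p∣a·a : + suc N ∣ℤ a · a
    p∣a·a = ≈0⇒∣ (x*y≈0⇒y≈0 s≉0 (trans (sym sum-squares) (sum-zero {s} products≈0)))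

-- The cyclotomic field and its subfield of degree s

module RootsOfUnity (N : ℕ) (p-prime : Prime (suc N)) (L : FieldOverℚ) (ζ : ∣ L ∣ᶠ)
  (ζ-primitive : IsPrimitiveRootOfUnity L (suc N) ζ) where
  private
    p = suc N
    module Z = PrimeField N p-prime
    module ZR = CommutativeRing Z.ring
  open FieldOverℚ L
  open LinearAlgebra commutativeRing using (_×ℕ_)
  open RingTheory commutativeRing
  open FieldTheory L
  open IntegerCombinations commutativeRing
  open SetoidReasoning (CommutativeRing.setoid commutativeRing)

  private
    ζ^% : ∀ k → ζ ^ k ≈ ζ ^ (k % p)
    ζ^% k = begin
      ζ ^ k ≡⟨ ≡.cong (ζ ^_) (m≡m%n+[m/n]*n k p) ⟩
      ζ ^ (k % p ℕ.+ k ℕ./ p ℕ.* p) ≈⟨ ^-homo-* ζ (k % p) (k ℕ./ p ℕ.* p) ⟩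
      ζ ^ (k % p) * ζ ^ (k ℕ./ p ℕ.* p) ≡⟨ ≡.cong (λ e → ζ ^ (k % p) * ζ ^ e) (ℕ.*-comm (k ℕ./ p) p) ⟩
      ζ ^ (k % p) * ζ ^ (p ℕ.* (k ℕ./ p)) ≈⟨ *-congˡ (trans (sym (^-assocʳ ζ p (k ℕ./ p))) (trans (^-congˡ (k ℕ./ p) (proj₁ ζ-primitive)) (1^n≈1 (k ℕ./ p)))) ⟩
      ζ ^ (k % p) * 1# ≈⟨ *-identityʳ _ ⟩
      ζ ^ (k % p) ∎

  abstract
    -- The additive character of ℤ/p with ψ(1) = ζ. Reducing the exponent first gives a meaning to
    -- ζᵃ for negative `a`.
    ψ : ℤ → Carrier
    ψ a = ζ ^ (a %ℕ p)

    ψ-cong : ∀ {a b} → a Z.≋ₙ b → ψ a ≈ ψ b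
    ψ-cong {a} {b} a≈b = reflexive (≡.cong (ζ ^_) (Z.residue-unique (ℤ.n%ℕd<d a p) (ℤ.n%ℕd<d b p)
      (ZR.trans (ZR.sym (Z.≈-% a)) (ZR.trans a≈b (Z.≈-% b)))))

    ζ^≈ψ : ∀ k → ζ ^ k ≈ ψ (+ k)
    ζ^≈ψ = ζ^%

    ψ≡ : ∀ a → ψ a ≡ ζ ^ (a %ℕ p)
    ψ≡ a = ≡.refl

    ψ-0 : ψ (+ 0) ≈ 1#
    ψ-0 = refl

  ψ-+ : ∀ a b → ψ (a ℤ.+ b) ≈ ψ a * ψ b
  ψ-+ a b = begin
    ψ (a ℤ.+ b) ≈⟨ ψ-cong (ZR.+-cong (Z.≈-% a) (Z.≈-% b)) ⟩
    ψ (+ (a %ℕ p ℕ.+ b %ℕ p)) ≈⟨ ζ^≈ψ (a %ℕ p ℕ.+ b %ℕ p) ⟨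
    ζ ^ (a %ℕ p ℕ.+ b %ℕ p) ≈⟨ ^-homo-* ζ (a %ℕ p) (b %ℕ p) ⟩
    ζ ^ (a %ℕ p) * ζ ^ (b %ℕ p) ≡⟨ ≡.cong₂ _*_ (ψ≡ a) (ψ≡ b) ⟨
    ψ a * ψ b ∎

  ψ-^ : ∀ a k → ψ a ^ k ≈ ψ (+ k ℤ.* a)
  ψ-^ a zero    = sym (trans (reflexive (≡.cong ψ (ℤ.*-zeroˡ a))) ψ-0)
  ψ-^ a (suc k) = begin
    ψ a * ψ a ^ k ≈⟨ *-congˡ (ψ-^ a k) ⟩
    ψ a * ψ (+ k ℤ.* a) ≈⟨ ψ-+ a (+ k ℤ.* a) ⟨
    ψ (a ℤ.+ + k ℤ.* a) ≡⟨ ≡.cong ψ (ℤ-Ring.Solver.solve 2 (λ a k → a :+ k :* a := (con (+ 1) :+ k) :* a) ≡.refl a (+ k)) ⟩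
    ψ (+ suc k ℤ.* a) ∎
    where open ℤ-Ring.Solver using (_:=_; _:*_; _:+_; con)

  ψ-neg : ∀ a → ψ a * ψ (ℤ.- a) ≈ 1#
  ψ-neg a = trans (sym (ψ-+ a (ℤ.- a))) (trans (reflexive (≡.cong ψ (ℤ.+-inverseʳ a))) ψ-0)

  ψ≈1⇒≈0 : ∀ {a} → ψ a ≈ 1# → a Z.≋ₙ + 0
  ψ≈1⇒≈0 {a} ψa≈1 = ZR.trans (Z.≈-% a) (ZR.reflexive (≡.cong (λ r → + r) (trivial (a %ℕ p) (ℤ.n%ℕd<d a p) (trans (reflexive (≡.sym (ψ≡ a))) ψa≈1))))
    where
    trivial : ∀ r → r ℕ.< p → ζ ^ r ≈ 1# → r ≡ 0
    trivial zero    r<p ζ^r≈1 = ≡.refl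
    trivial (suc r) r<p ζ^r≈1 = contradiction ζ^r≈1 (proj₂ ζ-primitive (suc r) (s≤s z≤n) r<p)

  ψ-injective : ∀ {a b} → ψ a ≈ ψ b → a Z.≋ₙ b
  ψ-injective {a} {b} ψa≈ψb = RingTheory.x-y≈0⇒x≈y Z.ring (ψ≈1⇒≈0 {a ℤ.- b} (begin
    ψ (a ℤ.- b) ≈⟨ ψ-+ a (ℤ.- b) ⟩
    ψ a * ψ (ℤ.- b) ≈⟨ *-congʳ ψa≈ψb ⟩
    ψ b * ψ (ℤ.- b) ≈⟨ ψ-neg b ⟩
    1# ∎))

  p×1≉0 : ¬ (p ×ℕ 1# ≈ 0#)
  p×1≉0 = fromℤ-nonzero {+ p} (λ ())

  private
    fixed-sum : ∀ {w S} → ¬ (w ≈ 1#) → w * S ≈ S → S ≈ 0#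
    fixed-sum {w} {S} w≉1 wS≈S = x*y≈0⇒y≈0 {w - 1#} (w≉1 ∘ x-y≈0⇒x≈y) (begin
      (w - 1#) * S ≈⟨ Solver.solve 2 (λ w S → (w :- con (+ 1)) :* S := w :* S :- S) refl w S ⟩
      w * S - S ≈⟨ x≈y⇒x-y≈0 wS≈S ⟩
      0# ∎)
      where open Solver using (_:=_; _:*_; _:-_; con)

  private
    +p≈ : ∀ r → + (r ℕ.+ p) Z.≋ₙ + r
    +p≈ r = ZR.trans (ZR.+-congˡ {+ r} {+ p} {+ 0} (Z.∣⇒≈0 ℤ∣.∣-refl)) (ZR.+-identityʳ (+ r))

  sum-ψ : ∀ c → ¬ (c Z.≋ₙ + 0) → sum {p} (λ i → ψ (c ℤ.* + toℕ i)) ≈ 0#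
  sum-ψ c c≉0 = fixed-sum {ψ c} (c≉0 ∘ ψ≈1⇒≈0) (begin
    ψ c * sum {p} (λ i → f (toℕ i)) ≈⟨ *-distribˡ-sum {p} (ψ c) (λ i → f (toℕ i)) ⟩
    sum {p} (λ i → ψ c * f (toℕ i)) ≈⟨ sum-cong-≋ {p} (λ i → step (toℕ i)) ⟩
    sum {p} (λ i → f (toℕ i ℕ.+ 1)) ≈⟨ sum-shift p f periodic 1 ⟩
    sum {p} (λ i → f (toℕ i)) ∎)
    where
    f : ℕ → Carrier
    f i = ψ (c ℤ.* + i)
    step : ∀ i → ψ c * f i ≈ f (i ℕ.+ 1)
    step i = trans (sym (ψ-+ c (c ℤ.* + i))) (reflexive (≡.cong ψ
      (ℤ-Ring.Solver.solve 2 (λ c i → c :+ c :* i := c :* (i :+ con (+ 1))) ≡.refl c (+ i))))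
      where open ℤ-Ring.Solver using (_:=_; _:*_; _:+_; con)
    periodic : ∀ i → f (i ℕ.+ p) ≈ f i
    periodic i = ψ-cong {c ℤ.* + (i ℕ.+ p)} {c ℤ.* + i} (ZR.*-congˡ {c} (+p≈ i))

  private
    exponent-step : ∀ r i → ℤ.- r ℤ.* i ≡ i ℤ.+ ℤ.- (r ℤ.+ + 1) ℤ.* i
    exponent-step = ℤ-Ring.Solver.solve 2 (λ r i → (:- r) :* i := i :+ (:- (r :+ con (+ 1))) :* i) ≡.refl
      where open ℤ-Ring.Solver using (_:=_; _:*_; _:+_; :-_; con)

  -- The resolvents Σᵣ yʳ ζ⁻ⁱʳ are eigenvectors of multiplication by y, and they do not all vanish.
  module _ (y : Carrier) (y^p≈1 : y ^ p ≈ 1#) where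
    private
      f : ℤ → ℕ → Carrier
      f i r = y ^ r * ψ (ℤ.- (+ r) ℤ.* i)

      S : ℤ → Carrier
      S i = sum {p} (λ r → f i (toℕ r))

      sum-ψ-0 : sum {p} (λ i → ψ (ℤ.- (+ 0) ℤ.* + toℕ i)) ≈ p ×ℕ 1#
      sum-ψ-0 = trans (sum-cong-≋ {p} {λ i → ψ (ℤ.- (+ 0) ℤ.* + toℕ i)} {λ _ → 1#}
        (λ i → trans (reflexive (≡.cong ψ (ℤ.*-zeroˡ (+ toℕ i)))) ψ-0)) (sum-replicate p)

      r≈0⇒r≡0 : ∀ (r : Fin p) → ℤ.- (+ toℕ r) Z.≋ₙ + 0 → r ≡ zero
      r≈0⇒r≡0 r -r≈0 = Fin.toℕ-injective (Z.residue-unique (Fin.toℕ<n r) (s≤s z≤n)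
        (ZR.trans (ZR.reflexive (≡.sym (ℤ.neg-involutive (+ toℕ r)))) (ZR.-‿cong -r≈0)))

      sum-S : sum {p} (λ i → S (+ toℕ i)) ≈ p ×ℕ 1#
      sum-S = begin
        sum {p} (λ i → sum {p} (λ r → f (+ toℕ i) (toℕ r))) ≈⟨ ∑-comm {p} {p} (λ i r → f (+ toℕ i) (toℕ r)) ⟩
        sum {p} (λ r → sum {p} (λ i → f (+ toℕ i) (toℕ r))) ≈⟨ sum-cong-≋ {p} {λ r → sum {p} (λ i → f (+ toℕ i) (toℕ r))} {g} (λ r → sym (*-distribˡ-sum {p} (y ^ toℕ r) (λ i → ψ (ℤ.- (+ toℕ r) ℤ.* + toℕ i)))) ⟩
        sum {p} g ≈⟨ sum-single {p} g zero (λ r r≢0 → trans (*-congˡ {y ^ toℕ r} (sum-ψ (ℤ.- (+ toℕ r)) (r≢0 ∘ r≈0⇒r≡0 r))) (zeroʳ (y ^ toℕ r))) ⟩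
        g zero ≈⟨ *-identityˡ _ ⟩
        sum {p} (λ i → ψ (ℤ.- (+ 0) ℤ.* + toℕ i)) ≈⟨ sum-ψ-0 ⟩
        p ×ℕ 1# ∎
        where
        g : Fin p → Carrier
        g r = y ^ toℕ r * sum {p} (λ i → ψ (ℤ.- (+ toℕ r) ℤ.* + toℕ i))

      nonzero-resolvent : ∃ λ (i : Fin p) → ¬ (S (+ toℕ i) ≈ 0#)
      nonzero-resolvent = Fin.¬∀⟶∃¬ p (λ i → S (+ toℕ i) ≈ 0#) (λ i → S (+ toℕ i) ≟ 0#)
        (λ S≈0 → p×1≉0 (trans (sym sum-S) (sum-zero {p} S≈0)))

      periodic : ∀ i r → f i (r ℕ.+ p) ≈ f i r
      periodic i r = *-cong (trans (^-homo-* y r p) (trans (*-congˡ y^p≈1) (*-identityʳ _)))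
        (ψ-cong {ℤ.- (+ (r ℕ.+ p)) ℤ.* i} {ℤ.- (+ r) ℤ.* i} (ZR.*-congʳ {i} (ZR.-‿cong {+ (r ℕ.+ p)} {+ r} (+p≈ r))))

      step : ∀ i r → y * f i r ≈ ψ i * f i (r ℕ.+ 1)
      step i r = begin
        y * (y ^ r * ψ (ℤ.- (+ r) ℤ.* i))
          ≈⟨ *-congˡ (*-congˡ (trans (reflexive (≡.cong ψ (exponent-step (+ r) i))) (ψ-+ i (ℤ.- (+ (r ℕ.+ 1)) ℤ.* i)))) ⟩
        y * (y ^ r * (ψ i * z))
          ≈⟨ Solver.solve 4 (λ y Y a b → y :* (Y :* (a :* b)) := a :* ((y :* Y) :* b)) refl y (y ^ r) (ψ i) z ⟩
        ψ i * (y ^ suc r * z)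
          ≡⟨ ≡.cong (λ e → ψ i * (y ^ e * z)) (ℕ.+-comm 1 r) ⟩
        ψ i * (y ^ (r ℕ.+ 1) * z) ∎
        where
        open Solver using (_:=_; _:*_)
        z = ψ (ℤ.- (+ (r ℕ.+ 1)) ℤ.* i)

      eigenvector : ∀ i → y * S i ≈ ψ i * S i
      eigenvector i = begin
        y * S i ≈⟨ *-distribˡ-sum {p} y (λ r → f i (toℕ r)) ⟩
        sum {p} (λ r → y * f i (toℕ r)) ≈⟨ sum-cong-≋ {p} {λ r → y * f i (toℕ r)} {λ r → ψ i * f i (toℕ r ℕ.+ 1)} (λ r → step i (toℕ r)) ⟩
        sum {p} (λ r → ψ i * f i (toℕ r ℕ.+ 1)) ≈⟨ *-distribˡ-sum {p} (ψ i) (λ r → f i (toℕ r ℕ.+ 1)) ⟨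
        ψ i * sum {p} (λ r → f i (toℕ r ℕ.+ 1)) ≈⟨ *-congˡ (sum-shift p (f i) (periodic i) 1) ⟩
        ψ i * S i ∎

    -- A nonvanishing resolvent has both eigenvalues `y` and `ψ i`, so they coincide. This takes the
    -- place of factoring Xᵖ - 1 and serves to identify the image of ζ under an endomorphism.
    root-of-unity : ∃ λ (i : Fin p) → y ≈ ψ (+ toℕ i)
    root-of-unity = proj₁ nonzero-resolvent , *-cancelˡ (proj₂ nonzero-resolvent)
      (trans (*-comm _ y) (trans (eigenvector (+ toℕ (proj₁ nonzero-resolvent))) (*-comm _ _)))

  -- Multiplication by the sum maps the ℤ-span of 1, ζ, ..., ζ^(p-1) into itself, so the vector of
  -- these powers is an eigenvector; its entry at index 0 is 1.
  sums-of-roots-integral : ∀ {n} (c : Vector ℤ n) (a : Vector ℤ n) →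
    IsAlgebraicInteger L (sum (λ i → fromℤ (c i) * ψ (a i)))
  sums-of-roots-integral {n} c a = p , Integrality.eigenvalue-integral commutativeRing y p powers zero refl
    (λ k → _∈⟨_⟩.coefficients (stable k)) (λ k → _∈⟨_⟩.proof (stable k))
    where
    y = sum (λ i → fromℤ (c i) * ψ (a i))
    powers : Vector Carrier p
    powers k = ζ ^ toℕ k
    ψ∈ : ∀ a → ψ a ∈⟨ powers ⟩
    ψ∈ a = ∈-resp (reflexive (≡.trans (≡.cong (ζ ^_) (Fin.toℕ-fromℕ< (ℤ.n%ℕd<d a p))) (≡.sym (ψ≡ a)))) (∈-generator (fromℕ< (ℤ.n%ℕd<d a p)))
    stable : ∀ k → y * powers k ∈⟨ powers ⟩
    stable k = ∈-resp (sym (*-distribʳ-sum {n} (powers k) (λ i → fromℤ (c i) * ψ (a i))))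
      (∈-sum _ (λ i → ∈-resp (begin
        fromℤ (c i) * ψ (a i ℤ.+ + toℕ k) ≈⟨ *-congˡ (ψ-+ (a i) (+ toℕ k)) ⟩
        fromℤ (c i) * (ψ (a i) * ψ (+ toℕ k)) ≈⟨ *-assoc _ _ _ ⟨
        fromℤ (c i) * ψ (a i) * ψ (+ toℕ k) ≈⟨ *-congˡ (ζ^≈ψ (toℕ k)) ⟨
        fromℤ (c i) * ψ (a i) * powers k ∎) (∈-scale (c i) (ψ∈ (a i ℤ.+ + toℕ k)))))

module _ {A : Set} (f : A → A) where
  iterate-suc : ∀ x n → iterate f x (suc n) ≡ f (iterate f x n)
  iterate-suc x zero    = ≡.refl
  iterate-suc x (suc n) = iterate-suc (f x) n

  iterate-+ : ∀ x m n → iterate f x (m ℕ.+ n) ≡ iterate f (iterate f x m) n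
  iterate-+ x zero    n = ≡.refl
  iterate-+ x (suc m) n = iterate-+ (f x) m n

module RationalCombinations (F : FieldOverℚ) =
  LinearCombinations ℚ.+-*-commutativeRing (FieldOverℚ.commutativeRing F) (FieldOverℚ.ι F) (FieldOverℚ.ι-isRingHomomorphism F)

module IteratedEndomorphism (F : FieldOverℚ) (f : ∣ F ∣ᶠ → ∣ F ∣ᶠ) (f-hom : IsFieldEmbedding F F f) where
  open FieldOverℚ F using (trans; refl; rawRing)

  iterate-isRingHomomorphism : ∀ n → IsFieldEmbedding F F (λ x → iterate f x n)
  iterate-isRingHomomorphism zero    = Identity.isRingHomomorphism rawRing refl
  iterate-isRingHomomorphism (suc n) = Composition.isRingHomomorphism trans f-hom (iterate-isRingHomomorphism n)

  module Iterate (n : ℕ) = FieldHomomorphism F F (λ x → iterate f x n) (iterate-isRingHomomorphism n)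

-- Conjugates of ζ as a rational basis of 𝕃

module CyclotomicField (N : ℕ) (p-prime : Prime (suc N)) (L : FieldOverℚ) (ζ : ∣ L ∣ᶠ)
  (ζ-primitive : IsPrimitiveRootOfUnity L (suc N) ζ) (L=ℚ⟨ζ⟩ : ∀ x → Adjoin L ζ x)
  (u : ℤ) (u-generates : GeneratesUnits (suc N) u)
  (σ : ∣ L ∣ᶠ → ∣ L ∣ᶠ) (σ-hom : IsFieldEmbedding L L σ)
  (σζ≈ζᵘ : FieldOverℚ._≈_ L (σ ζ) (FieldOverℚ._^_ L ζ (u %ℕ suc N))) where
  private
    p = suc N
    module Z = PrimeField N p-prime
    module ZR = CommutativeRing Z.ring
    module ZL = LinearAlgebra Z.ring
    module ZT = RingTheory Z.ring
  open FieldOverℚ L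
  open LinearAlgebra commutativeRing using (_×ℕ_)
  open RingTheory commutativeRing
  open FieldTheory L
  open RationalCombinations L
  open RootsOfUnity N p-prime L ζ ζ-primitive
  open Generator N p-prime u u-generates
  open IteratedEndomorphism L σ σ-hom public
  open SetoidReasoning (CommutativeRing.setoid commutativeRing)
  private module σ = FieldHomomorphism L L σ σ-hom

  abstract
    u^_ : ℕ → ℤ
    u^ e = u ZL.^ e

    u^≡ : ∀ e → u^ e ≡ u ZL.^ e
    u^≡ e = ≡.refl

    u^-+ : ∀ d e → u^ (d ℕ.+ e) Z.≋ₙ u^ d ℤ.* u^ e
    u^-+ = ZT.^-homo-* u

    u^-periodic : ∀ e → u^ (e ℕ.+ N) Z.≋ₙ u^ e
    u^-periodic = ^-periodic

    u^-log : ∀ {a} → ¬ (a Z.≋ₙ + 0) → ∃ λ (e : Fin N) → u^ toℕ e Z.≋ₙ a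
    u^-log = log<

    u^≉0 : ∀ e → ¬ (u^ e Z.≋ₙ + 0)
    u^≉0 = ^-nonzero′
      where
      ^-nonzero′ : ∀ e → ¬ (u ZL.^ e Z.≋ₙ + 0)
      ^-nonzero′ = Z.^-nonzero u≉0

    u^-0 : u^ 0 ≡ + 1
    u^-0 = ≡.refl

    u^-suc : ∀ e → u^ suc e ≡ u ℤ.* u^ e
    u^-suc e = ≡.refl

    u^-injective : ∀ {i j} → i ℕ.< N → j ℕ.< N → u^ i Z.≋ₙ u^ j → i ≡ j
    u^-injective = ^-injective

  σ-ψ : ∀ a → σ (ψ a) ≈ ψ (u ℤ.* a)
  σ-ψ a = begin
    σ (ψ a) ≡⟨ ≡.cong σ (ψ≡ a) ⟩
    σ (ζ ^ (a %ℕ p)) ≈⟨ σ.^-homo ζ (a %ℕ p) ⟩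
    σ ζ ^ (a %ℕ p) ≈⟨ ^-congˡ (a %ℕ p) (trans σζ≈ζᵘ (reflexive (≡.sym (ψ≡ u)))) ⟩
    ψ u ^ (a %ℕ p) ≈⟨ ψ-^ u (a %ℕ p) ⟩
    ψ (+ (a %ℕ p) ℤ.* u) ≈⟨ ψ-cong (ZR.trans (ZR.*-comm (+ (a %ℕ p)) u) (ZR.*-congˡ {u} (ZR.sym (Z.≈-% a)))) ⟩
    ψ (u ℤ.* a) ∎

  σ^-ψ : ∀ e a → iterate σ (ψ a) e ≈ ψ (u^ e ℤ.* a)
  σ^-ψ zero    a = reflexive (≡.cong ψ (≡.trans (≡.sym (ℤ.*-identityˡ a)) (≡.cong (ℤ._* a) (≡.sym u^-0))))
  σ^-ψ (suc e) a = begin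
    iterate σ (σ (ψ a)) e ≈⟨ Iterate.⟦⟧-cong e (σ-ψ a) ⟩
    iterate σ (ψ (u ℤ.* a)) e ≈⟨ σ^-ψ e (u ℤ.* a) ⟩
    ψ (u^ e ℤ.* (u ℤ.* a)) ≡⟨ ≡.cong ψ (≡.trans (rearrange (u^ e) u a) (≡.cong (ℤ._* a) (≡.sym (u^-suc e)))) ⟩
    ψ (u^ suc e ℤ.* a) ∎
    where
    rearrange : ∀ x y z → x ℤ.* (y ℤ.* z) ≡ (y ℤ.* x) ℤ.* z
    rearrange = ℤ-Ring.Solver.solve 3 (λ x y z → x :* (y :* z) := (y :* x) :* z) ≡.refl
      where open ℤ-Ring.Solver using (_:=_; _:*_)

  -- Indexing by the discrete logarithm of the exponent of ζ makes σ act by e ↦ e + 1, with period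
  -- N.
  conjugate : ℕ → Carrier
  conjugate e = ψ (u^ e)

  conjugate-periodic : ∀ e → conjugate (e ℕ.+ N) ≈ conjugate e
  conjugate-periodic e = ψ-cong (u^-periodic e)

  conjugate-injective : ∀ {i j} → i ℕ.< N → j ℕ.< N → conjugate i ≈ conjugate j → i ≡ j
  conjugate-injective i<N j<N ζᵢ≈ζⱼ = u^-injective i<N j<N (ψ-injective ζᵢ≈ζⱼ)

  conjugate-0 : conjugate 0 ≈ ζ
  conjugate-0 = trans (reflexive (≡.cong ψ u^-0)) (trans (sym (ζ^≈ψ 1)) (*-identityʳ ζ))

  σ^-conjugate : ∀ e d → iterate σ (conjugate d) e ≈ conjugate (e ℕ.+ d)
  σ^-conjugate e d = trans (σ^-ψ e (u^ d)) (ψ-cong (ZR.sym (u^-+ e d)))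

  -- This is the trace from 𝕃 to ℚ: the powers of σ turn out to be all endomorphisms of 𝕃.
  trace : Carrier → Carrier
  trace x = sum {N} (λ f → iterate σ x (toℕ f))

  trace-cong : ∀ {x y} → x ≈ y → trace x ≈ trace y
  trace-cong x≈y = sum-cong-≋ {N} (λ f → Iterate.⟦⟧-cong (toℕ f) x≈y)

  trace-sum : ∀ {n} (v : Vector Carrier n) → trace (sum v) ≈ sum (λ i → trace (v i))
  trace-sum {n} v = trans (sum-cong-≋ {N} (λ f → Iterate.sum-homo (toℕ f) v)) (∑-comm {N} {n} (λ f i → iterate σ (v i) (toℕ f)))

  trace-ι* : ∀ q x → trace (ι q * x) ≈ ι q * trace x
  trace-ι* q x = trans
    (sum-cong-≋ {N} (λ f → trans (Iterate.*-homo (toℕ f) (ι q) x) (*-congʳ (Iterate.ι-homo (toℕ f) q))))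
    (sym (*-distribˡ-sum {N} (ι q) (λ f → iterate σ x (toℕ f))))

  trace-ψ : ∀ a → trace (ψ a) ≈ sum {N} (λ f → ψ (u^ toℕ f ℤ.* a))
  trace-ψ a = sum-cong-≋ {N} (λ f → σ^-ψ (toℕ f) a)

  trace-ψ-zero : ∀ {a} → a Z.≋ₙ + 0 → trace (ψ a) ≈ N ×ℕ 1#
  trace-ψ-zero {a} a≈0 = begin
    trace (ψ a) ≈⟨ trace-ψ a ⟩
    sum {N} (λ f → ψ (u^ toℕ f ℤ.* a)) ≈⟨ sum-cong-≋ {N} {λ f → ψ (u^ toℕ f ℤ.* a)} {λ _ → 1#} (λ f →
                                                trans (ψ-cong {u^ toℕ f ℤ.* a} {+ 0} (ZR.trans (ZR.*-congˡ {u^ toℕ f} a≈0) (ZR.zeroʳ (u^ toℕ f)))) ψ-0) ⟩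
    sum {N} (λ _ → 1#) ≈⟨ sum-replicate N ⟩
    N ×ℕ 1# ∎

  N×1≉0 : ¬ (N ×ℕ 1# ≈ 0#)
  N×1≉0 = fromℤ-nonzero {+ N} (λ N≡0 → ℕ.<⇒≢ (ℕ.≤-pred Z.1<p) (≡.sym (ℤ.+-injective N≡0)))

  private
    S : Carrier
    S = sum {N} (λ f → conjugate (toℕ f))

    trace-ψ≈S : ∀ {a} → ¬ (a Z.≋ₙ + 0) → trace (ψ a) ≈ S
    trace-ψ≈S {a} a≉0 = begin
      trace (ψ a) ≈⟨ trace-ψ a ⟩
      sum {N} (λ f → ψ (u^ toℕ f ℤ.* a)) ≈⟨ sum-cong-≋ {N} {λ f → ψ (u^ toℕ f ℤ.* a)} {λ f → conjugate (toℕ f ℕ.+ toℕ k)} (λ f → ψ-cong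
                                                              (ZR.trans (ZR.*-congˡ {u^ toℕ f} (ZR.sym (proj₂ (u^-log a≉0)))) (ZR.sym (u^-+ (toℕ f) (toℕ k))))) ⟩
      sum {N} (λ f → conjugate (toℕ f ℕ.+ toℕ k)) ≈⟨ sum-shift N conjugate conjugate-periodic (toℕ k) ⟩
      S ∎
      where k = proj₁ (u^-log a≉0)

    -- The value of `S` comes from summing Tr ψ(b) over all residues b in two ways. Exchanging the
    -- sums gives 0; the term b = 0 contributes N and each of the N others contributes `S`, so N (1
    -- + S) = 0.
    total : sum {p} (λ b → trace (ψ (+ toℕ b))) ≈ 0#
    total = begin
      sum {p} (λ b → trace (ψ (+ toℕ b))) ≈⟨ sum-cong-≋ {p} (λ b → trace-ψ (+ toℕ b)) ⟩
      sum {p} (λ b → sum {N} (λ f → ψ (u^ toℕ f ℤ.* + toℕ b))) ≈⟨ ∑-comm {p} {N} (λ b f → ψ (u^ toℕ f ℤ.* + toℕ b)) ⟩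
      sum {N} (λ f → sum {p} (λ b → ψ (u^ toℕ f ℤ.* + toℕ b))) ≈⟨ sum-zero {N} (λ f → sum-ψ (u^ toℕ f) (u^≉0 (toℕ f))) ⟩
      0# ∎

    total′ : sum {p} (λ b → trace (ψ (+ toℕ b))) ≈ (N ×ℕ 1#) * (1# + S)
    total′ = begin
      trace (ψ (+ 0)) + sum {N} (λ b → trace (ψ (+ suc (toℕ b)))) ≈⟨ +-cong (trace-ψ-zero {+ 0} ZR.refl) (sum-cong-≋ {N} (λ b → trace-ψ≈S (Z.+-nonzero (s≤s z≤n) (s≤s (Fin.toℕ<n b))))) ⟩
      N ×ℕ 1# + sum {N} (λ _ → S) ≈⟨ +-congˡ (sum-const {N} S) ⟩
      N ×ℕ 1# + (N ×ℕ 1#) * S ≈⟨ Solver.solve 2 (λ n S → n :+ n :* S := n :* (con (+ 1) :+ S)) refl (N ×ℕ 1#) S ⟩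
      (N ×ℕ 1#) * (1# + S) ∎
      where open Solver using (_:=_; _:+_; _:*_; con)

  sum-conjugates : S ≈ - 1#
  sum-conjugates = x-y≈0⇒x≈y (trans (+-congˡ (-‿involutive 1#)) (trans (+-comm S 1#) (x*y≈0⇒y≈0 N×1≉0 (trans (sym total′) total))))

  trace-ψ-nonzero : ∀ {a} → ¬ (a Z.≋ₙ + 0) → trace (ψ a) ≈ - 1#
  trace-ψ-nonzero a≉0 = trans (trace-ψ≈S a≉0) sum-conjugates

  conjugates : Vector Carrier N
  conjugates e = conjugate (toℕ e)

  trace-conjugate : ∀ e → trace (conjugate e) ≈ - 1#
  trace-conjugate e = trace-ψ-nonzero (u^≉0 e)

  private
    rational∈ : ∀ q → ι q ∈⟨ conjugates ⟩
    rational∈ q = combination (λ _ → ℚ.- q) (sym (begin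
      sum {N} (λ f → ι (ℚ.- q) * conjugate (toℕ f)) ≈⟨ *-distribˡ-sum {N} (ι (ℚ.- q)) conjugates ⟨
      ι (ℚ.- q) * S ≈⟨ *-cong (ι.-‿homo q) sum-conjugates ⟩
      - ι q * - 1# ≈⟨ Solver.solve 1 (λ q → :- q :* :- con (+ 1) := q) refl (ι q) ⟩
      ι q ∎))
      where open Solver using (_:=_; :-_; _:*_; con)

    1∈ : 1# ∈⟨ conjugates ⟩
    1∈ = ∈-resp ι.1#-homo (rational∈ 1ℚ)

    ψ∈ : ∀ a → ψ a ∈⟨ conjugates ⟩
    ψ∈ a = helper (a Z.≈?0)
      where
      helper : Dec (a Z.≋ₙ + 0) → ψ a ∈⟨ conjugates ⟩
      helper (yes a≈0) = ∈-resp (sym (trans (ψ-cong a≈0) ψ-0)) 1∈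
      helper (no a≉0)  = ∈-resp (ψ-cong (proj₂ (u^-log a≉0))) (∈-generator (proj₁ (u^-log a≉0)))

    ∈-* : ∀ {x y} → x ∈⟨ conjugates ⟩ → y ∈⟨ conjugates ⟩ → x * y ∈⟨ conjugates ⟩
    ∈-* {x} {y} (combination c x≈) (combination d y≈) = ∈-resp (sym (*-congʳ x≈))
      (∈-resp (sym (*-distribʳ-sum {N} y _)) (∈-sum _ λ e → ∈-resp (begin
        ι (c e) * (conjugate (toℕ e) * y) ≈⟨ *-assoc _ _ _ ⟨
        ι (c e) * conjugate (toℕ e) * y ∎)
        (∈-scale (c e) (∈-resp (sym (*-congˡ y≈)) (∈-resp (sym (*-distribˡ-sum {N} (conjugate (toℕ e)) _)) (∈-sum _ λ f →
          ∈-resp (begin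
            ι (d f) * ψ (u^ toℕ e ℤ.+ u^ toℕ f) ≈⟨ *-congˡ (ψ-+ (u^ toℕ e) (u^ toℕ f)) ⟩
            ι (d f) * (conjugate (toℕ e) * conjugate (toℕ f)) ≈⟨ Solver.solve 3 (λ d x y → d :* (x :* y) := x :* (d :* y)) refl (ι (d f)) (conjugate (toℕ e)) (conjugate (toℕ f)) ⟩
            conjugate (toℕ e) * (ι (d f) * conjugate (toℕ f)) ∎)
            (∈-scale (d f) (ψ∈ (u^ toℕ e ℤ.+ u^ toℕ f)))))))))
      where open Solver using (_:=_; _:*_)

    σ^∈ : ∀ e {x} → x ∈⟨ conjugates ⟩ → iterate σ x e ∈⟨ conjugates ⟩
    σ^∈ e {x} (combination c x≈) = ∈-resp (sym (Iterate.⟦⟧-cong e x≈)) (∈-resp (sym (Iterate.sum-homo e {N} (λ i → ι (c i) * conjugate (toℕ i)))) (∈-sum _ λ i →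
      ∈-resp (sym (trans (Iterate.*-homo e (ι (c i)) (conjugate (toℕ i))) (*-cong (Iterate.ι-homo e (c i)) (σ^-ψ e (u^ toℕ i)))))
        (∈-scale (c i) (ψ∈ (u^ e ℤ.* u^ toℕ i)))))

    abstract
      1/N : ℚ
      1/N = proj₁ (reciprocal (ℕ.≤-pred Z.1<p))

      ι-1/N : ι 1/N * (N ×ℕ 1#) ≈ 1#
      ι-1/N = proj₂ (reciprocal (ℕ.≤-pred Z.1<p))

    trace-∈ : ∀ {x} → x ∈⟨ conjugates ⟩ → ∃ λ q → trace x ≈ ι q
    trace-∈ {x} (combination c x≈) = ℚ.- ℚ-LinearAlgebra.sum c , (begin
      trace x ≈⟨ trace-cong x≈ ⟩
      trace (sum {N} (λ e → ι (c e) * conjugate (toℕ e))) ≈⟨ trace-sum {N} _ ⟩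
      sum {N} (λ e → trace (ι (c e) * conjugate (toℕ e))) ≈⟨ sum-cong-≋ {N} (λ e → trans (trace-ι* (c e) (conjugate (toℕ e))) (*-congˡ (trace-conjugate (toℕ e)))) ⟩
      sum {N} (λ e → ι (c e) * - 1#) ≈⟨ *-distribʳ-sum {N} (- 1#) (λ e → ι (c e)) ⟨
      sum {N} (λ e → ι (c e)) * - 1# ≈⟨ *-congʳ (ι.sum-homo c) ⟨
      ι (ℚ-LinearAlgebra.sum c) * - 1# ≈⟨ Solver.solve 1 (λ x → x :* :- con (+ 1) := :- x) refl (ι (ℚ-LinearAlgebra.sum c)) ⟩
      - ι (ℚ-LinearAlgebra.sum c) ≈⟨ ι.-‿homo _ ⟨
      ι (ℚ.- ℚ-LinearAlgebra.sum c) ∎)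
      where open Solver using (_:=_; _:*_; :-_; con)

  fixed⇒σ^ : ∀ {x} → σ x ≈ x → ∀ e → iterate σ x e ≈ x
  fixed⇒σ^ σx≈x zero    = refl
  fixed⇒σ^ σx≈x (suc e) = trans (Iterate.⟦⟧-cong e σx≈x) (fixed⇒σ^ σx≈x e)

  private
    -- A fixed element is the average of its N conjugates, and traces of elements of the span are
    -- rational. Membership in the span is assumed because this result is itself used to show that
    -- the span is closed under inverses, hence all of 𝕃.
    fixed∈⇒rational : ∀ {x} → x ∈⟨ conjugates ⟩ → σ x ≈ x → ∃ λ q → x ≈ ι q
    fixed∈⇒rational {x} x∈ σx≈x = 1/N ℚ.* q , (begin
      x ≈⟨ trans (*-congʳ ι-1/N) (*-identityˡ x) ⟨
      ι 1/N * (N ×ℕ 1#) * x ≈⟨ *-assoc _ _ _ ⟩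
      ι 1/N * ((N ×ℕ 1#) * x) ≈⟨ *-congˡ (sum-const {N} x) ⟨
      ι 1/N * sum {N} (λ _ → x) ≈⟨ *-congˡ (sum-cong-≋ {N} (λ f → fixed⇒σ^ σx≈x (toℕ f))) ⟨
      ι 1/N * trace x ≈⟨ *-congˡ (proj₂ (trace-∈ x∈)) ⟩
      ι 1/N * ι q ≈⟨ ι.*-homo 1/N q ⟨
      ι (1/N ℚ.* q) ∎)
      where
      q : ℚ
      q = proj₁ (trace-∈ x∈)

  -- The inverse of x is the product of the other conjugates divided by the norm.
  private
    module Norm (x : Carrier) (x≉0 : ¬ (x ≈ 0#)) where
      conjugates-product : ℕ → Carrier
      conjugates-product zero    = 1#
      conjugates-product (suc k) = conjugates-product k * iterate σ (σ x) k

      norm : ℕ → Carrier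
      norm k = x * conjugates-product k

      -- A telescoping identity, multiplied by `x` to avoid division. For k = N - 1 the last factor
      -- is σᴺ x = x, so the full norm is fixed by σ.
      σ-norm : ∀ k → σ (norm k) * x ≈ norm k * iterate σ (σ x) k
      σ-norm zero    = begin
        σ (x * 1#) * x ≈⟨ *-congʳ (trans (σ.⟦⟧-cong (*-identityʳ x)) (sym (*-identityʳ (σ x)))) ⟩
        (σ x * 1#) * x ≈⟨ Solver.solve 2 (λ x y → (y :* con (+ 1)) :* x := (x :* con (+ 1)) :* y) refl x (σ x) ⟩
        (x * 1#) * σ x ∎
        where open Solver using (_:=_; _:*_; con)
      σ-norm (suc k) = begin
        σ (x * (P * y)) * x ≈⟨ *-congʳ (trans (σ.⟦⟧-cong (sym (*-assoc x P y))) (σ.*-homo (x * P) y)) ⟩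
        (σ (x * P) * σ y) * x ≈⟨ Solver.solve 3 (λ a b x → (a :* b) :* x := (a :* x) :* b) refl (σ (x * P)) (σ y) x ⟩
        (σ (x * P) * x) * σ y ≈⟨ *-cong (σ-norm k) (reflexive (≡.sym (iterate-suc σ (σ x) k))) ⟩
        ((x * P) * y) * y′ ≈⟨ *-congʳ (*-assoc x P y) ⟩
        (x * (P * y)) * y′ ∎
        where
        open Solver using (_:=_; _:*_)
        P = conjugates-product k
        y = iterate σ (σ x) k
        y′ = iterate σ (σ x) (suc k)

      product≉0 : ∀ k → ¬ (conjugates-product k ≈ 0#)
      product≉0 zero    = 1≉0
      product≉0 (suc k) P≈0 = x≉0 (σ.injective (Iterate.injective k
        (trans (x*y≈0⇒y≈0 (product≉0 k) P≈0) (sym (trans (Iterate.⟦⟧-cong k σ.0#-homo) (Iterate.0#-homo k))))))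

      product∈ : x ∈⟨ conjugates ⟩ → ∀ k → conjugates-product k ∈⟨ conjugates ⟩
      product∈ x∈ zero    = 1∈
      product∈ x∈ (suc k) = ∈-* (product∈ x∈ k) (σ^∈ (suc k) x∈)

    σ^N-identity∈ : ∀ {x} → x ∈⟨ conjugates ⟩ → iterate σ x N ≈ x
    σ^N-identity∈ {x} (combination c x≈) = begin
      iterate σ x N ≈⟨ Iterate.⟦⟧-cong N x≈ ⟩
      iterate σ (sum {N} (λ e → ι (c e) * conjugate (toℕ e))) N ≈⟨ Iterate.sum-homo N {N} _ ⟩
      sum {N} (λ e → iterate σ (ι (c e) * conjugate (toℕ e)) N) ≈⟨ sum-cong-≋ {N} (λ e → trans (Iterate.*-homo N (ι (c e)) (conjugate (toℕ e))) (*-cong (Iterate.ι-homo N (c e))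
                                                                         (trans (σ^-conjugate N (toℕ e)) (trans (reflexive (≡.cong conjugate (ℕ.+-comm N (toℕ e)))) (conjugate-periodic (toℕ e)))))) ⟩
      sum {N} (λ e → ι (c e) * conjugate (toℕ e)) ≈⟨ x≈ ⟨
      x ∎

    inverse∈ : ∀ {x y} → x * y ≈ 1# → x ∈⟨ conjugates ⟩ → y ∈⟨ conjugates ⟩
    inverse∈ {x} {y} xy≈1 x∈ = ∈-resp (begin
      ι (1/ q) * P ≈⟨ *-congˡ (trans (*-congʳ xy≈1) (*-identityˡ P)) ⟨
      ι (1/ q) * (x * y * P) ≈⟨ Solver.solve 4 (λ r x y P → r :* (x :* y :* P) := r :* (x :* P) :* y) refl (ι (1/ q)) x y P ⟩
      ι (1/ q) * (x * P) * y ≈⟨ *-congʳ (*-congˡ xP≈q) ⟩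
      ι (1/ q) * ι q * y ≈⟨ *-congʳ (trans (sym (ι.*-homo (1/ q) q)) (trans (reflexive (≡.cong ι (ℚ.*-inverseˡ q {{q-nonZero}}))) ι.1#-homo)) ⟩
      1# * y ≈⟨ *-identityˡ y ⟩
      y ∎)
      (∈-scale (1/ q) (product∈ x∈ N′))
      where
      open Solver using (_:=_; _:*_)
      x≉0 : ¬ (x ≈ 0#)
      x≉0 x≈0 = 1≉0 (trans (sym xy≈1) (trans (*-congʳ x≈0) (zeroˡ y)))
      open Norm x x≉0
      N′ = ℕ.pred N
      P = conjugates-product N′
      fixed : σ (x * P) ≈ x * P
      fixed = *-cancelˡ x≉0 (trans (*-comm x _) (trans (σ-norm N′) (trans (*-congˡ (trans
        (reflexive (≡.cong (iterate σ x) (ℕ.suc-pred N))) (σ^N-identity∈ x∈))) (*-comm _ x))))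
      rational-norm = fixed∈⇒rational (∈-* x∈ (product∈ x∈ N′)) fixed
      q = proj₁ rational-norm
      xP≈q = proj₂ rational-norm
      q-nonZero : ℚ.NonZero q
      q-nonZero = ℚ.≢-nonZero λ q≡0 → product≉0 N′ (x*y≈0⇒y≈0 x≉0 (trans xP≈q (trans (reflexive (≡.cong ι q≡0)) ι.0#-homo)))
      1/_ : ℚ → ℚ
      1/ q′ = ℚ.1/_ q {{q-nonZero}}

    adjoin∈ : ∀ {x} → Adjoin L ζ x → x ∈⟨ conjugates ⟩
    adjoin∈ (rational q)   = rational∈ q
    adjoin∈ gen            = ∈-resp conjugate-0 (ψ∈ (u^ 0))
    adjoin∈ (add a b)      = ∈-+ (adjoin∈ a) (adjoin∈ b)
    adjoin∈ (mul a b)      = ∈-* (adjoin∈ a) (adjoin∈ b)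
    adjoin∈ (neg a)        = ∈-neg (adjoin∈ a)
    adjoin∈ (inv xy≈1 a)   = inverse∈ xy≈1 (adjoin∈ a)
    adjoin∈ (resp x≈y a)   = ∈-resp x≈y (adjoin∈ a)

  conjugates-span : ∀ x → x ∈⟨ conjugates ⟩
  conjugates-span x = adjoin∈ (L=ℚ⟨ζ⟩ x)

  σ^N-identity : ∀ x → iterate σ x N ≈ x
  σ^N-identity x = σ^N-identity∈ (conjugates-span x)

  -- Multiplying by ζ_g⁻¹ and taking traces isolates the coefficient of ζ_g.
  conjugates-independent : ∀ (c : Vector ℚ N) → sum (λ e → ι (c e) * conjugates e) ≈ 0# → ∀ g → c g ≡ 0ℚ
  conjugates-independent c x≈0 g = ι-injective (trans (x*y≈0⇒y≈0 p×1≉0 (begin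
    (p ×ℕ 1#) * ι (c g) ≈⟨ *-congˡ (sum-δʳ {N} (λ e → ι (c e)) g) ⟨
    (p ×ℕ 1#) * sum (λ e → ι (c e) * δ e g) ≈⟨ *-distribˡ-sum {N} (p ×ℕ 1#) (λ e → ι (c e) * δ e g) ⟩
    -- Tr (ζₑ ζ_g⁻¹) equals p δ - 1, and the unwanted -1 is itself Tr ζₑ. The sum becomes a
    -- difference of two traces, each of which vanishes by the assumed relation.
    sum (λ e → (p ×ℕ 1#) * (ι (c e) * δ e g)) ≈⟨ sum-cong-≋ {N} (λ e → Solver.solve 3 (λ p c d → p :* (c :* d) := c :* (p :* d :- con (+ 1)) :- c :* (:- con (+ 1))) refl (p ×ℕ 1#) (ι (c e)) (δ e g)) ⟩
    sum (λ e → ι (c e) * ((p ×ℕ 1#) * δ e g - 1#) - ι (c e) * - 1#)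
      ≈⟨ sum-sub {N} (λ e → ι (c e) * ((p ×ℕ 1#) * δ e g - 1#)) (λ e → ι (c e) * - 1#) ⟩
    sum (λ e → ι (c e) * ((p ×ℕ 1#) * δ e g - 1#)) - sum (λ e → ι (c e) * - 1#)
      ≈⟨ +-cong (sum-cong-≋ {N} (λ e → *-congˡ (trace-term e))) (-‿cong (sum-cong-≋ {N} (λ e → *-congˡ (trace-conjugate (toℕ e))))) ⟨
    sum (λ e → ι (c e) * trace (conjugates e * w)) - sum (λ e → ι (c e) * trace (conjugates e))
      ≈⟨ +-cong vanish₁ (-‿cong vanish₂) ⟩
    0# - 0# ≈⟨ -‿inverseʳ 0# ⟩
    0# ∎)) (sym ι.0#-homo))
    where
    open Solver using (_:=_; _:*_; _:-_; :-_; con)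
    w : Carrier
    w = ψ (ℤ.- u^ toℕ g)
    vanish₂ : sum (λ e → ι (c e) * trace (conjugates e)) ≈ 0#
    vanish₂ = begin
      sum (λ e → ι (c e) * trace (conjugates e)) ≈⟨ sum-cong-≋ {N} (λ e → trace-ι* (c e) (conjugates e)) ⟨
      sum (λ e → trace (ι (c e) * conjugates e)) ≈⟨ trace-sum {N} (λ e → ι (c e) * conjugates e) ⟨
      trace (sum (λ e → ι (c e) * conjugates e)) ≈⟨ trace-cong x≈0 ⟩
      trace 0# ≈⟨ sum-zero {N} (λ f → Iterate.0#-homo (toℕ f)) ⟩
      0# ∎
    vanish₁ : sum (λ e → ι (c e) * trace (conjugates e * w)) ≈ 0#
    vanish₁ = begin
      sum (λ e → ι (c e) * trace (conjugates e * w)) ≈⟨ sum-cong-≋ {N} (λ e → trans (trace-cong (*-assoc _ _ _)) (trace-ι* (c e) (conjugates e * w))) ⟨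
      sum (λ e → trace (ι (c e) * conjugates e * w)) ≈⟨ trace-sum {N} (λ e → ι (c e) * conjugates e * w) ⟨
      trace (sum (λ e → ι (c e) * conjugates e * w)) ≈⟨ trace-cong (trans (sym (*-distribʳ-sum {N} w (λ e → ι (c e) * conjugates e))) (trans (*-congʳ x≈0) (zeroˡ w))) ⟩
      trace 0# ≈⟨ sum-zero {N} (λ f → Iterate.0#-homo (toℕ f)) ⟩
      0# ∎
    trace-term : ∀ e → trace (conjugates e * w) ≈ (p ×ℕ 1#) * δ e g - 1#
    trace-term e = trans (trace-cong (sym (ψ-+ (u^ toℕ e) (ℤ.- u^ toℕ g)))) (helper (e Fin.≟ g))
      where
      helper : Dec (e ≡ g) → trace (ψ (u^ toℕ e ℤ.- u^ toℕ g)) ≈ (p ×ℕ 1#) * δ e g - 1#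
      helper (yes ≡.refl) = begin
        trace (ψ (u^ toℕ e ℤ.- u^ toℕ e)) ≈⟨ trace-ψ-zero (ZR.-‿inverseʳ (u^ toℕ e)) ⟩
        N ×ℕ 1# ≈⟨ Solver.solve 1 (λ n → n := (con (+ 1) :+ n) :* con (+ 1) :- con (+ 1)) refl (N ×ℕ 1#) ⟩
        (p ×ℕ 1#) * 1# - 1# ≈⟨ +-congʳ (*-congˡ (δ-diag e)) ⟨
        (p ×ℕ 1#) * δ e e - 1# ∎
        where open Solver using (_:+_)
      helper (no e≢g) = begin
        trace (ψ (u^ toℕ e ℤ.- u^ toℕ g)) ≈⟨ trace-ψ-nonzero (λ e-g≈0 → e≢g (Fin.toℕ-injective (u^-injective (Fin.toℕ<n e) (Fin.toℕ<n g) (ZT.x-y≈0⇒x≈y e-g≈0)))) ⟩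
        - 1# ≈⟨ Solver.solve 1 (λ p → :- con (+ 1) := p :* con (+ 0) :- con (+ 1)) refl (p ×ℕ 1#) ⟩
        (p ×ℕ 1#) * 0# - 1# ≈⟨ +-congʳ (*-congˡ (δ-off e≢g)) ⟨
        (p ×ℕ 1#) * δ e g - 1# ∎

  agree-at-ζ : ∀ f → IsFieldEmbedding L L f → ∀ e → f ζ ≈ conjugate e → ∀ x → f x ≈ iterate σ x e
  agree-at-ζ f f-hom e fζ≈ζᵉ x = begin
    f x ≈⟨ φ.⟦⟧-cong x≈ ⟩
    f (sum {N} (λ i → ι (c i) * conjugates i)) ≈⟨ φ.sum-homo {N} _ ⟩
    sum {N} (λ i → f (ι (c i) * conjugates i)) ≈⟨ sum-cong-≋ {N} (λ i → trans (φ.*-homo _ _) (*-cong (φ.ι-homo (c i)) (f-ψ (u^ toℕ i)))) ⟩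
    sum {N} (λ i → ι (c i) * iterate σ (conjugates i) e) ≈⟨ sum-cong-≋ {N} (λ i → trans (Iterate.*-homo e _ _) (*-congʳ (Iterate.ι-homo e (c i)))) ⟨
    sum {N} (λ i → iterate σ (ι (c i) * conjugates i) e) ≈⟨ Iterate.sum-homo e {N} _ ⟨
    iterate σ (sum {N} (λ i → ι (c i) * conjugates i)) e ≈⟨ Iterate.⟦⟧-cong e x≈ ⟨
    iterate σ x e ∎
    where
    module φ = FieldHomomorphism L L f f-hom
    c = coefficients (conjugates-span x)
    x≈ = proof (conjugates-span x)
    f-ψ : ∀ a → f (ψ a) ≈ iterate σ (ψ a) e
    f-ψ a = begin
      f (ψ a) ≡⟨ ≡.cong f (ψ≡ a) ⟩
      f (ζ ^ (a %ℕ p)) ≈⟨ φ.^-homo ζ (a %ℕ p) ⟩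
      f ζ ^ (a %ℕ p) ≈⟨ ^-congˡ (a %ℕ p) fζ≈ζᵉ ⟩
      ψ (u^ e) ^ (a %ℕ p) ≈⟨ ψ-^ (u^ e) (a %ℕ p) ⟩
      ψ (+ (a %ℕ p) ℤ.* u^ e) ≈⟨ ψ-cong (ZR.trans (ZR.*-comm (+ (a %ℕ p)) (u^ e)) (ZR.*-congˡ {u^ e} (ZR.sym (Z.≈-% a)))) ⟩
      ψ (u^ e ℤ.* a) ≈⟨ σ^-ψ e a ⟨
      iterate σ (ψ a) e ∎

  -- The image of ζ is a p-th root of unity, hence ψ(i) for some i, and i is not 0 modulo p by
  -- injectivity. So i is a power of u, and an endomorphism is determined by the image of ζ.
  endomorphism-is-σ^ : ∀ f → IsFieldEmbedding L L f → ∃ λ (e : Fin N) → ∀ x → f x ≈ iterate σ x (toℕ e)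
  endomorphism-is-σ^ f f-hom = proj₁ e , agree-at-ζ f f-hom (toℕ (proj₁ e)) (trans (proj₂ i) (sym (ψ-cong (proj₂ e))))
    where
    module φ = FieldHomomorphism L L f f-hom
    i = root-of-unity (f ζ) (trans (sym (φ.^-homo ζ p)) (trans (φ.⟦⟧-cong (proj₁ ζ-primitive)) φ.1#-homo))
    i≉0 : ¬ (+ toℕ (proj₁ i) Z.≋ₙ + 0)
    i≉0 i≈0 = proj₂ ζ-primitive 1 (s≤s z≤n) Z.1<p (trans (*-identityʳ ζ) (φ.injective (trans (proj₂ i) (trans (ψ-cong i≈0) (trans ψ-0 (sym φ.1#-homo))))))
    e = u^-log i≉0

-- If A and B are the matrices of base change then s = tr (A B) = tr (B A) = d.
module BasisSize (F : FieldOverℚ) where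
  open FieldOverℚ F
  open RingTheory commutativeRing
  open FieldTheory F
  open RationalCombinations F
  open SetoidReasoning (CommutativeRing.setoid commutativeRing)
  private
    module Q = LinearAlgebra ℚ.+-*-commutativeRing
    module QR = RingTheory ℚ.+-*-commutativeRing

  Independent : ∀ {n} → Vector Carrier n → Set
  Independent {n} v = ∀ (q : Vector ℚ n) → sum {n} (λ i → ι (q i) * v i) ≈ 0# → ∀ i → q i ≡ 0ℚ

  coefficients-unique : ∀ {n} (v : Vector Carrier n) → Independent v → ∀ (q r : Vector ℚ n) →
    sum {n} (λ i → ι (q i) * v i) ≈ sum {n} (λ i → ι (r i) * v i) → ∀ i → q i ≡ r i
  coefficients-unique {n} v independent q r qv≈rv i = QR.x-y≈0⇒x≈y (independent (λ i → q i ℚ.- r i) (begin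
    sum {n} (λ i → ι (q i ℚ.- r i) * v i) ≈⟨ sum-cong-≋ {n} (λ i → trans (*-congʳ (ι.sub-homo (q i) (r i))) (Solver.solve 3 (λ q r v → (q :- r) :* v := q :* v :- r :* v) refl (ι (q i)) (ι (r i)) (v i))) ⟩
    sum {n} (λ i → ι (q i) * v i - ι (r i) * v i) ≈⟨ sum-sub {n} (λ i → ι (q i) * v i) (λ i → ι (r i) * v i) ⟩
    sum {n} (λ i → ι (q i) * v i) - sum {n} (λ i → ι (r i) * v i) ≈⟨ x≈y⇒x-y≈0 qv≈rv ⟩
    0# ∎) i)
    where open Solver using (_:=_; _:*_; _:-_)

  private
    product-identity : ∀ {m n} (v : Vector Carrier m) (w : Vector Carrier n) → Independent v →
      (A : Fin m → Fin n → ℚ) (B : Fin n → Fin m → ℚ) →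
      (∀ i → v i ≈ sum {n} (λ k → ι (A i k) * w k)) → (∀ k → w k ≈ sum {m} (λ i → ι (B k i) * v i)) →
      ∀ i l → Q.sum {n} (λ k → A i k ℚ.* B k l) ≡ QR.δ i l
    product-identity {m} {n} v w independent A B v≈Aw w≈Bv i = coefficients-unique v independent
      (λ l → Q.sum {n} (λ k → A i k ℚ.* B k l)) (QR.δ i) (begin
      sum {m} (λ l → ι (Q.sum {n} (λ k → A i k ℚ.* B k l)) * v l) ≈⟨ sum-cong-≋ {m} (λ l → *-congʳ (trans (ι.sum-homo {n} (λ k → A i k ℚ.* B k l)) (sum-cong-≋ {n} (λ k → ι.*-homo (A i k) (B k l))))) ⟩
      sum {m} (λ l → sum {n} (λ k → ι (A i k) * ι (B k l)) * v l) ≈⟨ sum-cong-≋ {m} (λ l → *-distribʳ-sum {n} (v l) (λ k → ι (A i k) * ι (B k l))) ⟩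
      sum {m} (λ l → sum {n} (λ k → ι (A i k) * ι (B k l) * v l)) ≈⟨ ∑-comm {m} {n} (λ l k → ι (A i k) * ι (B k l) * v l) ⟩
      sum {n} (λ k → sum {m} (λ l → ι (A i k) * ι (B k l) * v l)) ≈⟨ sum-cong-≋ {n} (λ k → trans (sum-cong-≋ {m} (λ l → *-assoc _ _ _)) (sym (*-distribˡ-sum {m} (ι (A i k)) (λ l → ι (B k l) * v l)))) ⟩
      sum {n} (λ k → ι (A i k) * sum {m} (λ l → ι (B k l) * v l)) ≈⟨ sum-cong-≋ {n} (λ k → *-congˡ (w≈Bv k)) ⟨
      sum {n} (λ k → ι (A i k) * w k) ≈⟨ v≈Aw i ⟨
      v i ≈⟨ sum-δˡ {m} v i ⟨
      sum {m} (λ l → δ i l * v l) ≈⟨ sum-cong-≋ {m} (λ l → *-congʳ (ι-δ i l)) ⟨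
      sum {m} (λ l → ι (QR.δ i l) * v l) ∎)
      where
      ι-δ : ∀ {m} (i l : Fin m) → ι (QR.δ i l) ≈ δ i l
      ι-δ i l with i Fin.≟ l
      ... | yes _ = ι.1#-homo
      ... | no _  = ι.0#-homo

    trace-identity : ∀ {m} (M : Fin m → Fin m → ℚ) → (∀ i l → M i l ≡ QR.δ i l) → Q.sum {m} (λ i → M i i) ≡ Q.fromℤ (+ m)
    trace-identity {m} M M≡δ = ≡.trans (QR.sum-cong-≋ {m} (λ i → ≡.trans (M≡δ i i) (QR.δ-diag i))) (QR.sum-replicate m)

  basis-size-unique : ∀ {m n} (v : Vector Carrier m) (w : Vector Carrier n) → Independent v → Independent w →
                      (∀ i → v i ∈⟨ w ⟩) → (∀ k → w k ∈⟨ v ⟩) → m ≡ n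
  basis-size-unique {m} {n} v w v-independent w-independent v∈w w∈v = ℤ.+-injective (fromℤ-ℚ-injective {+ m} {+ n} (≡.trans
    (≡.sym (trace-identity (λ i l → Q.sum {n} (λ k → A i k ℚ.* B k l)) (product-identity v w v-independent A B v≈Aw w≈Bv)))
    (≡.trans (QR.∑-comm {m} {n} (λ i k → A i k ℚ.* B k i)) (≡.trans
      (QR.sum-cong-≋ {n} (λ k → QR.sum-cong-≋ {m} (λ i → ℚ.*-comm (A i k) (B k i))))
      (trace-identity (λ k l → Q.sum {m} (λ i → B k i ℚ.* A i l)) (product-identity w v w-independent B A w≈Bv v≈Aw))))))
    where
    A : Fin m → Fin n → ℚ
    A i = coefficients (v∈w i)
    B : Fin n → Fin m → ℚ
    B k = coefficients (w∈v k)
    v≈Aw : ∀ i → v i ≈ sum {n} (λ k → ι (A i k) * w k)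
    v≈Aw i = proof (v∈w i)
    w≈Bv : ∀ k → w k ≈ sum {m} (λ i → ι (B k i) * v i)
    w≈Bv k = proof (w∈v k)

-- The automorphism θ and its order

module Restriction (K L : FieldOverℚ) (j : ∣ K ∣ᶠ → ∣ L ∣ᶠ) (j-hom : IsFieldEmbedding K L j)
  (σ : ∣ L ∣ᶠ → ∣ L ∣ᶠ) (σ-hom : IsFieldEmbedding L L σ)
  (θ : ∣ K ∣ᶠ → ∣ K ∣ᶠ) (jθ≈σj : ∀ x → FieldOverℚ._≈_ L (j (θ x)) (σ (j x))) where
  private
    module K = FieldOverℚ K
    module L = FieldOverℚ L
    module j = FieldHomomorphism K L j j-hom
    module σ = FieldHomomorphism L L σ σ-hom
    module σ^ = IteratedEndomorphism L σ σ-hom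

  -- `θ` is given merely as a function with `j ∘ θ` equal to `σ ∘ j`; its laws are those of `σ`
  -- pulled back along the injective `j`.
  θ-hom : IsFieldEmbedding K K θ
  θ-hom = record
    { isSemiringHomomorphism = record
      { isNearSemiringHomomorphism = record
        { +-isMonoidHomomorphism = record
          { isMagmaHomomorphism = record
            { isRelHomomorphism = record { cong = λ {x} {y} x≈y → j.injective (L.trans (jθ≈σj x) (L.trans (σ.⟦⟧-cong (j.⟦⟧-cong x≈y)) (L.sym (jθ≈σj y)))) }
            ; homo = λ x y → j.injective (L.trans (jθ≈σj _) (L.trans (σ.⟦⟧-cong (j.+-homo x y)) (L.trans (σ.+-homo _ _)
                (L.sym (L.trans (j.+-homo _ _) (L.+-cong (jθ≈σj x) (jθ≈σj y)))))))
            }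
          ; ε-homo = j.injective (L.trans (jθ≈σj _) (L.trans (σ.⟦⟧-cong j.0#-homo) (L.trans σ.0#-homo (L.sym j.0#-homo))))
          }
        ; *-homo = λ x y → j.injective (L.trans (jθ≈σj _) (L.trans (σ.⟦⟧-cong (j.*-homo x y)) (L.trans (σ.*-homo _ _)
            (L.sym (L.trans (j.*-homo _ _) (L.*-cong (jθ≈σj x) (jθ≈σj y)))))))
        }
      ; 1#-homo = j.injective (L.trans (jθ≈σj _) (L.trans (σ.⟦⟧-cong j.1#-homo) (L.trans σ.1#-homo (L.sym j.1#-homo))))
      }
    ; -‿homo = λ x → j.injective (L.trans (jθ≈σj _) (L.trans (σ.⟦⟧-cong (j.-‿homo x)) (L.trans (σ.-‿homo _)
        (L.sym (L.trans (j.-‿homo _) (L.-‿cong (jθ≈σj x)))))))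
    }

  jθ^≈σ^j : ∀ n x → j (iterate θ x n) L.≈ iterate σ (j x) n
  jθ^≈σ^j zero    x = L.refl
  jθ^≈σ^j (suc n) x = L.trans (jθ^≈σ^j n (θ x)) (σ^.Iterate.⟦⟧-cong n (jθ≈σj x))

  Trivial : ℕ → Set
  Trivial n = ∀ x → iterate θ x n K.≈ x

  open IteratedEndomorphism K θ θ-hom public renaming (module Iterate to θ^)

  trivial-* : ∀ {d} → Trivial d → ∀ q → Trivial (q ℕ.* d)
  trivial-* θᵈ≈1 zero    x = K.refl
  trivial-* {d} θᵈ≈1 (suc q) x = K.trans (K.reflexive (iterate-+ θ x d (q ℕ.* d)))
    (K.trans (θ^.⟦⟧-cong (q ℕ.* d) (θᵈ≈1 x)) (trivial-* θᵈ≈1 q x))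

  θ^-% : ∀ {d} .{{_ : ℕ.NonZero d}} → Trivial d → ∀ n x → iterate θ x n K.≈ iterate θ x (n % d)
  θ^-% {d} θᵈ≈1 n x = K.trans (K.reflexive (≡.trans (≡.cong (iterate θ x) (m≡m%n+[m/n]*n n d)) (iterate-+ θ x (n % d) (n ℕ./ d ℕ.* d))))
    (trivial-* θᵈ≈1 (n ℕ./ d) (iterate θ x (n % d)))

  -- Whether a power of `θ` is the identity can be tested on a finite rational basis, so the order
  -- is found by searching the positive exponents up to `N`.
  period : ∀ {n} → HasDegree K n → ∀ N → 0 ℕ.< N → Trivial N →
           ∃ λ d → 0 ℕ.< d × Trivial d × (∀ e → Trivial e → d ∣ₙ e)
  period {n} (b , b-spans , _) N 0<N θᴺ≈1 = suc d , s≤s z≤n , θᵈ≈1 , period-divides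
    where
    open RationalCombinations K
    open SetoidReasoning (CommutativeRing.setoid K.commutativeRing)
    on-basis : ∀ e → (∀ i → iterate θ (b i) e K.≈ b i) → Trivial e
    on-basis e fixes x = begin
      iterate θ x e ≈⟨ θ^.⟦⟧-cong e x≈ ⟩
      iterate θ (K.sum {n} (λ i → K.ι (q i) K.* b i)) e ≈⟨ θ^.sum-homo e {n} (λ i → K.ι (q i) K.* b i) ⟩
      K.sum {n} (λ i → iterate θ (K.ι (q i) K.* b i) e) ≈⟨ RingTheory.sum-cong-≋ K.commutativeRing {n} (λ i → K.trans (θ^.*-homo e _ _) (K.*-cong (θ^.ι-homo e (q i)) (fixes i))) ⟩
      K.sum {n} (λ i → K.ι (q i) K.* b i) ≈⟨ x≈ ⟨
      x ∎
      where
      q = proj₁ (b-spans x)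
      x≈ = proj₂ (b-spans x)
    trivial? : ∀ e → Dec (Trivial e)
    trivial? e = map′ (on-basis e) (λ θᵉ≈1 i → θᵉ≈1 (b i)) (Fin.all? (λ i → iterate θ (b i) e ≟ b i))
      where open FieldTheory K using (_≟_)
    least-period : ∃ λ d → Trivial (suc d) × d ℕ.≤ ℕ.pred N × (∀ k → k ℕ.< d → ¬ Trivial (suc k))
    least-period = least (Trivial ∘ suc) (trivial? ∘ suc) (ℕ.pred N)
      (≡.subst Trivial (≡.sym (ℕ.suc-pred N {{ℕ.>-nonZero 0<N}})) θᴺ≈1)
    d = proj₁ least-period
    θᵈ≈1 = proj₁ (proj₂ least-period)
    period-divides : ∀ e → Trivial e → suc d ∣ₙ e
    period-divides e θᵉ≈1 = ℕ∣.m%n≡0⇒n∣m e (suc d) (remainder (e % suc d) (m%n<n e (suc d))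
      (λ x → K.trans (K.sym (θ^-% θᵈ≈1 e x)) (θᵉ≈1 x)))
      where
      remainder : ∀ r → r ℕ.< suc d → Trivial r → r ≡ 0
      remainder zero    _         _    = ≡.refl
      remainder (suc r) (s≤s r<d) θʳ≈1 = contradiction θʳ≈1 (proj₂ (proj₂ (proj₂ least-period)) r r<d)

toℕ-mod : ∀ e d {{_ : ℕ.NonZero d}} → toℕ (e mod d) ≡ e % d
toℕ-mod e d = Fin.toℕ-fromℕ< (m%n<n e d)

block-mod : ∀ {d} {{_ : ℕ.NonZero d}} h (i : Fin d) → (h ℕ.* d ℕ.+ toℕ i) mod d ≡ i
block-mod {d} h i = Fin.toℕ-injective (≡.trans (toℕ-mod (h ℕ.* d ℕ.+ toℕ i) d)
  (≡.trans (≡.cong (_% d) (ℕ.+-comm (h ℕ.* d) (toℕ i)))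
    (≡.trans ([m+kn]%n≡m%n (toℕ i) h d) (m<n⇒m%n≡m (Fin.toℕ<n i)))))

-- Gaussian periods in 𝕂 and the trace form

module Subfield (N : ℕ) (p-prime : Prime (suc N)) (L : FieldOverℚ) (ζ : ∣ L ∣ᶠ)
  (ζ-primitive : IsPrimitiveRootOfUnity L (suc N) ζ) (L=ℚ⟨ζ⟩ : ∀ x → Adjoin L ζ x)
  (K : FieldOverℚ) (j : ∣ K ∣ᶠ → ∣ L ∣ᶠ) (j-hom : IsFieldEmbedding K L j)
  (u : ℤ) (u-generates : GeneratesUnits (suc N) u)
  (σ : ∣ L ∣ᶠ → ∣ L ∣ᶠ) (σ-auto : IsAutomorphism L σ)
  (σζ≈ζᵘ : FieldOverℚ._≈_ L (σ ζ) (FieldOverℚ._^_ L ζ (u %ℕ suc N)))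
  (θ : ∣ K ∣ᶠ → ∣ K ∣ᶠ) (jθ≈σj : ∀ x → FieldOverℚ._≈_ L (j (θ x)) (σ (j x)))
  (t : ∣ K ∣ᶠ) (t-trace : Relative.IsTrace K L j ζ t) where

  σ-hom : IsFieldEmbedding L L σ
  σ-hom = RingMorphisms.IsRingIsomorphism.isRingHomomorphism σ-auto

  open Restriction K L j j-hom σ σ-hom θ jθ≈σj public
  open CyclotomicField N p-prime L ζ ζ-primitive L=ℚ⟨ζ⟩ u u-generates σ σ-hom σζ≈ζᵘ
  open RootsOfUnity N p-prime L ζ ζ-primitive
  private
    module K = FieldOverℚ K
    module L = FieldOverℚ L
    module KA = LinearAlgebra K.commutativeRing
    module KR = RingTheory K.commutativeRing
    module KF = FieldTheory K
    module KQ = RationalCombinations K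
    module LQ = RationalCombinations L
    module j = FieldHomomorphism K L j j-hom
    module Z = PrimeField N p-prime
    module ZL = LinearAlgebra Z.ring
    module ZR = CommutativeRing Z.ring
  open L using (_≈_; _*_; _+_; -_; _-_; 0#; 1#; sum; trans; sym; refl; reflexive; +-cong; +-congʳ; *-cong; *-congˡ; *-congʳ; *-assoc; ι; fromℤ; _^_)
  open LinearAlgebra L.commutativeRing using (_×ℕ_)
  open RingTheory L.commutativeRing
  open FieldTheory L
  open SetoidReasoning (CommutativeRing.setoid L.commutativeRing)

  θᴺ≈1 : Trivial N
  θᴺ≈1 x = j.injective (trans (jθ^≈σ^j N x) (σ^N-identity (j x)))

  -- The conjugates of `t`. Their images in 𝕃 are the Gaussian periods, sums of ζ^(uᵉ) over a class
  -- of exponents e modulo the order of `θ`.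
  τ : ℕ → K.Carrier
  τ i = iterate θ t i

  -- Gal (L / K) consists of the powers of σᵈ, where d is the order of θ.
  module Period (d m : ℕ) {{d-nonZero : ℕ.NonZero d}} (N≡md : N ≡ m ℕ.* d)
    (θᵈ≈1 : Trivial d) (d-divides : ∀ e → Trivial e → d ∣ₙ e) where

    private
      open Relative K L j
      n = proj₁ t-trace
      g : Vector Gal n
      g = proj₁ (proj₂ t-trace)
      g-injective = proj₁ (proj₁ (proj₂ (proj₂ t-trace)))
      g-exhaustive = proj₂ (proj₁ (proj₂ (proj₂ t-trace)))
      module Gal-hom (h : Gal) where
        hom : IsFieldEmbedding L L (Gal.map h)
        hom = RingMorphisms.IsRingIsomorphism.isRingHomomorphism (Gal.isAutomorphism h)

      exponent : ∀ i → ∃ λ (e : Fin N) → ∀ x → Gal.map (g i) x ≈ iterate σ x (toℕ e)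
      exponent i = endomorphism-is-σ^ (Gal.map (g i)) (Gal-hom.hom (g i))

      exponent-trivial : ∀ i → Trivial (toℕ (proj₁ (exponent i)))
      exponent-trivial i x = j.injective (trans (jθ^≈σ^j (toℕ (proj₁ (exponent i))) x)
        (trans (sym (proj₂ (exponent i) (j x))) (Gal.fixes (g i) x)))

      block : ∀ i → ∃ λ (h : Fin m) → toℕ (proj₁ (exponent i)) ≡ toℕ h ℕ.* d
      block i = block-index N≡md _ (Fin.toℕ<n (proj₁ (exponent i))) (d-divides _ (exponent-trivial i))

      index : Fin n → Fin m
      index i = proj₁ (block i)

      g≗σ^ : ∀ i x → Gal.map (g i) x ≈ iterate σ x (toℕ (index i) ℕ.* d)
      g≗σ^ i x = trans (proj₂ (exponent i) x) (reflexive (≡.cong (iterate σ x) (proj₂ (block i))))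

      iterate-automorphism : ∀ e → IsAutomorphism L (λ x → iterate σ x e)
      iterate-automorphism zero    = Identity.isRingIsomorphism L.rawRing refl
      iterate-automorphism (suc e) = Composition.isRingIsomorphism trans σ-auto (iterate-automorphism e)

      σ^-Gal : Fin m → Gal
      σ^-Gal h = record
        { map            = λ x → iterate σ x (toℕ h ℕ.* d)
        ; isAutomorphism = iterate-automorphism (toℕ h ℕ.* d)
        ; fixes          = λ x → trans (sym (jθ^≈σ^j (toℕ h ℕ.* d) x)) (j.⟦⟧-cong (trivial-* θᵈ≈1 (toℕ h) x))
        }

      index⁻¹ : Fin m → Fin n
      index⁻¹ h = proj₁ (g-exhaustive (σ^-Gal h))

      σ^ζ : ∀ e → iterate σ ζ e ≈ conjugate e
      σ^ζ e = trans (Iterate.⟦⟧-cong e (sym conjugate-0)) (trans (σ^-conjugate e 0) (reflexive (≡.cong conjugate (ℕ.+-identityʳ e))))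

      bound : ∀ (h : Fin m) → toℕ h ℕ.* d ℕ.< N
      bound h = ≡.subst (toℕ h ℕ.* d ℕ.<_) (≡.sym N≡md) (ℕ.*-monoˡ-< d (Fin.toℕ<n h))

      σ^-injective : ∀ (h h′ : Fin m) → (∀ x → iterate σ x (toℕ h ℕ.* d) ≈ iterate σ x (toℕ h′ ℕ.* d)) → h ≡ h′
      σ^-injective h h′ eq = Fin.toℕ-injective (ℕ.*-cancelʳ-≡ (toℕ h) (toℕ h′) d (conjugate-injective (bound h) (bound h′)
        (trans (sym (σ^ζ (toℕ h ℕ.* d))) (trans (eq ζ) (σ^ζ (toℕ h′ ℕ.* d))))))

      -- The trace of ζ is given through some enumeration of Gal(𝕃/𝕂). Matching it with the
      -- automorphisms σ^(h d), h < m, turns the trace into an explicit sum over h.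
      π : Perm.Permutation n m
      π = Perm.permutation index index⁻¹
        (λ h → σ^-injective _ h (λ x → trans (sym (g≗σ^ (index⁻¹ h) x)) (sym (proj₂ (g-exhaustive (σ^-Gal h)) x))))
        (λ i → g-injective _ i (λ x → trans (sym (proj₂ (g-exhaustive (σ^-Gal (index i))) x)) (sym (g≗σ^ i x))))

    jt≈ : j t ≈ sum {m} (λ h → conjugate (toℕ h ℕ.* d))
    jt≈ = begin
      j t ≈⟨ proj₂ (proj₂ (proj₂ t-trace)) ⟩
      sum {n} (λ i → Gal.map (g i) ζ) ≈⟨ sum-cong-≋ {n} (λ i → trans (g≗σ^ i ζ) (σ^ζ (toℕ (index i) ℕ.* d))) ⟩
      sum {n} (λ i → conjugate (toℕ (index i) ℕ.* d)) ≈⟨ sum-permute {n} {m} (λ h → conjugate (toℕ h ℕ.* d)) π ⟨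
      sum {m} (λ h → conjugate (toℕ h ℕ.* d)) ∎

    jτ≈ : ∀ i → j (τ i) ≈ sum {m} (λ h → conjugate (toℕ h ℕ.* d ℕ.+ i))
    jτ≈ i = begin
      j (τ i) ≈⟨ jθ^≈σ^j i t ⟩
      iterate σ (j t) i ≈⟨ Iterate.⟦⟧-cong i jt≈ ⟩
      iterate σ (sum {m} (λ h → conjugate (toℕ h ℕ.* d))) i ≈⟨ Iterate.sum-homo i {m} (λ h → conjugate (toℕ h ℕ.* d)) ⟩
      sum {m} (λ h → iterate σ (conjugate (toℕ h ℕ.* d)) i) ≈⟨ sum-cong-≋ {m} (λ h → trans (σ^-conjugate i (toℕ h ℕ.* d)) (reflexive (≡.cong conjugate (ℕ.+-comm i (toℕ h ℕ.* d))))) ⟩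
      sum {m} (λ h → conjugate (toℕ h ℕ.* d ℕ.+ i)) ∎

    sum-conjugate-blocks : ∀ (f : ℕ → L.Carrier) → sum {N} (λ e → f (toℕ e)) ≈ sum {m} (λ h → sum {d} (λ i → f (toℕ h ℕ.* d ℕ.+ toℕ i)))
    sum-conjugate-blocks f = ≡.subst (λ M → sum {M} (λ e → f (toℕ e)) ≈ sum {m} (λ h → sum {d} (λ i → f (toℕ h ℕ.* d ℕ.+ toℕ i)))) (≡.sym N≡md) (sum-blocks m d f)

    -- The periods are sums over disjoint classes of exponents, so a combination of them is a
    -- combination of conjugates of ζ whose coefficient at e depends only on e modulo d.
    -- Independence and integrality carry over from 𝕃 this way.
    combination-of-conjugates : ∀ (c : Fin d → L.Carrier) →
      sum {d} (λ i → c i * j (τ (toℕ i))) ≈ sum {N} (λ e → c (toℕ e mod d) * conjugate (toℕ e))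
    combination-of-conjugates c = begin
      sum {d} (λ i → c i * j (τ (toℕ i)))
        ≈⟨ sum-cong-≋ {d} (λ i → trans (*-congˡ (jτ≈ (toℕ i))) (*-distribˡ-sum {m} (c i) (λ h → conjugate (toℕ h ℕ.* d ℕ.+ toℕ i)))) ⟩
      sum {d} (λ i → sum {m} (λ h → c i * conjugate (toℕ h ℕ.* d ℕ.+ toℕ i)))
        ≈⟨ ∑-comm {d} {m} (λ i h → c i * conjugate (toℕ h ℕ.* d ℕ.+ toℕ i)) ⟩
      sum {m} (λ h → sum {d} (λ i → c i * conjugate (toℕ h ℕ.* d ℕ.+ toℕ i)))
        ≈⟨ sum-cong-≋ {m} (λ h → sum-cong-≋ {d} (λ i → *-congʳ (reflexive (≡.cong c (block-mod (toℕ h) i))))) ⟨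
      sum {m} (λ h → sum {d} (λ i → c ((toℕ h ℕ.* d ℕ.+ toℕ i) mod d) * conjugate (toℕ h ℕ.* d ℕ.+ toℕ i)))
        ≈⟨ sum-conjugate-blocks (λ e → c (e mod d) * conjugate e) ⟨
      sum {N} (λ e → c (toℕ e mod d) * conjugate (toℕ e)) ∎

    j-combination : ∀ (c : Fin d → K.Carrier) → j (K.sum {d} (λ i → c i K.* τ (toℕ i))) ≈ sum {d} (λ i → j (c i) * j (τ (toℕ i)))
    j-combination c = trans (j.sum-homo {d} (λ i → c i K.* τ (toℕ i))) (sum-cong-≋ {d} (λ i → j.*-homo (c i) (τ (toℕ i))))

    -- The image in 𝕃 is an integer combination of roots of unity. Its monic equation has integer
    -- coefficients, so it can be read back in 𝕂 by injectivity of `j`.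
    combination-integral : ∀ (a : Vector ℤ d) {x} → x K.≈ K.sum {d} (λ i → K.fromℤ (a i) K.* τ (toℕ i)) → IsAlgebraicInteger K x
    combination-integral a {x} x≈ = proj₁ integral , proj₁ (proj₂ integral) , j.injective (begin
      j (x K.^ k K.+ K.sum {k} (λ i → K.fromℤ (c i) K.* x K.^ toℕ i)) ≈⟨ j.+-homo _ _ ⟩
      j (x K.^ k) + j (K.sum {k} (λ i → K.fromℤ (c i) K.* x K.^ toℕ i)) ≈⟨ +-cong (trans (j.^-homo x k) (^-congˡ k jx≈y)) (trans (j.sum-homo {k} (λ i → K.fromℤ (c i) K.* x K.^ toℕ i)) (sum-cong-≋ {k} (λ i →
                                                                               trans (j.*-homo _ _) (*-cong (j.fromℤ-homo (c i)) (trans (j.^-homo x (toℕ i)) (^-congˡ (toℕ i) jx≈y)))))) ⟩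
      y ^ k + sum {k} (λ i → fromℤ (c i) * y ^ toℕ i) ≈⟨ proj₂ (proj₂ integral) ⟩
      0# ≈⟨ j.0#-homo ⟨
      j K.0# ∎)
      where
      y : L.Carrier
      y = sum {N} (λ e → fromℤ (a (toℕ e mod d)) * conjugate (toℕ e))
      integral : IsAlgebraicInteger L y
      integral = sums-of-roots-integral {N} (λ e → a (toℕ e mod d)) (λ e → u^ toℕ e)
      k = proj₁ integral
      c = proj₁ (proj₂ integral)
      jx≈y : j x ≈ y
      jx≈y = begin
        j x ≈⟨ j.⟦⟧-cong x≈ ⟩
        j (K.sum {d} (λ i → K.fromℤ (a i) K.* τ (toℕ i))) ≈⟨ j-combination (λ i → K.fromℤ (a i)) ⟩
        sum {d} (λ i → j (K.fromℤ (a i)) * j (τ (toℕ i))) ≈⟨ sum-cong-≋ {d} (λ i → *-congʳ (j.fromℤ-homo (a i))) ⟩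
        sum {d} (λ i → fromℤ (a i) * j (τ (toℕ i))) ≈⟨ combination-of-conjugates (λ i → fromℤ (a i)) ⟩
        y ∎

    private
      0<m : 0 ℕ.< m
      0<m = ℕ.n≢0⇒n>0 λ m≡0 → ℕ.<⇒≢ (ℕ.≤-pred Z.1<p) (≡.sym (≡.trans N≡md (≡.cong (ℕ._* d) m≡0)))

      τ-basis : Vector K.Carrier d
      τ-basis i = τ (toℕ i)

      τ-independent : BasisSize.Independent K τ-basis
      τ-independent q qτ≈0 i = ≡.trans (≡.cong q (≡.sym (block-mod 0 i))) (≡.subst (λ e → q (e mod d) ≡ 0ℚ) (Fin.toℕ-fromℕ< i<N) (conjugates-independent (λ e → q (toℕ e mod d)) (begin
        sum {N} (λ e → ι (q (toℕ e mod d)) * conjugate (toℕ e)) ≈⟨ combination-of-conjugates (λ i → ι (q i)) ⟨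
        sum {d} (λ i → ι (q i) * j (τ (toℕ i))) ≈⟨ sum-cong-≋ {d} (λ i → *-congʳ (j.ι-homo (q i))) ⟨
        sum {d} (λ i → j (K.ι (q i)) * j (τ (toℕ i))) ≈⟨ j-combination (λ i → K.ι (q i)) ⟨
        j (K.sum {d} (λ i → K.ι (q i) K.* τ-basis i)) ≈⟨ j.⟦⟧-cong qτ≈0 ⟩
        j K.0# ≈⟨ j.0#-homo ⟩
        0# ∎) (fromℕ< i<N)))
        where
        i<N : toℕ i ℕ.< N
        i<N = ℕ.<-≤-trans (Fin.toℕ<n i) (≡.subst (d ℕ.≤_) (≡.sym N≡md) (ℕ.m≤n*m d m {{ℕ.>-nonZero 0<m}}))

      -- `j x` is fixed by the m automorphisms σ^(h d). Summing these m images of its expansion in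
      -- conjugates of ζ collects the conjugates into periods and gives m x, and m is invertible.
      τ-span : ∀ x → x KQ.∈⟨ τ-basis ⟩
      τ-span x = KQ.∈-resp (K.trans (K.*-congˡ (K.sym mx≈)) (K.trans (K.sym (K.*-assoc (K.ι r) (m KA.×ℕ K.1#) x))
        (K.trans (K.*-congʳ (proj₂ (KF.reciprocal 0<m))) (K.*-identityˡ x))))
        (KQ.∈-scale r (KQ.∈-sum _ (λ e → KQ.∈-scale (c e) (KQ.∈-resp
          (K.sym (K.trans (θ^-% θᵈ≈1 (toℕ e) t) (K.reflexive (≡.cong τ (≡.sym (toℕ-mod (toℕ e) d))))))
          (KQ.∈-generator (toℕ e mod d))))))
        where
        r : ℚ
        r = proj₁ (KF.reciprocal 0<m)
        c : Vector ℚ N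
        c = LQ.coefficients (conjugates-span (j x))
        mx≈ : (m KA.×ℕ K.1#) K.* x K.≈ K.sum {N} (λ e → K.ι (c e) K.* τ (toℕ e))
        mx≈ = j.injective (begin
          j ((m KA.×ℕ K.1#) K.* x) ≈⟨ trans (j.*-homo _ x) (*-congʳ (j.×ℕ1-homo m)) ⟩
          (m ×ℕ 1#) * j x ≈⟨ sum-const {m} (j x) ⟨
          sum {m} (λ _ → j x) ≈⟨ sum-cong-≋ {m} (λ h → trans (sym (jθ^≈σ^j (toℕ h ℕ.* d) x)) (j.⟦⟧-cong (trivial-* θᵈ≈1 (toℕ h) x))) ⟨
          sum {m} (λ h → iterate σ (j x) (toℕ h ℕ.* d)) ≈⟨ sum-cong-≋ {m} (λ h → expand (toℕ h ℕ.* d)) ⟩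
          sum {m} (λ h → sum {N} (λ e → ι (c e) * conjugate (toℕ h ℕ.* d ℕ.+ toℕ e))) ≈⟨ ∑-comm {m} {N} (λ h e → ι (c e) * conjugate (toℕ h ℕ.* d ℕ.+ toℕ e)) ⟩
          sum {N} (λ e → sum {m} (λ h → ι (c e) * conjugate (toℕ h ℕ.* d ℕ.+ toℕ e))) ≈⟨ sum-cong-≋ {N} (λ e → trans (*-congˡ (jτ≈ (toℕ e))) (*-distribˡ-sum {m} (ι (c e)) (λ h → conjugate (toℕ h ℕ.* d ℕ.+ toℕ e)))) ⟨
          sum {N} (λ e → ι (c e) * j (τ (toℕ e))) ≈⟨ sum-cong-≋ {N} (λ e → trans (j.*-homo _ _) (*-congʳ (j.ι-homo (c e)))) ⟨
          sum {N} (λ e → j (K.ι (c e) K.* τ (toℕ e))) ≈⟨ j.sum-homo {N} _ ⟨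
          j (K.sum {N} (λ e → K.ι (c e) K.* τ (toℕ e))) ∎)
          where
          expand : ∀ n → iterate σ (j x) n ≈ sum {N} (λ e → ι (c e) * conjugate (n ℕ.+ toℕ e))
          expand n = begin
            iterate σ (j x) n ≈⟨ Iterate.⟦⟧-cong n (LQ.proof (conjugates-span (j x))) ⟩
            iterate σ (sum {N} (λ e → ι (c e) * conjugate (toℕ e))) n ≈⟨ Iterate.sum-homo n {N} _ ⟩
            sum {N} (λ e → iterate σ (ι (c e) * conjugate (toℕ e)) n) ≈⟨ sum-cong-≋ {N} (λ e → trans (Iterate.*-homo n _ _) (*-cong (Iterate.ι-homo n (c e)) (σ^-conjugate n (toℕ e)))) ⟩
            sum {N} (λ e → ι (c e) * conjugate (n ℕ.+ toℕ e)) ∎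

    degree : ∀ {s} → HasDegree K s → s ≡ d
    degree (b , b-spans , b-independent) = BasisSize.basis-size-unique K b τ-basis b-independent τ-independent
      (λ i → τ-span (b i)) (λ k → KQ.combination (proj₁ (b-spans (τ-basis k))) (proj₂ (b-spans (τ-basis k))))

  -- The given basis has s elements and τ₀, ..., τ_{d-1} is another one, where d is the order of
  -- `θ`; the sizes of two bases agree.
  period-is-degree : ∀ {s} → HasDegree K s → Trivial s × (∀ e → Trivial e → s ∣ₙ e)
  period-is-degree {s} K-degree = ≡.subst Trivial d≡s (proj₁ (proj₂ (proj₂ d-period))) ,
    ≡.subst (λ d → ∀ e → Trivial e → d ∣ₙ e) d≡s (proj₂ (proj₂ (proj₂ d-period)))
    where
    d-period : ∃ λ d → 0 ℕ.< d × Trivial d × (∀ e → Trivial e → d ∣ₙ e)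
    d-period = period K-degree N (ℕ.≤-pred Z.1<p) θᴺ≈1
    d = proj₁ d-period
    d∣N : d ∣ₙ N
    d∣N = proj₂ (proj₂ (proj₂ d-period)) N θᴺ≈1
    d≡s : d ≡ s
    d≡s = ≡.sym (Period.degree d (ℕ∣._∣_.quotient d∣N) {{ℕ.>-nonZero (proj₁ (proj₂ d-period))}} (ℕ∣._∣_.equality d∣N)
      (proj₁ (proj₂ (proj₂ d-period))) (proj₂ (proj₂ (proj₂ d-period))) K-degree)

  -- The trace form Tr (τₖ τₗ) = p δₖₗ - m: the product τₖ τₗ has the conjugates ζ^(uᵏ + u^(h s + l)), and
  -- -1 lies in the subgroup of s-th powers because s is odd.
  module TraceForm (m s : ℕ) (N≡ms : N ≡ m ℕ.* s) (2∤s : ¬ (2 ∣ₙ s)) (K-degree : HasDegree K s) where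
    private
      instance
        s-nonZero : ℕ.NonZero s
        s-nonZero = ℕ.≢-nonZero λ s≡0 → 2∤s (≡.subst (2 ∣ₙ_) (≡.sym s≡0) (2 ℕ∣.∣0))

    θˢ≈1 : Trivial s
    θˢ≈1 = proj₁ (period-is-degree K-degree)

    open Period s m N≡ms θˢ≈1 (proj₂ (period-is-degree K-degree)) using (jτ≈; sum-conjugate-blocks; combination-integral) public
    private module EC = ExponentCount N p-prime u u-generates m s N≡ms 2∤s

    private
      exponent-sum : ℕ → ℕ → ℤ
      exponent-sum k l = u^ k ℤ.+ u^ l

      exponent-sum≡ : ∀ k l → exponent-sum k l ≡ u ZL.^ k ℤ.+ u ZL.^ l
      exponent-sum≡ k l = ≡.cong₂ ℤ._+_ (u^≡ k) (u^≡ l)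

      block-periodic : ∀ c h → conjugate ((h ℕ.+ m) ℕ.* s ℕ.+ c) ≈ conjugate (h ℕ.* s ℕ.+ c)
      block-periodic c h = trans (reflexive (≡.cong conjugate shifted-exponent)) (conjugate-periodic (h ℕ.* s ℕ.+ c))
        where
        shifted-exponent : (h ℕ.+ m) ℕ.* s ℕ.+ c ≡ h ℕ.* s ℕ.+ c ℕ.+ N
        shifted-exponent = ≡.trans (≡.cong (ℕ._+ c) (≡.trans (ℕ.*-distribʳ-+ s h m) (≡.cong (h ℕ.* s ℕ.+_) (≡.sym N≡ms))))
          (≡.trans (ℕ.+-assoc (h ℕ.* s) N c) (≡.trans (≡.cong (h ℕ.* s ℕ.+_) (ℕ.+-comm N c)) (≡.sym (ℕ.+-assoc (h ℕ.* s) c N))))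

      -- A period is invariant under σ^(h s). Shifting the second factor of a product of periods by
      -- h gives both factors the common exponent h s + e, so that the sums over h and over the
      -- powers of `θ` merge into one sum over all exponents below N.
      η-shift : ∀ l e h → sum {m} (λ h′ → conjugate (toℕ h′ ℕ.* s ℕ.+ (l ℕ.+ e))) ≈
                          sum {m} (λ h′ → conjugate (h ℕ.* s ℕ.+ e ℕ.+ (toℕ h′ ℕ.* s ℕ.+ l)))
      η-shift l e h = sym (trans (sum-cong-≋ {m} (λ h′ → reflexive (≡.cong conjugate (rearrange (toℕ h′)))))
        (sum-shift m (λ h′ → conjugate (h′ ℕ.* s ℕ.+ (l ℕ.+ e))) (block-periodic (l ℕ.+ e)) h))
        where
        rearrange : ∀ h′ → h ℕ.* s ℕ.+ e ℕ.+ (h′ ℕ.* s ℕ.+ l) ≡ (h′ ℕ.+ h) ℕ.* s ℕ.+ (l ℕ.+ e)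
        rearrange h′ = solve 5 (λ h s e h′ l → h :* s :+ e :+ (h′ :* s :+ l) := (h′ :+ h) :* s :+ (l :+ e)) ≡.refl h s e h′ l
          where open +-*-Solver

      jθ^τ : ∀ i k → j (iterate θ (τ k) i) ≈ sum {m} (λ h → conjugate (toℕ h ℕ.* s ℕ.+ (k ℕ.+ i)))
      jθ^τ i k = trans (reflexive (≡.cong j (≡.sym (iterate-+ θ t k i)))) (jτ≈ (k ℕ.+ i))

      T : ℕ → ℕ → ℕ → L.Carrier
      T l e h′ = conjugate (e ℕ.+ (h′ ℕ.* s ℕ.+ l))

      -- The trace from 𝕂 of a product of two periods, written through traces from 𝕃 of single roots
      -- of unity; each of these is N or -1.
      sum-of-traces : ∀ k l → j (K.sum {s} (λ i → iterate θ (τ k K.* τ l) (toℕ i))) ≈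
                      sum {m} (λ h′ → trace (ψ (exponent-sum k (toℕ h′ ℕ.* s ℕ.+ l))))
      sum-of-traces k l = begin
        j (K.sum {s} (λ i → iterate θ (τ k K.* τ l) (toℕ i)))
          ≈⟨ trans (j.sum-homo {s} _) (sum-cong-≋ {s} (λ i → trans (j.⟦⟧-cong (θ^.*-homo (toℕ i) (τ k) (τ l))) (j.*-homo _ _))) ⟩
        sum {s} (λ i → j (iterate θ (τ k) (toℕ i)) * j (iterate θ (τ l) (toℕ i)))
          ≈⟨ sum-cong-≋ {s} (λ i → trans (*-cong (jθ^τ (toℕ i) k) (jθ^τ (toℕ i) l)) (trans
               (*-distribʳ-sum {m} (sum {m} (λ h′ → conjugate (toℕ h′ ℕ.* s ℕ.+ (l ℕ.+ toℕ i)))) (λ h → conjugate (toℕ h ℕ.* s ℕ.+ (k ℕ.+ toℕ i))))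
               (sum-cong-≋ {m} (λ h → *-cong (reflexive (≡.cong conjugate (rearrange (toℕ h) k (toℕ i)))) (η-shift l (toℕ i) (toℕ h)))))) ⟩
        sum {s} (λ i → sum {m} (λ h → P (toℕ h ℕ.* s ℕ.+ toℕ i)))
          ≈⟨ ∑-comm {s} {m} (λ i h → P (toℕ h ℕ.* s ℕ.+ toℕ i)) ⟩
        sum {m} (λ h → sum {s} (λ i → P (toℕ h ℕ.* s ℕ.+ toℕ i)))
          ≈⟨ sum-conjugate-blocks P ⟨
        sum {N} (λ e → P (toℕ e))
          ≈⟨ sum-cong-≋ {N} (λ e → *-distribˡ-sum {m} (conjugate (toℕ e ℕ.+ k)) (λ h′ → T l (toℕ e) (toℕ h′))) ⟩
        sum {N} (λ e → sum {m} (λ h′ → conjugate (toℕ e ℕ.+ k) * T l (toℕ e) (toℕ h′)))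
          ≈⟨ ∑-comm {N} {m} (λ e h′ → conjugate (toℕ e ℕ.+ k) * T l (toℕ e) (toℕ h′)) ⟩
        sum {m} (λ h′ → sum {N} (λ e → conjugate (toℕ e ℕ.+ k) * T l (toℕ e) (toℕ h′)))
          ≈⟨ sum-cong-≋ {m} (λ h′ → sum-cong-≋ {N} (λ e → product-conjugate (toℕ e) (toℕ h′))) ⟩
        sum {m} (λ h′ → trace (ψ (exponent-sum k (toℕ h′ ℕ.* s ℕ.+ l)))) ∎
        where
        P : ℕ → L.Carrier
        P e = conjugate (e ℕ.+ k) * sum {m} (λ h′ → T l e (toℕ h′))
        rearrange : ∀ h k i → h ℕ.* s ℕ.+ (k ℕ.+ i) ≡ h ℕ.* s ℕ.+ i ℕ.+ k
        rearrange h k i = ≡.trans (≡.cong (h ℕ.* s ℕ.+_) (ℕ.+-comm k i)) (≡.sym (ℕ.+-assoc (h ℕ.* s) i k))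
        product-conjugate : ∀ e h′ → conjugate (e ℕ.+ k) * T l e h′ ≈ iterate σ (ψ (exponent-sum k (h′ ℕ.* s ℕ.+ l))) e
        product-conjugate e h′ = begin
          conjugate (e ℕ.+ k) * conjugate (e ℕ.+ (h′ ℕ.* s ℕ.+ l)) ≈⟨ *-cong (σ^-conjugate e k) (σ^-conjugate e (h′ ℕ.* s ℕ.+ l)) ⟨
          iterate σ (conjugate k) e * iterate σ (conjugate (h′ ℕ.* s ℕ.+ l)) e ≈⟨ Iterate.*-homo e _ _ ⟨
          iterate σ (conjugate k * conjugate (h′ ℕ.* s ℕ.+ l)) e ≈⟨ Iterate.⟦⟧-cong e (ψ-+ (u^ k) (u^ (h′ ℕ.* s ℕ.+ l))) ⟨
          iterate σ (ψ (exponent-sum k (h′ ℕ.* s ℕ.+ l))) e ∎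

      trace-off : ∀ {k l} → k ℕ.< s → l ℕ.< s → k ≢ l → ∀ h → trace (ψ (exponent-sum k (h ℕ.* s ℕ.+ l))) ≈ - 1#
      trace-off {k} {l} k<s l<s k≢l h = trace-ψ-nonzero (λ z≈0 → k≢l (EC.opposite-blocks k<s l<s h
        (≡.subst (Z._≋ₙ + 0) (exponent-sum≡ k (h ℕ.* s ℕ.+ l)) z≈0)))

      h₀ : Fin m
      h₀ = proj₁ EC.opposite-block

      trace-diag : ∀ k h → trace (ψ (exponent-sum k (toℕ h ℕ.* s ℕ.+ k))) ≈ (suc N ×ℕ 1#) * δ h h₀ - 1#
      trace-diag k h = helper (h Fin.≟ h₀)
        where
        open Solver using (_:=_; _:+_; _:*_; _:-_; :-_; con)
        helper : Dec (h ≡ h₀) → trace (ψ (exponent-sum k (toℕ h ℕ.* s ℕ.+ k))) ≈ (suc N ×ℕ 1#) * δ h h₀ - 1#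
        helper (yes ≡.refl) = begin
          trace (ψ (exponent-sum k (toℕ h₀ ℕ.* s ℕ.+ k))) ≈⟨ trace-ψ-zero (≡.subst (Z._≋ₙ + 0) (≡.sym (exponent-sum≡ k (toℕ h₀ ℕ.* s ℕ.+ k))) (proj₁ (proj₂ EC.opposite-block) k)) ⟩
          N ×ℕ 1# ≈⟨ Solver.solve 1 (λ n → n := (con (+ 1) :+ n) :* con (+ 1) :- con (+ 1)) refl (N ×ℕ 1#) ⟩
          (suc N ×ℕ 1#) * 1# - 1# ≈⟨ +-congʳ (*-congˡ (δ-diag h₀)) ⟨
          (suc N ×ℕ 1#) * δ h₀ h₀ - 1# ∎
        helper (no h≢h₀) = begin
          trace (ψ (exponent-sum k (toℕ h ℕ.* s ℕ.+ k))) ≈⟨ trace-ψ-nonzero (λ z≈0 → h≢h₀ (proj₂ (proj₂ EC.opposite-block) h k (≡.subst (Z._≋ₙ + 0) (exponent-sum≡ k (toℕ h ℕ.* s ℕ.+ k)) z≈0))) ⟩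
          - 1# ≈⟨ Solver.solve 1 (λ p → :- con (+ 1) := p :* con (+ 0) :- con (+ 1)) refl (suc N ×ℕ 1#) ⟩
          (suc N ×ℕ 1#) * 0# - 1# ≈⟨ +-congʳ (*-congˡ (δ-off h≢h₀)) ⟨
          (suc N ×ℕ 1#) * δ h h₀ - 1# ∎

    trace-form : ∀ (k l : Fin s) → K.sum {s} (λ i → iterate θ (τ (toℕ k) K.* τ (toℕ l)) (toℕ i)) K.≈
                 (suc N KA.×ℕ K.1#) K.* KR.δ k l K.- m KA.×ℕ K.1#
    trace-form k l = j.injective (trans (sum-of-traces (toℕ k) (toℕ l)) (helper (k Fin.≟ l)))
      where
      open Solver using (_:=_; _:+_; _:*_; _:-_; :-_; con)
      j-value : ∀ {x y} → KR.δ k l K.≈ x → j x ≈ y → (suc N ×ℕ 1#) * y - m ×ℕ 1# ≈ j ((suc N KA.×ℕ K.1#) K.* KR.δ k l K.- m KA.×ℕ K.1#)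
      j-value {x} {y} δ≈x jx≈y = sym (begin
        j ((suc N KA.×ℕ K.1#) K.* KR.δ k l K.- m KA.×ℕ K.1#) ≈⟨ j.sub-homo _ _ ⟩
        j ((suc N KA.×ℕ K.1#) K.* KR.δ k l) - j (m KA.×ℕ K.1#) ≈⟨ +-cong (trans (j.*-homo _ _) (*-cong (j.×ℕ1-homo (suc N)) (trans (j.⟦⟧-cong δ≈x) jx≈y))) (L.-‿cong (j.×ℕ1-homo m)) ⟩
        (suc N ×ℕ 1#) * y - m ×ℕ 1# ∎)
      helper : Dec (k ≡ l) → sum {m} (λ h → trace (ψ (exponent-sum (toℕ k) (toℕ h ℕ.* s ℕ.+ toℕ l)))) ≈
               j ((suc N KA.×ℕ K.1#) K.* KR.δ k l K.- m KA.×ℕ K.1#)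
      helper (yes ≡.refl) = begin
        sum {m} (λ h → trace (ψ (exponent-sum (toℕ k) (toℕ h ℕ.* s ℕ.+ toℕ k)))) ≈⟨ sum-cong-≋ {m} (trace-diag (toℕ k)) ⟩
        sum {m} (λ h → (suc N ×ℕ 1#) * δ h h₀ - 1#) ≈⟨ sum-sub {m} (λ h → (suc N ×ℕ 1#) * δ h h₀) (λ _ → 1#) ⟩
        sum {m} (λ h → (suc N ×ℕ 1#) * δ h h₀) - sum {m} (λ _ → 1#) ≈⟨ +-cong (sum-δʳ {m} (λ _ → suc N ×ℕ 1#) h₀) (L.-‿cong (sum-replicate m)) ⟩
        suc N ×ℕ 1# - m ×ℕ 1# ≈⟨ +-congʳ (L.*-identityʳ _) ⟨
        (suc N ×ℕ 1#) * 1# - m ×ℕ 1# ≈⟨ j-value (KR.δ-diag k) j.1#-homo ⟩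
        j ((suc N KA.×ℕ K.1#) K.* KR.δ k k K.- m KA.×ℕ K.1#) ∎
      helper (no k≢l) = begin
        sum {m} (λ h → trace (ψ (exponent-sum (toℕ k) (toℕ h ℕ.* s ℕ.+ toℕ l)))) ≈⟨ sum-cong-≋ {m} (λ h → trace-off (Fin.toℕ<n k) (Fin.toℕ<n l) (k≢l ∘ Fin.toℕ-injective) (toℕ h)) ⟩
        sum {m} (λ _ → - 1#) ≈⟨ sum-const {m} (- 1#) ⟩
        (m ×ℕ 1#) * - 1# ≈⟨ Solver.solve 2 (λ p m → m :* :- con (+ 1) := p :* con (+ 0) :- m) refl (suc N ×ℕ 1#) (m ×ℕ 1#) ⟩
        (suc N ×ℕ 1#) * 0# - m ×ℕ 1# ≈⟨ j-value (KR.δ-off k≢l) j.0#-homo ⟩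
        j ((suc N KA.×ℕ K.1#) K.* KR.δ k l K.- m KA.×ℕ K.1#) ∎

-- Integral lattices

open ℤ-LinearAlgebra using () renaming (sum to sumℤ; _·_ to _·ℤ_; linComb to linCombℤ; det to detℤ; _^_ to _^ℤ_)

module ℤ-Determinant = Determinant ℤ.+-*-commutativeRing

linComb-· : ∀ {m n} (c : Vector ℤ m) (b : Vector (Vector ℤ n) m) f → linCombℤ c b ·ℤ f ≡ sumℤ {m} (λ i → c i ℤ.* (b i ·ℤ f))
linComb-· {m} {n} c b f = begin
  sumℤ {n} (λ k → sumℤ {m} (λ i → c i ℤ.* b i k) ℤ.* f k) ≡⟨ ℤ-Ring.sum-cong-≋ {n} (λ k → ℤ-Ring.*-distribʳ-sum {m} (f k) (λ i → c i ℤ.* b i k)) ⟩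
  sumℤ {n} (λ k → sumℤ {m} (λ i → c i ℤ.* b i k ℤ.* f k)) ≡⟨ ℤ-Ring.∑-comm {n} {m} (λ k i → c i ℤ.* b i k ℤ.* f k) ⟩
  sumℤ {m} (λ i → sumℤ {n} (λ k → c i ℤ.* b i k ℤ.* f k)) ≡⟨ ℤ-Ring.sum-cong-≋ {m} (λ i → ≡.trans (ℤ-Ring.sum-cong-≋ {n} (λ k → ℤ.*-assoc (c i) (b i k) (f k)))
                                                                      (≡.sym (ℤ-Ring.*-distribˡ-sum {n} (c i) (λ k → b i k ℤ.* f k)))) ⟩
  sumℤ {m} (λ i → c i ℤ.* (b i ·ℤ f)) ∎
  where open ≡-Reasoning

sum-subtract : ∀ {n} (f g : Vector ℤ n) v → sumℤ {n} (λ k → f k ℤ.- v ℤ.* g k) ≡ sumℤ f ℤ.- v ℤ.* sumℤ g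
sum-subtract {n} f g v = ≡.trans (ℤ-Ring.sum-sub {n} f (λ k → v ℤ.* g k))
  (≡.cong (λ z → sumℤ f ℤ.- z) (≡.sym (ℤ-Ring.*-distribˡ-sum {n} v g)))

·-subtract : ∀ {n} (a c f : Vector ℤ n) v → (λ k → a k ℤ.- v ℤ.* c k) ·ℤ f ≡ a ·ℤ f ℤ.- v ℤ.* (c ·ℤ f)
·-subtract {n} a c f v = ≡.trans (ℤ-Ring.sum-cong-≋ {n} (λ k → solve 4 (λ a v c f → (a :- v :* c) :* f := a :* f :- v :* (c :* f)) ≡.refl (a k) v (c k) (f k)))
  (sum-subtract {n} (λ k → a k ℤ.* f k) (λ k → c k ℤ.* f k) v)
  where open ℤ-Ring.Solver using (solve; _:=_; _:*_; _:-_)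

-- Bases of sublattices of ℤⁿ cut out by congruences

module SublatticeBasis {n : ℕ} (form : Vector ℤ n → Vector ℤ n → ℤ)
  (form-left  : ∀ a c b v → form (λ k → a k ℤ.- v ℤ.* c k) b ≡ form a b ℤ.- v ℤ.* form c b)
  (form-right : ∀ a c b v → form b (λ k → a k ℤ.- v ℤ.* c k) ≡ form b a ℤ.- v ℤ.* form b c) where

  -- `D` becomes the squared volume once the form is realised as an inner product. Linear
  -- independence is not recorded: it follows from D > 0 by Cramer's rule. Membership is up to
  -- pointwise equality of vectors.
  record LatticeBasis (Λ : Vector ℤ n → Set) (D : ℕ) : Set where
    field
      basis        : Vector (Vector ℤ n) n
      spans        : ∀ {a} → Λ a → ∃ λ (c : Vector ℤ n) → ∀ k → a k ≡ linCombℤ c basis k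
      contains     : ∀ {a} (c : Vector ℤ n) → (∀ k → a k ≡ linCombℤ c basis k) → Λ a
      discriminant : detℤ (λ i k → form (basis i) (basis k)) ≡ + D

  -- One further congruence a · f ≡ 0 modulo q. If some basis vector bᵣ violates it, its value is
  -- invertible modulo q; then bᵣ is replaced by q bᵣ, and a multiple of bᵣ is subtracted from every
  -- other basis vector to make its value divisible by q.
  module Step (Nq : ℕ) (q-prime : Prime (suc Nq)) (f : Vector ℤ n) {Λ : Vector ℤ n → Set} {D : ℕ}
    (L : LatticeBasis Λ D) where
    open LatticeBasis L
    open PrimeField Nq q-prime
    private
      module ZR = CommutativeRing ring
      module ZT = RingTheory ring
      q = suc Nq

    Sublattice : Vector ℤ n → Set
    Sublattice a = Λ a × + q ∣ℤ a ·ℤ f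

    private
      w : Fin n → ℤ
      w i = basis i ·ℤ f

      combination-· : ∀ {a} c → (∀ k → a k ≡ linCombℤ c basis k) → a ·ℤ f ≡ sumℤ {n} (λ i → c i ℤ.* w i)
      combination-· {a} c a≡cb = ≡.trans (ℤ-Ring.sum-cong-≋ {n} (λ k → ≡.cong (ℤ._* f k) (a≡cb k))) (linComb-· c basis f)

      trivial : (∀ i → w i ≋ₙ + 0) → LatticeBasis Sublattice D
      trivial w≈0 = record
        { basis        = basis
        ; spans        = λ a∈ → spans (proj₁ a∈)
        ; contains     = λ {a} c a≡cb → contains c a≡cb , ≡.subst (+ q ∣ℤ_) (≡.sym (combination-· c a≡cb))
            (≈0⇒∣ (ZT.sum-zero {n} (λ i → ZR.trans (ZR.*-congˡ {c i} (w≈0 i)) (ZR.zeroʳ (c i)))))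
        ; discriminant = discriminant
        }

      module Pivot (r : Fin n) (wr≉0 : ¬ (w r ≋ₙ + 0)) where
        y : ℤ
        y = proj₁ (inverse wr≉0)

        -- The entry 1 - q at the pivot turns bᵣ - vᵣ bᵣ into q bᵣ. It is congruent to 1, and so is
        -- `y * w r`, so that `v` is proportional to `w` modulo q at every index.
        v : Vector ℤ n
        v i = if does (i Fin.≟ r) then + 1 ℤ.- + q else y ℤ.* w i

        vr≡1-q : v r ≡ + 1 ℤ.- + q
        vr≡1-q with r Fin.≟ r
        ... | yes _  = ≡.refl
        ... | no r≢r = contradiction ≡.refl r≢r

        1-q≈1 : + 1 ℤ.- + q ≋ₙ + 1
        1-q≈1 = congruent (divides (ℤ.- + 1) (solve 1 (λ q → con (+ 1) :- q :- con (+ 1) := :- con (+ 1) :* q) ≡.refl (+ q)))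
          where open ℤ-Ring.Solver using (solve; _:=_; _:*_; _:-_; :-_; con)

        v≈yw : ∀ i → v i ≋ₙ y ℤ.* w i
        v≈yw i with i Fin.≟ r
        ... | yes ≡.refl = ZR.trans 1-q≈1 (ZR.sym (proj₂ (inverse wr≉0)))
        ... | no _       = ZR.refl

        basis′ : Vector (Vector ℤ n) n
        basis′ i k = basis i k ℤ.- v i ℤ.* basis r k

        w′≈0 : ∀ i → basis′ i ·ℤ f ≋ₙ + 0
        w′≈0 i = ZR.trans (ZR.reflexive (·-subtract (basis i) (basis r) f (v i)))
          (ZT.x≈y⇒x-y≈0 (ZR.sym (ZR.trans (ZR.*-congʳ {w r} (v≈yw i)) (ZR.trans
            (ZR.reflexive (solve 3 (λ y x z → y :* x :* z := x :* (y :* z)) ≡.refl y (w i) (w r)))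
            (ZR.trans (ZR.*-congˡ {w i} (proj₂ (inverse wr≉0))) (ZR.*-identityʳ (w i)))))))
          where open ℤ-Ring.Solver using (solve; _:=_; _:*_)

        linComb-basis′ : ∀ c k → linCombℤ c basis′ k ≡ linCombℤ c basis k ℤ.- sumℤ {n} (λ i → c i ℤ.* v i) ℤ.* basis r k
        linComb-basis′ c k = begin
          sumℤ {n} (λ i → c i ℤ.* (basis i k ℤ.- v i ℤ.* z)) ≡⟨ ℤ-Ring.sum-cong-≋ {n} (λ i → solve 4 (λ c b v z → c :* (b :- v :* z) := c :* b :- z :* (c :* v)) ≡.refl (c i) (basis i k) (v i) z) ⟩
          sumℤ {n} (λ i → c i ℤ.* basis i k ℤ.- z ℤ.* (c i ℤ.* v i)) ≡⟨ sum-subtract {n} (λ i → c i ℤ.* basis i k) (λ i → c i ℤ.* v i) z ⟩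
          linCombℤ c basis k ℤ.- z ℤ.* sumℤ {n} (λ i → c i ℤ.* v i) ≡⟨ ≡.cong (λ x → linCombℤ c basis k ℤ.- x) (ℤ.*-comm z (sumℤ {n} (λ i → c i ℤ.* v i))) ⟩
          linCombℤ c basis k ℤ.- sumℤ {n} (λ i → c i ℤ.* v i) ℤ.* z ∎
          where
          open ≡-Reasoning
          open ℤ-Ring.Solver using (solve; _:=_; _:*_; _:-_)
          z = basis r k

        adjust : Vector ℤ n → ℤ → Vector ℤ n
        adjust c e i = c i ℤ.+ e ℤ.* ℤ-Ring.δ i r

        sum-adjust : ∀ c e (g : Vector ℤ n) → sumℤ {n} (λ i → adjust c e i ℤ.* g i) ≡ sumℤ {n} (λ i → c i ℤ.* g i) ℤ.+ e ℤ.* g r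
        sum-adjust c e g = begin
          sumℤ {n} (λ i → (c i ℤ.+ e ℤ.* ℤ-Ring.δ i r) ℤ.* g i) ≡⟨ ℤ-Ring.sum-cong-≋ {n} (λ i → solve 4 (λ c e d g → (c :+ e :* d) :* g := c :* g :+ (e :* g) :* d) ≡.refl (c i) e (ℤ-Ring.δ i r) (g i)) ⟩
          sumℤ {n} (λ i → c i ℤ.* g i ℤ.+ (e ℤ.* g i) ℤ.* ℤ-Ring.δ i r) ≡⟨ ℤ-Ring.∑-distrib-+ {n} (λ i → c i ℤ.* g i) (λ i → (e ℤ.* g i) ℤ.* ℤ-Ring.δ i r) ⟩
          sumℤ {n} (λ i → c i ℤ.* g i) ℤ.+ sumℤ {n} (λ i → (e ℤ.* g i) ℤ.* ℤ-Ring.δ i r) ≡⟨ ≡.cong (λ x → sumℤ {n} (λ i → c i ℤ.* g i) ℤ.+ x) (ℤ-Ring.sum-δʳ {n} (λ i → e ℤ.* g i) r) ⟩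
          sumℤ {n} (λ i → c i ℤ.* g i) ℤ.+ e ℤ.* g r ∎
          where
          open ≡-Reasoning
          open ℤ-Ring.Solver using (solve; _:=_; _:*_; _:+_)

        contains′ : ∀ {a} (c : Vector ℤ n) → (∀ k → a k ≡ linCombℤ c basis′ k) → Sublattice a
        contains′ {a} c a≡cb′ = contains (adjust c (ℤ.- C)) (λ k → begin
            a k ≡⟨ a≡cb′ k ⟩
            linCombℤ c basis′ k ≡⟨ linComb-basis′ c k ⟩
            linCombℤ c basis k ℤ.- C ℤ.* basis r k ≡⟨ solve 3 (λ x c b → x :- c :* b := x :+ (:- c) :* b) ≡.refl (linCombℤ c basis k) C (basis r k) ⟩
            linCombℤ c basis k ℤ.+ (ℤ.- C) ℤ.* basis r k ≡⟨ sum-adjust c (ℤ.- C) (λ i → basis i k) ⟨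
            linCombℤ (adjust c (ℤ.- C)) basis k ∎) ,
          ≡.subst (+ q ∣ℤ_) (≡.sym (≡.trans (ℤ-Ring.sum-cong-≋ {n} (λ k → ≡.cong (ℤ._* f k) (a≡cb′ k))) (linComb-· c basis′ f)))
            (≈0⇒∣ (ZT.sum-zero {n} (λ i → ZR.trans (ZR.*-congˡ {c i} (w′≈0 i)) (ZR.zeroʳ (c i)))))
          where
          open ≡-Reasoning
          open ℤ-Ring.Solver using (solve; _:=_; _:*_; _:+_; _:-_; :-_)
          C : ℤ
          C = sumℤ {n} (λ i → c i ℤ.* v i)

        spans′ : ∀ {a} → Sublattice a → ∃ λ (c : Vector ℤ n) → ∀ k → a k ≡ linCombℤ c basis′ k
        -- With the old coefficients the new basis falls short by C bᵣ, where C = Σ cᵢ vᵢ. Modulo q,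
        -- C is `y` times a · f, hence 0; as the new pivot vector is q bᵣ, adding e = C / q to its
        -- coefficient makes up for the deficit.
        spans′ {a} (a∈Λ , q∣a·f) = adjust c e , λ k → ≡.sym (begin
          linCombℤ (adjust c e) basis′ k ≡⟨ linComb-basis′ (adjust c e) k ⟩
          linCombℤ (adjust c e) basis k ℤ.- sumℤ {n} (λ i → adjust c e i ℤ.* v i) ℤ.* basis r k
            ≡⟨ ≡.cong₂ (λ x z → x ℤ.- z ℤ.* basis r k) (sum-adjust c e (λ i → basis i k)) (sum-adjust c e v) ⟩
          linCombℤ c basis k ℤ.+ e ℤ.* basis r k ℤ.- (C ℤ.+ e ℤ.* v r) ℤ.* basis r k
            ≡⟨ ≡.cong₂ (λ x z → linCombℤ c basis k ℤ.+ e ℤ.* basis r k ℤ.- (x ℤ.+ e ℤ.* z) ℤ.* basis r k) C≡eq vr≡1-q ⟩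
          linCombℤ c basis k ℤ.+ e ℤ.* basis r k ℤ.- (e ℤ.* + q ℤ.+ e ℤ.* (+ 1 ℤ.- + q)) ℤ.* basis r k
            ≡⟨ solve 4 (λ x e b q → x :+ e :* b :- (e :* q :+ e :* (con (+ 1) :- q)) :* b := x) ≡.refl (linCombℤ c basis k) e (basis r k) (+ q) ⟩
          linCombℤ c basis k ≡⟨ proj₂ (spans a∈Λ) k ⟨
          a k ∎)
          where
          open ≡-Reasoning
          open ℤ-Ring.Solver using (solve; _:=_; _:*_; _:+_; _:-_; con)
          c : Vector ℤ n
          c = proj₁ (spans a∈Λ)
          C : ℤ
          C = sumℤ {n} (λ i → c i ℤ.* v i)
          C≈0 : C ≋ₙ + 0
          C≈0 = ZR.trans (ZT.sum-cong-≋ {n} (λ i → ZR.trans (ZR.*-congˡ {c i} (v≈yw i)) (ZR.reflexive (solve 3 (λ c y w → c :* (y :* w) := y :* (c :* w)) ≡.refl (c i) y (w i)))))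
            (ZR.trans (ZR.sym (ZT.*-distribˡ-sum {n} y (λ i → c i ℤ.* w i)))
            (ZR.trans (ZR.*-congˡ {y} (∣⇒≈0 (≡.subst (+ q ∣ℤ_) (combination-· c (proj₂ (spans a∈Λ))) q∣a·f))) (ZR.zeroʳ y)))
          q∣C : + q ∣ℤ C
          q∣C = ≈0⇒∣ C≈0
          e : ℤ
          e = ℤ∣._∣_.quotient q∣C
          C≡eq : C ≡ e ℤ.* + q
          C≡eq = ℤ∣._∣_.equality q∣C

        G : Fin n → Fin n → ℤ
        G i k = form (basis i) (basis k)

        gram′ : ∀ i k → form (basis′ i) (basis′ k) ≡ (G i k ℤ.- v i ℤ.* G r k) ℤ.- v k ℤ.* (G i r ℤ.- v i ℤ.* G r r)
        gram′ i k = begin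
          form (basis′ i) (basis′ k) ≡⟨ form-left (basis i) (basis r) (basis′ k) (v i) ⟩
          form (basis i) (basis′ k) ℤ.- v i ℤ.* form (basis r) (basis′ k) ≡⟨ ≡.cong₂ (λ x z → x ℤ.- v i ℤ.* z) (form-right (basis k) (basis r) (basis i) (v k)) (form-right (basis k) (basis r) (basis r) (v k)) ⟩
          (G i k ℤ.- v k ℤ.* G i r) ℤ.- v i ℤ.* (G r k ℤ.- v k ℤ.* G r r) ≡⟨ solve 6 (λ x y z t v w → (x :- w :* y) :- v :* (z :- w :* t) := (x :- v :* z) :- w :* (y :- v :* t)) ≡.refl (G i k) (G i r) (G r k) (G r r) (v i) (v k) ⟩
          (G i k ℤ.- v i ℤ.* G r k) ℤ.- v k ℤ.* (G i r ℤ.- v i ℤ.* G r r) ∎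
          where
          open ≡-Reasoning
          open ℤ-Ring.Solver using (solve; _:=_; _:*_; _:-_)

        discriminant′ : detℤ (λ i k → form (basis′ i) (basis′ k)) ≡ + (q ℕ.* q ℕ.* D)
        discriminant′ = begin
          detℤ (λ i k → form (basis′ i) (basis′ k)) ≡⟨ ℤ-Determinant.det-cong n gram′ ⟩
          detℤ (λ i k → (G i k ℤ.- v i ℤ.* G r k) ℤ.- v k ℤ.* (G i r ℤ.- v i ℤ.* G r r)) ≡⟨ ℤ-Determinant.det-congruence n r v G ⟩
          (+ 1 ℤ.- v r) ℤ.* (+ 1 ℤ.- v r) ℤ.* detℤ G ≡⟨ ≡.cong₂ (λ x z → (+ 1 ℤ.- x) ℤ.* (+ 1 ℤ.- x) ℤ.* z) vr≡1-q discriminant ⟩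
          (+ 1 ℤ.- (+ 1 ℤ.- + q)) ℤ.* (+ 1 ℤ.- (+ 1 ℤ.- + q)) ℤ.* + D ≡⟨ solve 2 (λ q D → (con (+ 1) :- (con (+ 1) :- q)) :* (con (+ 1) :- (con (+ 1) :- q)) :* D := q :* q :* D) ≡.refl (+ q) (+ D) ⟩
          + q ℤ.* + q ℤ.* + D ≡⟨ ≡.trans (≡.cong (ℤ._* + D) (≡.sym (ℤ.pos-* q q))) (≡.sym (ℤ.pos-* (q ℕ.* q) D)) ⟩
          + (q ℕ.* q ℕ.* D) ∎
          where
          open ≡-Reasoning
          open ℤ-Ring.Solver using (solve; _:=_; _:*_; _:-_; con)

        pivoted : LatticeBasis Sublattice (q ℕ.* q ℕ.* D)
        pivoted = record { basis = basis′ ; spans = spans′ ; contains = contains′ ; discriminant = discriminant′ }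

    -- An inequality suffices: if the congruence already holds on the lattice, D stays as it is, and
    -- a smaller volume only raises the density.
    sublattice-basis : ∃ λ D′ → (0 ℕ.< D → 0 ℕ.< D′) × D′ ℕ.≤ q ℕ.* q ℕ.* D × LatticeBasis Sublattice D′
    sublattice-basis = helper (Fin.any? (λ i → ¬? (w i ≈?0)))
      where
      helper : Dec (∃ λ i → ¬ (w i ≋ₙ + 0)) → ∃ λ D′ → (0 ℕ.< D → 0 ℕ.< D′) × D′ ℕ.≤ q ℕ.* q ℕ.* D × LatticeBasis Sublattice D′
      helper (yes (r , wr≉0)) = q ℕ.* q ℕ.* D , (λ 0<D → ℕ.*-mono-< {0} {q ℕ.* q} {0} {D} (s≤s z≤n) 0<D) , ℕ.≤-refl , Pivot.pivoted r wr≉0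
      helper (no none)        = D , (λ 0<D → 0<D) , ℕ.m≤n*m D (q ℕ.* q) ,
        trivial (λ i → decidable-stable (w i ≈?0) (λ wi≉0 → none (i , wi≉0)))

IsZero : ∀ {n} → Vector ℤ n → Set
IsZero a = ∀ k → a k ≡ + 0

IsZero? : ∀ {n} (a : Vector ℤ n) → Dec (IsZero a)
IsZero? a = Fin.all? (λ k → a k ℤ.≟ + 0)

square-nonneg : ∀ i → + 0 ℤ.≤ i ℤ.* i
square-nonneg (+ n)    = ≡.subst (+ 0 ℤ.≤_) (ℤ.pos-* n n) (ℤ.+≤+ z≤n)
square-nonneg -[1+ n ] = ℤ.+≤+ z≤n

sum-nonneg : ∀ {n} (f : Vector ℤ n) → (∀ k → + 0 ℤ.≤ f k) → + 0 ℤ.≤ sumℤ f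
sum-nonneg {zero}  f 0≤f = ℤ.≤-refl
sum-nonneg {suc n} f 0≤f = ℤ.+-mono-≤ (0≤f zero) (sum-nonneg (f ∘ suc) (0≤f ∘ suc))

term≤sum : ∀ {n} (f : Vector ℤ n) → (∀ k → + 0 ℤ.≤ f k) → ∀ k → f k ℤ.≤ sumℤ f
term≤sum {suc n} f 0≤f zero    = ≡.subst (ℤ._≤ f zero ℤ.+ sumℤ (f ∘ suc)) (ℤ.+-identityʳ (f zero))
  (ℤ.+-mono-≤ (ℤ.≤-refl {f zero}) (sum-nonneg (f ∘ suc) (0≤f ∘ suc)))
term≤sum {suc n} f 0≤f (suc k) = ≡.subst (ℤ._≤ f zero ℤ.+ sumℤ (f ∘ suc)) (ℤ.+-identityˡ (f (suc k)))
  (ℤ.+-mono-≤ (0≤f zero) (term≤sum (f ∘ suc) (0≤f ∘ suc) k))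

abs≤square : ∀ i → + ℤ.∣ i ∣ ℤ.≤ i ℤ.* i
abs≤square (+ zero)  = ℤ.≤-refl
abs≤square (+ suc n) = ≡.subst (+ suc n ℤ.≤_) (ℤ.pos-* (suc n) (suc n)) (ℤ.+≤+ (ℕ.m≤m*n (suc n) (suc n)))
abs≤square -[1+ n ]  = ℤ.+≤+ (ℕ.m≤m*n (suc n) (suc n))

abs≤norm : ∀ {n} (a : Vector ℤ n) k → + ℤ.∣ a k ∣ ℤ.≤ a ·ℤ a
abs≤norm a k = ℤ.≤-trans (abs≤square (a k)) (term≤sum (λ k → a k ℤ.* a k) (λ k → square-nonneg (a k)) k)

norm-nonneg : ∀ {n} (a : Vector ℤ n) → + 0 ℤ.≤ a ·ℤ a
norm-nonneg a = sum-nonneg (λ k → a k ℤ.* a k) (λ k → square-nonneg (a k))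

norm≡0 : ∀ {n} (a : Vector ℤ n) → a ·ℤ a ℤ.≤ + 0 → IsZero a
norm≡0 a a·a≤0 k = ℤ.∣i∣≡0⇒i≡0 (ℕ.n≤0⇒n≡0 (ℤ.drop‿+≤+ (ℤ.≤-trans (abs≤norm a k) a·a≤0)))

sum-ones : ∀ n → sumℤ {n} (λ _ → + 1) ≡ + n
sum-ones zero    = ≡.refl
sum-ones (suc n) = ≡.cong (λ z → + 1 ℤ.+ z) (sum-ones n)

-- Lagrange's identity: the difference is the sum of (aᵢ - aⱼ)² over pairs. A new coordinate x adds
-- the sum of (a′ₖ - x)².
cauchy-schwarz : ∀ n (a : Vector ℤ n) → + 0 ℤ.≤ + n ℤ.* (a ·ℤ a) ℤ.- sumℤ a ℤ.* sumℤ a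
cauchy-schwarz zero    a = ℤ.≤-refl
cauchy-schwarz (suc n) a = ≡.subst (+ 0 ℤ.≤_) identity (ℤ.+-mono-≤ (cauchy-schwarz n a′) (≡.subst (+ 0 ℤ.≤_) expand
  (sum-nonneg (λ k → (a′ k ℤ.- x) ℤ.* (a′ k ℤ.- x)) (λ k → square-nonneg (a′ k ℤ.- x)))))
  where
  open ℤ-Ring.Solver using (solve; _:=_; _:*_; _:+_; _:-_; :-_; con)
  open ≡-Reasoning
  x : ℤ
  x = a zero
  a′ : Vector ℤ n
  a′ = a ∘ suc
  expand : sumℤ {n} (λ k → (a′ k ℤ.- x) ℤ.* (a′ k ℤ.- x)) ≡ (a′ ·ℤ a′ ℤ.- (x ℤ.+ x) ℤ.* sumℤ a′) ℤ.- (ℤ.- (x ℤ.* x)) ℤ.* + n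
  expand = begin
    sumℤ {n} (λ k → (a′ k ℤ.- x) ℤ.* (a′ k ℤ.- x))
      ≡⟨ ℤ-Ring.sum-cong-≋ {n} (λ k → solve 2 (λ a x → (a :- x) :* (a :- x) := (a :* a :- (x :+ x) :* a) :- (con (+ 0) :- x :* x) :* con (+ 1)) ≡.refl (a′ k) x) ⟩
    sumℤ {n} (λ k → (a′ k ℤ.* a′ k ℤ.- (x ℤ.+ x) ℤ.* a′ k) ℤ.- (+ 0 ℤ.- x ℤ.* x) ℤ.* + 1)
      ≡⟨ sum-subtract {n} (λ k → a′ k ℤ.* a′ k ℤ.- (x ℤ.+ x) ℤ.* a′ k) (λ _ → + 1) (+ 0 ℤ.- x ℤ.* x) ⟩
    sumℤ {n} (λ k → a′ k ℤ.* a′ k ℤ.- (x ℤ.+ x) ℤ.* a′ k) ℤ.- (+ 0 ℤ.- x ℤ.* x) ℤ.* sumℤ {n} (λ _ → + 1)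
      ≡⟨ ≡.cong₂ (λ y z → y ℤ.- z ℤ.* sumℤ {n} (λ _ → + 1)) (sum-subtract {n} (λ k → a′ k ℤ.* a′ k) a′ (x ℤ.+ x)) (ℤ.+-identityˡ (ℤ.- (x ℤ.* x))) ⟩
    (a′ ·ℤ a′ ℤ.- (x ℤ.+ x) ℤ.* sumℤ a′) ℤ.- (ℤ.- (x ℤ.* x)) ℤ.* sumℤ {n} (λ _ → + 1)
      ≡⟨ ≡.cong (λ z → (a′ ·ℤ a′ ℤ.- (x ℤ.+ x) ℤ.* sumℤ a′) ℤ.- (ℤ.- (x ℤ.* x)) ℤ.* z) (sum-ones n) ⟩
    (a′ ·ℤ a′ ℤ.- (x ℤ.+ x) ℤ.* sumℤ a′) ℤ.- (ℤ.- (x ℤ.* x)) ℤ.* + n ∎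
  identity : (+ n ℤ.* (a′ ·ℤ a′) ℤ.- sumℤ a′ ℤ.* sumℤ a′) ℤ.+ ((a′ ·ℤ a′ ℤ.- (x ℤ.+ x) ℤ.* sumℤ a′) ℤ.- (ℤ.- (x ℤ.* x)) ℤ.* + n)
             ≡ (+ 1 ℤ.+ + n) ℤ.* (x ℤ.* x ℤ.+ a′ ·ℤ a′) ℤ.- (x ℤ.+ sumℤ a′) ℤ.* (x ℤ.+ sumℤ a′)
  identity = solve 4 (λ n A S x → (n :* A :- S :* S) :+ ((A :- (x :+ x) :* S) :- (:- (x :* x)) :* n)
    := (con (+ 1) :+ n) :* (x :* x :+ A) :- (x :+ S) :* (x :+ S)) ≡.refl (+ n) (a′ ·ℤ a′) (sumℤ a′) x

-- A vector of norm at most M has coordinates in [-M, M], so the vectors of given norm can be searched.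
module MinimalVector {n : ℕ} (Λ : Vector ℤ n → Set) (Λ? : ∀ a → Dec (Λ a))
  (Λ-resp : ∀ {a b} → a ≗ b → Λ a → Λ b) (Q : Vector ℤ n → ℤ) (Q-cong : ∀ {a b} → a ≗ b → Q a ≡ Q b)
  (norm≤Q : ∀ a → a ·ℤ a ℤ.≤ Q a) where

  private
    Represented : ℕ → Set
    Represented M = ∃ λ a → Λ a × ¬ IsZero a × Q a ≡ + M

    decode : ∀ M → (Fin n → Fin (suc (M ℕ.+ M))) → Vector ℤ n
    decode M x k = + toℕ (x k) ℤ.- + M

    shift : ∀ M i → ℤ.∣ i ∣ ℕ.≤ M → + ℤ.∣ i ℤ.+ + M ∣ ≡ i ℤ.+ + M
    shift M (+ i)    _   = ≡.refl
    shift M -[1+ i ] i<M = ≡.subst (λ z → + ℤ.∣ z ∣ ≡ z) (≡.sym (ℤ.⊖-≥ i<M)) ≡.refl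

    encode : ∀ M (a : Vector ℤ n) → (∀ k → ℤ.∣ a k ∣ ℕ.≤ M) → ∃ λ x → decode M x ≗ a
    encode M a bound = x , λ k → begin
      + toℕ (x k) ℤ.- + M ≡⟨ ≡.cong (λ z → + z ℤ.- + M) (Fin.toℕ-fromℕ< (s≤s (small k))) ⟩
      + ℤ.∣ a k ℤ.+ + M ∣ ℤ.- + M ≡⟨ ≡.cong (ℤ._- + M) (shift M (a k) (bound k)) ⟩
      a k ℤ.+ + M ℤ.- + M ≡⟨ ℤ-Ring.Solver.solve 2 (λ a M → a :+ M :- M := a) ≡.refl (a k) (+ M) ⟩
      a k ∎
      where
      open ≡-Reasoning
      open ℤ-Ring.Solver using (_:=_; _:+_; _:-_)
      small : ∀ k → ℤ.∣ a k ℤ.+ + M ∣ ℕ.≤ M ℕ.+ M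
      small k = ℕ.≤-trans (ℤ.∣i+j∣≤∣i∣+∣j∣ (a k) (+ M)) (ℕ.+-monoˡ-≤ M (bound k))
      x : Fin n → Fin (suc (M ℕ.+ M))
      x k = fromℕ< (s≤s (small k))

    represented? : ∀ M → Dec (Represented M)
    represented? M = map′
      (λ (x , Λx , x≢0 , Qx) → decode M (finToFun x) , Λx , x≢0 , Qx) found
      (Fin.any? {n = suc (M ℕ.+ M) ℕ.^ n} (λ x → Λ? (decode M (finToFun x)) ×-dec ¬? (IsZero? (decode M (finToFun x))) ×-dec (Q (decode M (finToFun x)) ℤ.≟ + M)))
      where
      found : Represented M → ∃ λ x → Λ (decode M (finToFun x)) × ¬ IsZero (decode M (finToFun x)) × Q (decode M (finToFun x)) ≡ + M
      found (a , Λa , a≢0 , Qa≡M) = funToFin x , Λ-resp (≡.sym ∘ same) Λa , (λ z → a≢0 (λ k → ≡.trans (≡.sym (same k)) (z k))) , ≡.trans (Q-cong same) Qa≡M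
        where
        code : ∃ λ x → decode M x ≗ a
        code = encode M a (λ k → ℤ.drop‿+≤+ (ℤ.≤-trans (abs≤norm a k) (ℤ.≤-trans (norm≤Q a) (ℤ.≤-reflexive Qa≡M))))
        x = proj₁ code
        same : decode M (finToFun (funToFin x)) ≗ a
        same k = ≡.trans (≡.cong (λ i → + toℕ i ℤ.- + M) (Fin.finToFun-funToFin x k)) (proj₂ code k)

    Q≡∣Q∣ : ∀ a → Q a ≡ + ℤ.∣ Q a ∣
    Q≡∣Q∣ a = ≡.sym (ℤ.0≤i⇒+∣i∣≡i (ℤ.≤-trans (norm-nonneg a) (norm≤Q a)))

  -- A nonzero vector `a` of the lattice bounds the values of `Q` to be searched; for each value
  -- there are finitely many candidates.
  minimal-vector : ∀ a → Λ a → ¬ IsZero a →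
    ∃ λ a₀ → ∃ λ M → Λ a₀ × ¬ IsZero a₀ × Q a₀ ≡ + M × (∀ a → Λ a → ¬ IsZero a → + M ℤ.≤ Q a)
  minimal-vector a Λa a≢0 = proj₁ (proj₁ (proj₂ least-norm)) , M , proj₁ (proj₂ (proj₁ (proj₂ least-norm))) ,
    proj₁ (proj₂ (proj₂ (proj₁ (proj₂ least-norm)))) , proj₂ (proj₂ (proj₂ (proj₁ (proj₂ least-norm)))) , minimal
    where
    least-norm : ∃ λ M → Represented M × M ℕ.≤ ℤ.∣ Q a ∣ × (∀ k → k ℕ.< M → ¬ Represented k)
    least-norm = least Represented represented? ℤ.∣ Q a ∣ (a , Λa , a≢0 , Q≡∣Q∣ a)
    M = proj₁ least-norm
    minimal : ∀ a → Λ a → ¬ IsZero a → + M ℤ.≤ Q a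
    minimal a Λa a≢0 = ≡.subst (+ M ℤ.≤_) (≡.sym (Q≡∣Q∣ a)) (ℤ.+≤+ (ℕ.≮⇒≥ (λ Qa<M →
      proj₂ (proj₂ (proj₂ least-norm)) ℤ.∣ Q a ∣ Qa<M (a , Λa , a≢0 , Q≡∣Q∣ a))))

^-distrib-*ₙ : ∀ k m n → (m ℕ.* n) ℕ.^ k ≡ m ℕ.^ k ℕ.* n ℕ.^ k
^-distrib-*ₙ zero    m n = ≡.refl
^-distrib-*ₙ (suc k) m n = ≡.trans (≡.cong (m ℕ.* n ℕ.*_) (^-distrib-*ₙ k m n))
  (solve 4 (λ m n x y → m :* n :* (x :* y) := m :* x :* (n :* y)) ≡.refl m n (m ℕ.^ k) (n ℕ.^ k))
  where open +-*-Solver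

-- The trace form in the coordinates of τ₀, …, τ_{s-1}, where p = m s + 1.
module IntegralTraceForm (p m s : ℕ) where
  form : Vector ℤ s → Vector ℤ s → ℤ
  form a b = + p ℤ.* (a ·ℤ b) ℤ.- + m ℤ.* (sumℤ a ℤ.* sumℤ b)

  form-sym : ∀ a b → form a b ≡ form b a
  form-sym a b = ≡.cong₂ (λ x y → + p ℤ.* x ℤ.- + m ℤ.* y)
    (ℤ-Ring.sum-cong-≋ {s} (λ k → ℤ.*-comm (a k) (b k))) (ℤ.*-comm (sumℤ a) (sumℤ b))

  form-cong : ∀ {a b c d} → a ≗ b → c ≗ d → form a c ≡ form b d
  form-cong a≗b c≗d = ≡.cong₂ (λ x y → + p ℤ.* x ℤ.- + m ℤ.* y)
    (ℤ-Ring.sum-cong-≋ {s} (λ k → ≡.cong₂ ℤ._*_ (a≗b k) (c≗d k)))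
    (≡.cong₂ ℤ._*_ (ℤ-Ring.sum-cong-≋ {s} a≗b) (ℤ-Ring.sum-cong-≋ {s} c≗d))

  form-left : ∀ a c b v → form (λ k → a k ℤ.- v ℤ.* c k) b ≡ form a b ℤ.- v ℤ.* form c b
  form-left a c b v = ≡.trans
    (≡.cong₂ (λ x y → + p ℤ.* x ℤ.- + m ℤ.* (y ℤ.* sumℤ b)) (·-subtract {s} a c b v) (sum-subtract {s} a c v))
    (solve 8 (λ p m v ab cb a c b → p :* (ab :- v :* cb) :- m :* ((a :- v :* c) :* b) := (p :* ab :- m :* (a :* b)) :- v :* (p :* cb :- m :* (c :* b)))
      ≡.refl (+ p) (+ m) v (a ·ℤ b) (c ·ℤ b) (sumℤ a) (sumℤ c) (sumℤ b))
    where open ℤ-Ring.Solver using (solve; _:=_; _:*_; _:-_)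

  form-right : ∀ a c b v → form b (λ k → a k ℤ.- v ℤ.* c k) ≡ form b a ℤ.- v ℤ.* form b c
  form-right a c b v = ≡.trans (form-sym b (λ k → a k ℤ.- v ℤ.* c k)) (≡.trans (form-left a c b v)
    (≡.cong₂ (λ x y → x ℤ.- v ℤ.* y) (form-sym a b) (form-sym c b)))

  open SublatticeBasis form form-left form-right public

  module _ (p≡1+ms : p ≡ suc (m ℕ.* s)) where
    private
      +p≡ : + p ≡ + 1 ℤ.+ + m ℤ.* + s
      +p≡ = ≡.trans (≡.cong (λ z → + z) p≡1+ms) (≡.cong (λ z → + 1 ℤ.+ z) (ℤ.pos-* m s))

    -- Because p = 1 + m s, the difference is m (s (a · a) - (Σ a)²). The form is thus positive
    -- definite, and its value bounds the coordinates.
    norm≤form : ∀ a → a ·ℤ a ℤ.≤ form a a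
    norm≤form a = ℤ.0≤i-j⇒j≤i (≡.subst (+ 0 ℤ.≤_) (≡.trans
      (solve 4 (λ m s A S → m :* (s :* A :- S :* S) := (con (+ 1) :+ m :* s) :* A :- m :* (S :* S) :- A) ≡.refl (+ m) (+ s) (a ·ℤ a) (sumℤ a))
      (≡.cong (λ z → z ℤ.* (a ·ℤ a) ℤ.- + m ℤ.* (sumℤ a ℤ.* sumℤ a) ℤ.- a ·ℤ a) (≡.sym +p≡)))
      (≡.subst (ℤ._≤ + m ℤ.* (+ s ℤ.* (a ·ℤ a) ℤ.- sumℤ a ℤ.* sumℤ a)) (ℤ.*-zeroʳ (+ m)) (ℤ.*-monoˡ-≤-nonNeg (+ m) (cauchy-schwarz s a))))
      where open ℤ-Ring.Solver using (solve; _:=_; _:*_; _:+_; _:-_; con)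

    private
      power : ∀ k → (+ p) ^ℤ k ≡ + (p ℕ.^ k)
      power zero    = ≡.refl
      power (suc k) = ≡.trans (≡.cong (+ p ℤ.*_) (power k)) (≡.sym (ℤ.pos-* p (p ℕ.^ k)))

      ones-× : ∀ n → n ℤ-LinearAlgebra.×ℕ + 1 ≡ + n
      ones-× zero    = ≡.refl
      ones-× (suc n) = ≡.cong (λ z → + 1 ℤ.+ z) (ones-× n)

      sum-δ : ∀ (i : Fin s) → sumℤ (ℤ-Ring.δ i) ≡ + 1
      sum-δ i = ≡.trans (ℤ-Ring.sum-cong-≋ {s} (λ j → ≡.sym (ℤ.*-identityʳ (ℤ-Ring.δ i j)))) (ℤ-Ring.sum-δˡ {s} (λ _ → + 1) i)

      gram-δ : ∀ (i k : Fin s) → form (ℤ-Ring.δ i) (ℤ-Ring.δ k) ≡ + p ℤ.* ℤ-Ring.δ i k ℤ.- + m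
      gram-δ i k = ≡.cong₂ (λ x y → + p ℤ.* x ℤ.- y)
        (≡.trans (ℤ-Ring.sum-δˡ {s} (ℤ-Ring.δ k) i) (ℤ-Ring.δ-sym k i))
        (≡.trans (≡.cong₂ (λ x y → + m ℤ.* (x ℤ.* y)) (sum-δ i) (sum-δ k)) (ℤ.*-identityʳ (+ m)))

      det-gram-δ : ∀ n → s ≡ suc n → detℤ {s} (λ i k → + p ℤ.* ℤ-Ring.δ i k ℤ.- + m) ≡ + (p ℕ.^ (s ℕ.∸ 1))
      -- The row sums of the Gram matrix are p - s m = 1, which is why one factor p is missing.
      det-gram-δ n ≡.refl = ≡.trans (ℤ-Determinant.det-scalar-minus-constant n (+ p) (+ m) (≡.trans
        (≡.cong₂ (λ x y → x ℤ.- y ℤ.* + m) +p≡ (ones-× (suc n)))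
        (ℤ-Ring.Solver.solve 2 (λ m s → (con (+ 1) :+ m :* s) :- s :* m := con (+ 1)) ≡.refl (+ m) (+ suc n)))) (power n)
        where open ℤ-Ring.Solver using (_:=_; _:*_; _:+_; _:-_; con)

    standard-basis : 0 ℕ.< s → LatticeBasis (λ _ → ⊤) (p ℕ.^ (s ℕ.∸ 1))
    standard-basis 0<s = record
      { basis        = ℤ-Ring.δ
      ; spans        = λ {a} _ → a , λ k → ≡.sym (ℤ-Ring.sum-δʳ {s} a k)
      ; contains     = λ _ _ → tt
      ; discriminant = ≡.trans (ℤ-Determinant.det-cong s gram-δ) (det-gram-δ (ℕ.pred s) (≡.sym (ℕ.suc-pred s {{ℕ.>-nonZero 0<s}})))
      }

  basis-resp : ∀ {Λ Λ′ D} → (∀ {a} → Λ a → Λ′ a) → (∀ {a} → Λ′ a → Λ a) → LatticeBasis Λ D → LatticeBasis Λ′ D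
  basis-resp to from L = record
    { basis        = basis
    ; spans        = λ a∈ → spans (from a∈)
    ; contains     = λ c a≡cb → to (contains c a≡cb)
    ; discriminant = discriminant
    }
    where open LatticeBasis L

-- The lattice of coordinate vectors: discriminant and least norm

module CoordinateLattice (N : ℕ) (p-prime : Prime (suc N)) (β : ℤ) (β-order : HasOrder (suc N) β N)
  (m s : ℕ) (N≡ms : N ≡ m ℕ.* s) (2∤s : ¬ (2 ∣ₙ s)) where
  private
    p = suc N
    h = (s ℕ.∸ 1) ℕ./ 2
  open IntegralTraceForm p m s

  α : ℤ
  α = β ℤ.^ m

  InLattice : Vector ℤ s → Set
  InLattice a = (∀ i → i ℕ.≤ h → a ·ℤ μ α i ≡ + 0 [mod p ]) × sumℤ a ≡ + 0 [mod 2 ]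

  private
    mod⇒∣ : ∀ n {a} → a ≡ + 0 [mod n ] → + n ∣ℤ a
    mod⇒∣ n a≡0 = Modular.≈0⇒∣ n (Modular.mod⇒≈ n a≡0)

    ∣⇒mod : ∀ n {a} → + n ∣ℤ a → a ≡ + 0 [mod n ]
    ∣⇒mod n n∣a = Modular.≈⇒mod n (Modular.∣⇒≈0 n n∣a)

    Below : ℕ → Vector ℤ s → Set
    Below k a = ∀ i → i ℕ.< k → + p ∣ℤ a ·ℤ μ α i

    0<s : 0 ℕ.< s
    0<s = ℕ.n≢0⇒n>0 λ s≡0 → 2∤s (≡.subst (2 ∣ₙ_) (≡.sym s≡0) (2 ℕ∣.∣0))

    D₀ : ℕ
    D₀ = p ℕ.^ (s ℕ.∸ 1)

    basis-below : ∀ k → ∃ λ D → 0 ℕ.< D × D ℕ.≤ (p ℕ.* p) ℕ.^ k ℕ.* D₀ × LatticeBasis (Below k) D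
    basis-below zero = D₀ , ℕ.m^n>0 p (s ℕ.∸ 1) , ℕ.≤-reflexive (≡.sym (ℕ.*-identityˡ D₀)) ,
      basis-resp (λ _ i ()) (λ _ → tt) (standard-basis (≡.cong suc N≡ms) 0<s)
    basis-below (suc k) = D′ , proj₁ (proj₂ step) (proj₁ (proj₂ (basis-below k))) ,
      ℕ.≤-trans (proj₁ (proj₂ (proj₂ step))) (ℕ.≤-trans (ℕ.*-monoʳ-≤ (p ℕ.* p) (proj₁ (proj₂ (proj₂ (basis-below k)))))
        (ℕ.≤-reflexive (≡.sym (ℕ.*-assoc (p ℕ.* p) ((p ℕ.* p) ℕ.^ k) D₀)))) ,
      basis-resp (λ {a} → extend {a}) (λ {a} a∈ → (λ i i<k → a∈ i (ℕ.m<n⇒m<1+n i<k)) , a∈ k (ℕ.n<1+n k)) (proj₂ (proj₂ (proj₂ step)))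
      where
      step = Step.sublattice-basis N p-prime (μ α k) (proj₂ (proj₂ (proj₂ (basis-below k))))
      D′ = proj₁ step
      extend : ∀ {a} → Below k a × + p ∣ℤ a ·ℤ μ α k → Below (suc k) a
      extend {a} (below , p∣) i i<1+k with ℕ.m≤n⇒m<n∨m≡n (ℕ.≤-pred i<1+k)
      ... | inj₁ i<k    = below i i<k
      ... | inj₂ ≡.refl = p∣

    μ₀ : ∀ a → a ·ℤ μ α 0 ≡ sumℤ a
    μ₀ a = ℤ-Ring.sum-cong-≋ {s} (λ k → ≡.trans (≡.cong (λ e → a k ℤ.* α ℤ.^ e) (ℕ.*-zeroʳ (toℕ k))) (ℤ.*-identityʳ (a k)))

    ones : Vector ℤ s
    ones _ = + 1

    ·-ones : ∀ a → a ·ℤ ones ≡ sumℤ a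
    ·-ones a = ℤ-Ring.sum-cong-≋ {s} (λ k → ℤ.*-identityʳ (a k))

    module Two = PrimeField 1 prime[2]
    module Two-Ring = CommutativeRing Two.ring
    module Two-Theory = RingTheory Two.ring

    square≋ : ∀ x → x ℤ.* x Two.≋ₙ x
    square≋ x = Two-Ring.trans (Two-Ring.*-cong (Two.≈-% x) (Two.≈-% x))
      (Two-Ring.trans (Two-Ring.reflexive (bit (x ℤ.%ℕ 2) (ℤ.n%ℕd<d x 2))) (Two-Ring.sym (Two.≈-% x)))
      where
      bit : ∀ r → r ℕ.< 2 → + r ℤ.* + r ≡ + r
      bit 0 _ = ≡.refl
      bit 1 _ = ≡.refl
      bit (suc (suc _)) (s≤s (s≤s ()))

    2∣a·a : ∀ a → + 2 ∣ℤ sumℤ a → + 2 ∣ℤ a ·ℤ a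
    2∣a·a a 2∣a = Two.≈0⇒∣ (Two-Ring.trans (Two-Theory.sum-cong-≋ {s} (λ k → square≋ (a k))) (Two.∣⇒≈0 2∣a))

    -- Both terms of p (a · a) - m (Σ a)² are multiples of p²: Parseval gives p ∣ a · a, and the
    -- condition at i = 0 is p ∣ Σ a.
    p²∣form : ∀ a → InLattice a → ∃ λ c → form a a ≡ c ℤ.* (+ p ℤ.* + p)
    p²∣form a (a∈ , _) = A′ ℤ.- + m ℤ.* (S′ ℤ.* S′) , ≡.trans
      (≡.cong₂ (λ x y → + p ℤ.* x ℤ.- + m ℤ.* (y ℤ.* y)) (ℤ∣._∣_.equality p∣A) (ℤ∣._∣_.equality p∣S))
      (solve 4 (λ p m A S → p :* (A :* p) :- m :* ((S :* p) :* (S :* p)) := (A :- m :* (S :* S)) :* (p :* p)) ≡.refl (+ p) (+ m) A′ S′)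
      where
      open ℤ-Ring.Solver using (solve; _:=_; _:*_; _:-_)
      p∣A : + p ∣ℤ a ·ℤ a
      p∣A = Parseval.p∣a·a N p-prime β β-order m s N≡ms 2∤s a a∈
      p∣S : + p ∣ℤ sumℤ a
      p∣S = ≡.subst (+ p ∣ℤ_) (μ₀ a) (mod⇒∣ p (a∈ 0 z≤n))
      A′ = ℤ∣._∣_.quotient p∣A
      S′ = ℤ∣._∣_.quotient p∣S

    -- Squares agree with their roots modulo 2, so a · a has the parity of Σ a.
    2∣form : ∀ a → InLattice a → + 2 ∣ℤ form a a
    2∣form a (_ , a-even) = ℤ∣.∣m∣n⇒∣m-n (ℤ∣.∣n⇒∣m*n (+ p) (2∣a·a a 2∣a)) (ℤ∣.∣n⇒∣m*n (+ m) (ℤ∣.∣n⇒∣m*n (sumℤ a) 2∣a))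
      where
      2∣a : + 2 ∣ℤ sumℤ a
      2∣a = mod⇒∣ 2 a-even

    positive-multiple : ∀ {M} k c → 0 ℕ.< M → + M ≡ c ℤ.* + k → k ℕ.≤ M
    positive-multiple {M} k c 0<M M≡ck = ℕ∣.∣⇒≤ {{ℕ.>-nonZero 0<M}} (∣⇒∣ᵤ {+ k} {+ M} (divides c M≡ck))

    p² : + p ℤ.* + p ≡ + (p ℕ.* p)
    p² = ≡.sym (ℤ.pos-* p p)

    p²≤form : ∀ a {M} → InLattice a → form a a ≡ + M → 0 ℕ.< M → p ℕ.* p ℕ.≤ M
    p²≤form a {M} a∈ Qa≡M 0<M = positive-multiple (p ℕ.* p) c 0<M (≡.trans (≡.sym Qa≡M) (≡.trans (proj₂ (p²∣form a a∈)) (≡.cong (c ℤ.*_) p²)))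
      where c = proj₁ (p²∣form a a∈)

    2p²≤form : p ≢ 2 → ∀ a {M} → InLattice a → form a a ≡ + M → 0 ℕ.< M → 2 ℕ.* (p ℕ.* p) ℕ.≤ M
    2p²≤form p≢2 a {M} a∈ Qa≡M 0<M = positive-multiple (2 ℕ.* (p ℕ.* p)) c′ 0<M (begin
      + M ≡⟨ Qa≡M ⟨
      form a a ≡⟨ proj₂ (p²∣form a a∈) ⟩
      c ℤ.* (+ p ℤ.* + p) ≡⟨ ≡.cong (ℤ._* (+ p ℤ.* + p)) (ℤ∣._∣_.equality 2∣c) ⟩
      c′ ℤ.* + 2 ℤ.* (+ p ℤ.* + p) ≡⟨ ℤ.*-assoc c′ (+ 2) (+ p ℤ.* + p) ⟩
      c′ ℤ.* (+ 2 ℤ.* (+ p ℤ.* + p)) ≡⟨ ≡.cong (λ z → c′ ℤ.* (+ 2 ℤ.* z)) p² ⟩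
      c′ ℤ.* (+ 2 ℤ.* + (p ℕ.* p)) ≡⟨ ≡.cong (c′ ℤ.*_) (≡.sym (ℤ.pos-* 2 (p ℕ.* p))) ⟩
      c′ ℤ.* + (2 ℕ.* (p ℕ.* p)) ∎)
      where
      open ≡-Reasoning
      c = proj₁ (p²∣form a a∈)
      p≉0 : ¬ (+ p Two.≋ₙ + 0)
      p≉0 p≈0 with prime⇒irreducible p-prime {2} (∣⇒∣ᵤ (Two.≈0⇒∣ p≈0))
      ... | inj₂ 2≡p = p≢2 (≡.sym 2≡p)
      c≈0 : c Two.≋ₙ + 0
      c≈0 = Two.x*y≈0⇒y≈0 {+ p} p≉0 (Two.x*y≈0⇒y≈0 {+ p} p≉0 (Two-Ring.trans
        (Two-Ring.reflexive (≡.trans (ℤ-Ring.Solver.solve 2 (λ p c → p :* (p :* c) := c :* (p :* p)) ≡.refl (+ p) c) (≡.sym (proj₂ (p²∣form a a∈)))))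
        (Two.∣⇒≈0 (2∣form a a∈))))
        where open ℤ-Ring.Solver using (_:=_; _:*_)
      2∣c : + 2 ∣ℤ c
      2∣c = Two.≈0⇒∣ c≈0
      c′ = ℤ∣._∣_.quotient 2∣c

    2h+1≡s : suc (h ℕ.+ h) ≡ s
    2h+1≡s = ≡.sym (≡.trans s≡1+2k (≡.cong suc (≡.trans (ℕ.*-comm k 2) (≡.trans (≡.cong (k ℕ.+_) (ℕ.+-identityʳ k)) (≡.cong₂ ℕ._+_ (≡.sym h≡k) (≡.sym h≡k))))))
      where
      k = proj₁ (odd⇒1+2* 2∤s)
      s≡1+2k = proj₂ (odd⇒1+2* 2∤s)
      h≡k : h ≡ k
      h≡k = ≡.trans (≡.cong (λ s → (s ℕ.∸ 1) ℕ./ 2) s≡1+2k) (m*n/n≡m k 2)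

    -- The h + 1 congruences contribute the exponent 2(h + 1) and the discriminant of 𝒪_𝕂
    -- contributes s - 1 = 2h; together this is 2s.
    index-bound : (p ℕ.* p) ℕ.^ suc h ℕ.* D₀ ≡ (p ℕ.* p) ℕ.^ s
    index-bound = begin
      (p ℕ.* p) ℕ.^ suc h ℕ.* p ℕ.^ (s ℕ.∸ 1) ≡⟨ ≡.cong (λ s → (p ℕ.* p) ℕ.^ suc h ℕ.* p ℕ.^ (s ℕ.∸ 1)) (≡.sym 2h+1≡s) ⟩
      (p ℕ.* p) ℕ.^ suc h ℕ.* p ℕ.^ (h ℕ.+ h) ≡⟨ ≡.cong ((p ℕ.* p) ℕ.^ suc h ℕ.*_) (≡.trans (ℕ.^-distribˡ-+-* p h h) (≡.sym (^-distrib-*ₙ h p p))) ⟩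
      (p ℕ.* p) ℕ.^ suc h ℕ.* (p ℕ.* p) ℕ.^ h ≡⟨ ℕ.^-distribˡ-+-* (p ℕ.* p) (suc h) h ⟨
      (p ℕ.* p) ℕ.^ (suc h ℕ.+ h) ≡⟨ ≡.cong ((p ℕ.* p) ℕ.^_) 2h+1≡s ⟩
      (p ℕ.* p) ℕ.^ s ∎
      where open ≡-Reasoning

    below⇒mod : ∀ {a} → Below (suc h) a → ∀ i → i ℕ.≤ h → a ·ℤ μ α i ≡ + 0 [mod p ]
    below⇒mod below i i≤h = ∣⇒mod p (below i (s≤s i≤h))

    mod⇒below : ∀ {a} → (∀ i → i ℕ.≤ h → a ·ℤ μ α i ≡ + 0 [mod p ]) → Below (suc h) a
    mod⇒below a∈ i i<1+h = mod⇒∣ p (a∈ i (ℕ.≤-pred i<1+h))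

    -- The density inequality squared and cleared of denominators, required for every nonzero value
    -- M of the form and so in particular for the least one.
    Bounded : ℕ → Set
    Bounded D = ∀ a {M} → InLattice a → form a a ≡ + M → 0 ℕ.< M → 2 ℕ.^ s ℕ.* D ℕ.≤ 4 ℕ.* M ℕ.^ s

  -- For p = 2 the parity condition repeats the condition at i = 0.
  lattice-basis : ∃ λ D → 0 ℕ.< D × (∀ a {M} → InLattice a → form a a ≡ + M → 0 ℕ.< M → 2 ℕ.^ s ℕ.* D ℕ.≤ 4 ℕ.* M ℕ.^ s) × LatticeBasis InLattice D
  lattice-basis = helper (p ℕ.≟ 2)
    where
    below = basis-below (suc h)
    D = proj₁ below
    0<D = proj₁ (proj₂ below)
    D≤ : D ℕ.≤ (p ℕ.* p) ℕ.^ s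
    D≤ = ℕ.≤-trans (proj₁ (proj₂ (proj₂ below))) (ℕ.≤-reflexive index-bound)
    L : LatticeBasis (Below (suc h)) D
    L = proj₂ (proj₂ (proj₂ below))
    step = Step.sublattice-basis 1 prime[2] ones L
    open ℕ.≤-Reasoning
    helper : Dec (p ≡ 2) → ∃ λ D → 0 ℕ.< D × Bounded D × LatticeBasis InLattice D
    helper (yes p≡2) = D , 0<D , bounded , basis-resp
      (λ {a} a∈ → below⇒mod {a} a∈ , ∣⇒mod 2 (≡.subst₂ (λ q x → + q ∣ℤ x) p≡2 (μ₀ a) (a∈ 0 (s≤s z≤n))))
      (λ {a} a∈ → mod⇒below {a} (proj₁ a∈)) L
      where
      s≡1 : s ≡ 1
      s≡1 = ℕ.m*n≡1⇒n≡1 m s (≡.trans (≡.sym N≡ms) (ℕ.suc-injective p≡2))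
      bounded : Bounded D
      bounded a {M} a∈ Qa≡M 0<M = begin
        -- Here s = 1, so 2ˢ is below 4 and the weaker bound M ≥ p² is enough.
        2 ℕ.^ s ℕ.* D ≤⟨ ℕ.*-monoʳ-≤ (2 ℕ.^ s) D≤ ⟩
        2 ℕ.^ s ℕ.* (p ℕ.* p) ℕ.^ s ≤⟨ ℕ.*-mono-≤ (ℕ.≤-trans (ℕ.≤-reflexive (≡.cong (2 ℕ.^_) s≡1)) (ℕ.m≤m+n 2 2)) (ℕ.^-monoˡ-≤ s (p²≤form a a∈ Qa≡M 0<M)) ⟩
        4 ℕ.* M ℕ.^ s ∎
    helper (no p≢2) = proj₁ step , proj₁ (proj₂ step) 0<D , bounded , basis-resp
      (λ {a} (a∈ , 2∣) → below⇒mod {a} a∈ , ∣⇒mod 2 (≡.subst (+ 2 ∣ℤ_) (·-ones a) 2∣))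
      (λ {a} (a∈ , even) → mod⇒below {a} a∈ , ≡.subst (+ 2 ∣ℤ_) (≡.sym (·-ones a)) (mod⇒∣ 2 even)) (proj₂ (proj₂ (proj₂ step)))
      where
      bounded : Bounded (proj₁ step)
      bounded a {M} a∈ Qa≡M 0<M = begin
        -- The parity congruence multiplies the discriminant by at most 2 * 2, which is the 4 on the
        -- right; the factor 2ˢ is absorbed by M ≥ 2p².
        2 ℕ.^ s ℕ.* proj₁ step ≤⟨ ℕ.*-monoʳ-≤ (2 ℕ.^ s) (proj₁ (proj₂ (proj₂ step))) ⟩
        2 ℕ.^ s ℕ.* (4 ℕ.* D) ≤⟨ ℕ.*-monoʳ-≤ (2 ℕ.^ s) (ℕ.*-monoʳ-≤ 4 D≤) ⟩
        2 ℕ.^ s ℕ.* (4 ℕ.* (p ℕ.* p) ℕ.^ s) ≡⟨ solve 3 (λ x y z → x :* (y :* z) := y :* (x :* z)) ≡.refl (2 ℕ.^ s) 4 ((p ℕ.* p) ℕ.^ s) ⟩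
        4 ℕ.* (2 ℕ.^ s ℕ.* (p ℕ.* p) ℕ.^ s) ≡⟨ ≡.cong (4 ℕ.*_) (^-distrib-*ₙ s 2 (p ℕ.* p)) ⟨
        4 ℕ.* (2 ℕ.* (p ℕ.* p)) ℕ.^ s ≤⟨ ℕ.*-monoʳ-≤ 4 (ℕ.^-monoˡ-≤ s (2p²≤form p≢2 a a∈ Qa≡M 0<M)) ⟩
        4 ℕ.* M ℕ.^ s ∎
        where open +-*-Solver

  private
    -- A nonzero vector satisfying every congruence modulo p and modulo 2, from which the search for
    -- a shortest vector starts.
    multiple : Vector ℤ s
    multiple _ = + (2 ℕ.* p)

    multiple∈ : InLattice multiple
    multiple∈ = (λ i _ → ∣⇒mod p (factor p (λ k → ℤ∣.∣m⇒∣m*n (μ α i k) (divides (+ 2) (ℤ.pos-* 2 p))))) ,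
      ∣⇒mod 2 (factor 2 {multiple} (λ _ → divides (+ p) (≡.trans (ℤ.pos-* 2 p) (ℤ.*-comm (+ 2) (+ p)))))
      where
      factor : ∀ q {f : Vector ℤ s} → (∀ k → + q ∣ℤ f k) → + q ∣ℤ sumℤ f
      factor q {f} q∣f = Modular.≈0⇒∣ q (RingTheory.sum-zero (Modular.ring q) {s} (λ k → Modular.∣⇒≈0 q (q∣f k)))

    in-lattice? : ∀ a → Dec (InLattice a)
    in-lattice? a = map′ (λ c i i≤h → ≡.subst (λ i → a ·ℤ μ α i ≡ + 0 [mod p ]) (Fin.toℕ-fromℕ< (s≤s i≤h)) (c (fromℕ< (s≤s i≤h))))
      (λ c i → c (toℕ i) (ℕ.≤-pred (Fin.toℕ<n i)))
      (Fin.all? {n = suc h} (λ i → p ℕ∣.∣? ℤ.∣ a ·ℤ μ α (toℕ i) ℤ.- + 0 ∣)) ×-dec (2 ℕ∣.∣? ℤ.∣ sumℤ a ℤ.- + 0 ∣)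

    in-lattice-resp : ∀ {a b} → a ≗ b → InLattice a → InLattice b
    in-lattice-resp {a} {b} a≗b (a∈ , even) =
      (λ i i≤h → ≡.subst (λ x → x ≡ + 0 [mod p ]) (ℤ-Ring.sum-cong-≋ {s} (λ k → ≡.cong (ℤ._* μ α i k) (a≗b k))) (a∈ i i≤h)) ,
      ≡.subst (λ x → x ≡ + 0 [mod 2 ]) (ℤ-Ring.sum-cong-≋ {s} a≗b) even

  shortest : ∃ λ a₀ → ∃ λ M → InLattice a₀ × ¬ IsZero a₀ × form a₀ a₀ ≡ + M × (∀ a → InLattice a → ¬ IsZero a → + M ℤ.≤ form a a)
  shortest = MinimalVector.minimal-vector InLattice in-lattice? in-lattice-resp (λ a → form a a) (λ a≗b → form-cong a≗b a≗b)
    (norm≤form (≡.cong suc N≡ms)) multiple multiple∈ (λ multiple≡0 → absurd (multiple≡0 (fromℕ< 0<s)))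
    where
    absurd : ¬ (+ (2 ℕ.* p) ≡ + 0)
    absurd ()

  form-positive : ∀ a {M} → ¬ IsZero a → form a a ≡ + M → 0 ℕ.< M
  form-positive a {zero}  a≢0 Qa≡0 = contradiction (norm≡0 a (ℤ.≤-trans (norm≤form (≡.cong suc N≡ms) a) (ℤ.≤-reflexive Qa≡0))) a≢0
  form-positive a {suc M} a≢0 _    = s≤s z≤n

-- Real embeddings and the center density

private
  rescale : ∀ n D X → 2 ℕ.^ n ℕ.* D ℕ.≤ 4 ℕ.* X → 4 ℕ.^ n ℕ.* D ℕ.≤ X ℕ.* 2 ℕ.^ (n ℕ.+ 2)
  rescale n D X bound = begin
    4 ℕ.^ n ℕ.* D ≡⟨ ≡.cong (ℕ._* D) (≡.trans (ℕ.^-*-assoc 2 2 n) (≡.trans (≡.cong (λ e → 2 ℕ.^ (n ℕ.+ e)) (ℕ.+-identityʳ n)) (ℕ.^-distribˡ-+-* 2 n n))) ⟩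
    2 ℕ.^ n ℕ.* 2 ℕ.^ n ℕ.* D ≡⟨ ℕ.*-assoc (2 ℕ.^ n) (2 ℕ.^ n) D ⟩
    2 ℕ.^ n ℕ.* (2 ℕ.^ n ℕ.* D) ≤⟨ ℕ.*-monoʳ-≤ (2 ℕ.^ n) bound ⟩
    2 ℕ.^ n ℕ.* (4 ℕ.* X) ≡⟨ solve 3 (λ x f y → x :* (f :* y) := y :* (x :* f)) ≡.refl (2 ℕ.^ n) 4 X ⟩
    X ℕ.* (2 ℕ.^ n ℕ.* 4) ≡⟨ ≡.cong (X ℕ.*_) (ℕ.^-distribˡ-+-* 2 n 2) ⟨
    X ℕ.* 2 ℕ.^ (n ℕ.+ 2) ∎
    where
    open ℕ.≤-Reasoning
    open +-*-Solver

-- Order and square roots in ℝ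

module RealOrder (ℝ : RealNumbers) where
  open RealNumbers ℝ
  open RealProperties ℝ
  open RingTheory commutativeRing
  open HeytingProperties (HeytingField.heytingCommutativeRing heytingField) using (x-0≈x; invertibleʳ⇒#)
  open IsStrictPartialOrder isStrictPartialOrder using (<-respˡ-≈; <-respʳ-≈; asym; irrefl) renaming (trans to <-trans)
  open SetoidReasoning (CommutativeRing.setoid commutativeRing)
  open Solver using (_:=_; _:+_; _:*_; _:-_; :-_; con)

  1≉0 : ¬ (1# ≈ 0#)
  1≉0 1≈0 = irrefl (sym 1≈0) 0<1

  <⇒0<- : ∀ {x y} → x < y → 0# < y - x
  <⇒0<- {x} x<y = <-respˡ-≈ (-‿inverseʳ x) (+-monoˡ-< (- x) x<y)

  0<-⇒< : ∀ {x y} → 0# < y - x → x < y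
  0<-⇒< {x} {y} 0<y-x = <-respˡ-≈ (+-identityˡ x) (<-respʳ-≈ (Solver.solve 2 (λ x y → y :- x :+ x := y) refl x y) (+-monoˡ-< x 0<y-x))

  +-pos : ∀ {x y} → 0# < x → 0# < y → 0# < x + y
  +-pos {x} {y} 0<x 0<y = <-trans 0<y (<-respˡ-≈ (+-identityˡ y) (+-monoˡ-< y 0<x))

  *-monoʳ-< : ∀ {x y z} → 0# < z → x < y → x * z < y * z
  *-monoʳ-< {x} {y} {z} 0<z x<y = 0<-⇒< (<-respʳ-≈ (Solver.solve 3 (λ x y z → (y :- x) :* z := y :* z :- x :* z) refl x y z)
    (*-pos (<⇒0<- x<y) 0<z))

  ^-pos : ∀ {x} → 0# < x → ∀ n → 0# < x ^ n
  ^-pos 0<x zero    = 0<1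
  ^-pos 0<x (suc n) = *-pos 0<x (^-pos 0<x n)

  nonneg∧#⇒pos : ∀ {x} → 0# ≤ x → x # 0# → 0# < x
  nonneg∧#⇒pos 0≤x x#0 with #⇒<⊎> x#0
  ... | inj₁ x<0 = contradiction x<0 0≤x
  ... | inj₂ 0<x = 0<x

  x*inverse≈1 : ∀ {x} (x#0 : x # 0#) → x * inverse x x#0 ≈ 1#
  x*inverse≈1 {x} x#0 = trans (*-congʳ (sym (x-0≈x x))) (proj₂ (proj₂ (#⇒invertible x#0)))

  inverse-pos : ∀ {x} (x#0 : x # 0#) → 0# < x → 0# < inverse x x#0
  inverse-pos {x} x#0 0<x with #⇒<⊎> z#0
    where
    z#0 : inverse x x#0 # 0#
    z#0 = invertibleʳ⇒#
      (x , trans (*-congʳ (x-0≈x _)) (trans (*-comm _ x) (x*inverse≈1 x#0)))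
  ... | inj₂ 0<z = 0<z
  ... | inj₁ z<0 = contradiction (<-respˡ-≈ (trans (*-comm _ x) (x*inverse≈1 x#0)) (<-respʳ-≈ (zeroˡ x) (*-monoʳ-< 0<x z<0))) (asym 0<1)

  -- `0# ≤ x` is a negation and the order has no decidable trichotomy. Cotransitivity of apartness
  -- locates first 0 against x < y and then -x against 0 < y, which yields strict positivity of y
  -- and of y + x.
  square-mono-< : ∀ {x y} → 0# ≤ x → x < y → x * x < y * y
  square-mono-< {x} {y} 0≤x x<y = 0<-⇒< (<-respʳ-≈
    (Solver.solve 2 (λ x y → (y :- x) :* (y :+ x) := y :* y :- x :* x) refl x y) (*-pos (<⇒0<- x<y) 0<y+x))
    where
    0<y : 0# < y
    0<y with #-cotrans (<⇒# x<y) 0#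
    ... | inj₁ x#0 = <-trans (nonneg∧#⇒pos 0≤x x#0) x<y
    ... | inj₂ 0#y with #⇒<⊎> 0#y
    ...   | inj₁ 0<y = 0<y
    ...   | inj₂ y<0 = contradiction (<-trans x<y y<0) 0≤x
    0<y+x : 0# < y + x
    0<y+x with #-cotrans (#-sym (<⇒# 0<y)) (- x)
    ... | inj₁ y#-x with #⇒<⊎> y#-x
    ...   | inj₁ y<-x = contradiction (0<-⇒< (<-respʳ-≈ (sym (+-identityˡ (- x))) (<-trans 0<y y<-x))) 0≤x
    ...   | inj₂ -x<y = <-respʳ-≈ (+-congˡ (-‿involutive x)) (<⇒0<- -x<y)
    0<y+x | inj₂ -x#0 with #⇒<⊎> -x#0
    ...   | inj₁ -x<0 = +-pos 0<y (<-respʳ-≈ (trans (+-identityˡ _) (-‿involutive x)) (<⇒0<- -x<0))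
    ...   | inj₂ 0<-x = contradiction (0<-⇒< (<-respʳ-≈ (sym (+-identityˡ (- x))) 0<-x)) 0≤x

  √-mono-≤ : ∀ {x y} → 0# ≤ x → 0# ≤ y → x ≤ y → √ x ≤ √ y
  √-mono-≤ {x} {y} 0≤x 0≤y x≤y √y<√x = x≤y (<-respˡ-≈ (√-square 0≤y) (<-respʳ-≈ (√-square 0≤x) (square-mono-< (√-nonneg y) √y<√x)))

  √-pos : ∀ {x} → 0# < x → 0# < √ x
  √-pos {x} 0<x = nonneg∧#⇒pos (√-nonneg x) (√-pos⇒#0 0<x)

  ×1-pos : ∀ n → 0# < suc n ×ℕ 1#
  ×1-pos zero    = <-respʳ-≈ (sym (+-identityʳ 1#)) 0<1
  ×1-pos (suc n) = +-pos 0<1 (×1-pos n)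

  fromℤ-mono-< : ∀ {a b} → a ℤ.< b → fromℤ a < fromℤ b
  fromℤ-mono-< {a} {b} a<b = 0<-⇒< (<-respʳ-≈ (fromℤ-sub b a) (positive (b ℤ.- a) (≡.subst (ℤ._< b ℤ.- a) (ℤ.+-inverseʳ a) (ℤ.+-monoˡ-< (ℤ.- a) a<b))))
    where
    positive : ∀ z → + 0 ℤ.< z → 0# < fromℤ z
    positive (+ suc n) _ = ×1-pos n
    positive (+ zero) (ℤ.+<+ ())

  fromℤ-mono-≤ : ∀ {a b} → a ℤ.≤ b → fromℤ a ≤ fromℤ b
  fromℤ-mono-≤ {a} {b} a≤b b<a with ℤ.≤-total b a | a ℤ.≟ b
  ... | _        | yes ≡.refl = irrefl refl b<a
  ... | inj₁ b≤a | no a≢b     = a≢b (ℤ.≤-antisym a≤b b≤a)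
  ... | inj₂ _   | no a≢b     = asym b<a (fromℤ-mono-< (ℤ.≤∧≢⇒< a≤b a≢b))

  fromℕ-* : ∀ m n → fromℤ (+ (m ℕ.* n)) ≈ fromℤ (+ m) * fromℤ (+ n)
  fromℕ-* = ×1-homo-*

  fromℕ-^ : ∀ m n → fromℤ (+ (m ℕ.^ n)) ≈ fromℤ (+ m) ^ n
  fromℕ-^ m zero    = fromℤ-1
  fromℕ-^ m (suc n) = trans (fromℕ-* m (m ℕ.^ n)) (*-congˡ (fromℕ-^ m n))

  0<2 : 0# < 2#
  0<2 = +-pos 0<1 0<1

  -- With 2ρ = √ M and vol = √ D the assertion 2^(-(n+2)/2) ≤ ρⁿ / vol is, after squaring, 2ⁿ D ≤ 4 Mⁿ.
  density-bound : ∀ n M D {ρ V d : Carrier} → 0 ℕ.< M → 2 ℕ.^ n ℕ.* D ℕ.≤ 4 ℕ.* M ℕ.^ n →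
    0# < d → d ≈ fromℤ (+ D) → V ≈ √ d → (V#0 : V # 0#) → 0# < ρ → (2# * ρ) * (2# * ρ) ≈ fromℤ (+ M) →
    1/2^½ (n ℕ.+ 2) ≤ ρ ^ n * inverse V V#0
  -- The goal is the negation of a strict inequality, so `small` assumes ρⁿ / V < 1 / W with W =
  -- 2^((n+2)/2). Multiplying by `V * W`, squaring and multiplying by 4ⁿ leads to a comparison of
  -- integers that contradicts `bound`.
  density-bound n M D {ρ} {V} {d} 0<M bound 0<d d≈D V≈√d V#0 0<ρ 4ρ²≈M small = fromℤ-mono-≤ (ℤ.+≤+ integers) reals
    where
    W : Carrier
    W = √ (2# ^ (n ℕ.+ 2))
    W#0 : W # 0#
    W#0 = √-pos⇒#0 (0<2^ (n ℕ.+ 2))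
    0<W : 0# < W
    0<W = √-pos (0<2^ (n ℕ.+ 2))
    0<V : 0# < V
    0<V = <-respʳ-≈ (sym V≈√d) (√-pos 0<d)
    R : Carrier
    R = ρ ^ n
    RW<V : R * W < V
    RW<V = <-respˡ-≈ (begin
      R * inverse V V#0 * (V * W) ≈⟨ Solver.solve 4 (λ R I V W → R :* I :* (V :* W) := V :* I :* (R :* W)) refl R (inverse V V#0) V W ⟩
      V * inverse V V#0 * (R * W) ≈⟨ trans (*-congʳ (x*inverse≈1 V#0)) (*-identityˡ (R * W)) ⟩
      R * W ∎)
      (<-respʳ-≈ (begin
      inverse W W#0 * (V * W) ≈⟨ Solver.solve 3 (λ I V W → I :* (V :* W) := W :* I :* V) refl (inverse W W#0) V W ⟩
      W * inverse W W#0 * V ≈⟨ trans (*-congʳ (x*inverse≈1 W#0)) (*-identityˡ V) ⟩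
      V ∎)
      (*-monoʳ-< (*-pos 0<V 0<W) small))
    squared : R * R * 2# ^ (n ℕ.+ 2) < fromℤ (+ D)
    squared = <-respˡ-≈ (begin
      R * W * (R * W) ≈⟨ Solver.solve 2 (λ R W → R :* W :* (R :* W) := R :* R :* (W :* W)) refl R W ⟩
      R * R * (W * W) ≈⟨ *-congˡ (√-square (asym (0<2^ (n ℕ.+ 2)))) ⟩
      R * R * 2# ^ (n ℕ.+ 2) ∎)
      (<-respʳ-≈ (begin
      V * V ≈⟨ *-cong V≈√d V≈√d ⟩
      √ d * √ d ≈⟨ √-square (asym 0<d) ⟩
      d ≈⟨ d≈D ⟩
      fromℤ (+ D) ∎)
      (square-mono-< (asym (*-pos (^-pos 0<ρ n) 0<W)) RW<V))
    2≈ : 2# ≈ fromℤ (+ 2)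
    2≈ = +-congˡ (sym (+-identityʳ 1#))
    4R² : (2# * 2#) ^ n * (R * R) ≈ fromℤ (+ M) ^ n
    4R² = begin
      (2# * 2#) ^ n * (ρ ^ n * ρ ^ n) ≈⟨ *-congˡ (^-distrib-* ρ ρ n) ⟨
      (2# * 2#) ^ n * (ρ * ρ) ^ n ≈⟨ ^-distrib-* (2# * 2#) (ρ * ρ) n ⟨
      (2# * 2# * (ρ * ρ)) ^ n ≈⟨ ^-congˡ n (trans (Solver.solve 2 (λ t r → t :* t :* (r :* r) := (t :* r) :* (t :* r)) refl 2# ρ) 4ρ²≈M) ⟩
      fromℤ (+ M) ^ n ∎
    reals : fromℤ (+ (M ℕ.^ n ℕ.* 2 ℕ.^ (n ℕ.+ 2))) < fromℤ (+ (4 ℕ.^ n ℕ.* D))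
    reals = <-respˡ-≈ (begin
      R * R * 2# ^ (n ℕ.+ 2) * (2# * 2#) ^ n ≈⟨ Solver.solve 3 (λ R t f → R :* t :* f := f :* R :* t) refl (R * R) (2# ^ (n ℕ.+ 2)) ((2# * 2#) ^ n) ⟩
      (2# * 2#) ^ n * (R * R) * 2# ^ (n ℕ.+ 2) ≈⟨ *-cong 4R² (^-congˡ (n ℕ.+ 2) 2≈) ⟩
      fromℤ (+ M) ^ n * fromℤ (+ 2) ^ (n ℕ.+ 2) ≈⟨ *-cong (fromℕ-^ M n) (fromℕ-^ 2 (n ℕ.+ 2)) ⟨
      fromℤ (+ (M ℕ.^ n)) * fromℤ (+ (2 ℕ.^ (n ℕ.+ 2))) ≈⟨ fromℕ-* (M ℕ.^ n) (2 ℕ.^ (n ℕ.+ 2)) ⟨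
      fromℤ (+ (M ℕ.^ n ℕ.* 2 ℕ.^ (n ℕ.+ 2))) ∎)
      (<-respʳ-≈ (begin
      fromℤ (+ D) * (2# * 2#) ^ n ≈⟨ *-comm _ _ ⟩
      (2# * 2#) ^ n * fromℤ (+ D) ≈⟨ *-congʳ (trans (^-congˡ n (trans (*-cong 2≈ 2≈) (sym (fromℕ-* 2 2)))) (sym (fromℕ-^ 4 n))) ⟩
      fromℤ (+ (4 ℕ.^ n)) * fromℤ (+ D) ≈⟨ fromℕ-* (4 ℕ.^ n) D ⟨
      fromℤ (+ (4 ℕ.^ n ℕ.* D)) ∎)
      (*-monoʳ-< (^-pos (*-pos 0<2 0<2) n) squared))
    integers : 4 ℕ.^ n ℕ.* D ℕ.≤ M ℕ.^ n ℕ.* 2 ℕ.^ (n ℕ.+ 2)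
    integers = rescale n D (M ℕ.^ n) bound

injective⇒surjective : ∀ {n} (f : Fin n → Fin n) → (∀ {i j} → f i ≡ f j → i ≡ j) → ∀ k → ∃ λ i → f i ≡ k
injective⇒surjective {suc n} f f-injective k with Fin.any? (λ i → f i Fin.≟ k)
... | yes found = found
... | no none   = contradiction (Fin.injective⇒≤ {f = λ i → punchOut (k≢f i)}
  (λ {i} {j} eq → f-injective (Fin.punchOut-injective (k≢f i) (k≢f j) eq))) (ℕ.<⇒≱ (ℕ.n<1+n n))
  where
  k≢f : ∀ i → k ≢ f i
  k≢f i k≡fi = none (i , ≡.sym k≡fi)

injective⇒permutation : ∀ {m n} → m ≡ n → (f : Fin m → Fin n) → (∀ {i j} → f i ≡ f j → i ≡ j) →
                        ∃ λ (π : Perm.Permutation m n) → ∀ i → π Perm.⟨$⟩ʳ i ≡ f i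
injective⇒permutation ≡.refl f f-injective = Perm.permutation f (λ k → proj₁ (preimage k)) (λ k → proj₂ (preimage k))
  (λ i → f-injective (proj₂ (preimage (f i)))) , λ _ → ≡.refl
  where preimage = injective⇒surjective f f-injective

-- All embeddings of 𝕂 are real

module TotallyReal (ℝ : RealNumbers) (K : FieldOverℚ) (s : ℕ) (2∤s : ¬ (2 ∣ₙ s))
  (θ : ∣ K ∣ᶠ → ∣ K ∣ᶠ) (θ-hom : IsFieldEmbedding K K θ) (t : ∣ K ∣ᶠ)
  (distinct : ∀ (i k : Fin s) → FieldOverℚ._≈_ K (iterate θ t (toℕ i)) (iterate θ t (toℕ k)) → i ≡ k)
  (embeddings : CanonicalEmbedding.Embeddings ℝ K s) where

  private
    module K = FieldOverℚ K
    module θ^ = IteratedEndomorphism K θ θ-hom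
  open RealNumbers ℝ
  open RealOrder ℝ using (1≉0)
  open RingTheory commutativeRing
  open Complex ℝ
  open CanonicalEmbedding ℝ K
  open Embeddings embeddings
  open SetoidReasoning (CommutativeRing.setoid commutativeRing)

  private
    module RealEmbedding (ψ : Embedding) (ψ-real : ∀ x → Embedding.im ψ x ≈ 0#) where
      open Embedding ψ
      private module hom = RingMorphisms.IsRingHomomorphism isRingHomomorphism

      re-isRingHomomorphism : RingMorphisms.IsRingHomomorphism K.rawRing (CommutativeRing.rawRing commutativeRing) re
      re-isRingHomomorphism = record
        { isSemiringHomomorphism = record
          { isNearSemiringHomomorphism = record
            { +-isMonoidHomomorphism = record
              { isMagmaHomomorphism = record
                { isRelHomomorphism = record { cong = λ x≈y → proj₁ (hom.⟦⟧-cong x≈y) }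
                ; homo = λ x y → proj₁ (hom.+-homo x y)
                }
              ; ε-homo = proj₁ hom.0#-homo
              }
            ; *-homo = λ x y → trans (proj₁ (hom.*-homo x y))
                (trans (+-congˡ (trans (-‿cong (trans (*-congʳ (ψ-real x)) (zeroˡ _))) -0#≈0#)) (+-identityʳ _))
            }
          ; 1#-homo = proj₁ hom.1#-homo
          }
        ; -‿homo = λ x → proj₁ (hom.-‿homo x)
        }

    0<r₁ : 0 ℕ.< r₁
    0<r₁ = ℕ.n≢0⇒n>0 λ r₁≡0 → 2∤s (ℕ∣.divides r₂ (≡.trans s≡r₁+2r₂ (≡.trans (≡.cong (ℕ._+ 2 ℕ.* r₂) r₁≡0) (ℕ.*-comm 2 r₂))))

    ψ₀ : Embedding
    ψ₀ = realσ (fromℕ< 0<r₁)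

    ψ₀-real : ∀ x → Embedding.im ψ₀ x ≈ 0#
    ψ₀-real = real (fromℕ< 0<r₁)

  φ : K.Carrier → Carrier
  φ = Embedding.re ψ₀

  module φ = FieldEmbedding K commutativeRing 1≉0 φ (RealEmbedding.re-isRingHomomorphism ψ₀ ψ₀-real)

  private
    twist : ℕ → Embedding
    twist n = record
      { map                = λ x → Embedding.map ψ₀ (iterate θ x n)
      ; isRingHomomorphism = Composition.isRingHomomorphism
          (λ (a , b) (c , d) → trans a c , trans b d) (θ^.iterate-isRingHomomorphism n) (Embedding.isRingHomomorphism ψ₀)
      }

    -- The composite of a real embedding with a power of `θ` has imaginary part 0 everywhere, while
    -- each listed complex embedding and its conjugate have a nonzero imaginary part somewhere.
    twist-real : ∀ n → ∃ λ k → twist n ≗ᴱ realσ k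
    twist-real n with exhaustive (twist n)
    ... | inj₁ found = found
    ... | inj₂ (k , inj₁ same) = contradiction (proj₂ (nonreal k))
      (#-irrefl (trans (sym (proj₂ (same x))) (ψ₀-real (iterate θ x n))))
      where x = proj₁ (nonreal k)
    ... | inj₂ (k , inj₂ conjugate) = contradiction (proj₂ (nonreal k))
      (#-irrefl (trans (sym (-‿involutive _)) (trans (-‿cong (trans (sym (proj₂ (conjugate x))) (ψ₀-real (iterate θ x n)))) -0#≈0#)))
      where x = proj₁ (nonreal k)

    index : Fin s → Fin r₁
    index i = proj₁ (twist-real (toℕ i))

    index-injective : ∀ {i k} → index i ≡ index k → i ≡ k
    index-injective {i} {k} eq = distinct i k (φ.injective (trans (proj₁ (proj₂ (twist-real (toℕ i)) t))
      (trans (reflexive (≡.cong (λ e → Embedding.re (realσ e) t) eq)) (sym (proj₁ (proj₂ (twist-real (toℕ k)) t))))))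

    -- The s twists of one real embedding are real and already take different values at `t`.
    -- Together with s = r₁ + 2 r₂ this leaves no complex pair.
    s≤r₁ : s ℕ.≤ r₁
    s≤r₁ = Fin.injective⇒≤ index-injective

    r₂≡0 : r₂ ≡ 0
    r₂≡0 = ℕ.n≤0⇒n≡0 (ℕ.≤-trans (ℕ.m≤m+n r₂ (r₂ ℕ.+ 0)) (ℕ.+-cancelˡ-≤ r₁ _ _
      (ℕ.≤-trans (ℕ.≤-reflexive (≡.sym s≡r₁+2r₂)) (ℕ.≤-trans s≤r₁ (ℕ.≤-reflexive (≡.sym (ℕ.+-identityʳ r₁)))))))

    s≡r₁ : s ≡ r₁
    s≡r₁ = ≡.trans s≡r₁+2r₂ (≡.trans (≡.cong (λ r → r₁ ℕ.+ 2 ℕ.* r) r₂≡0) (ℕ.+-identityʳ r₁))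

    absurd : ∀ {r} → r ≡ 0 → ¬ Fin (r ℕ.* 2)
    absurd ≡.refl ()

    ++-· : ∀ {m n} (f f′ : Vector Carrier m) (g g′ : Vector Carrier n) → n ≡ 0 → (f ++ g) · (f′ ++ g′) ≈ f · f′
    ++-· {zero}  f f′ g g′ ≡.refl = refl
    ++-· {suc m} f f′ g g′ n≡0 = +-congˡ (trans (reflexive (sum-cong-≗ {m ℕ.+ _} (λ i → ≡.cong₂ _*_ (shift f g i) (shift f′ g′ i)))) (++-· (f ∘ suc) (f′ ∘ suc) g g′ n≡0))
      where
      shift : ∀ {m n} (f : Vector Carrier (suc m)) (g : Vector Carrier n) i → (f ++ g) (suc i) ≡ ((f ∘ suc) ++ g) i
      shift {m} f g i with splitAt m i
      ... | inj₁ _ = ≡.refl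
      ... | inj₂ _ = ≡.refl

  dim≡s : dim ≡ s
  dim≡s = ≡.trans (≡.cong (λ r → r₁ ℕ.+ r ℕ.* 2) r₂≡0) (≡.trans (ℕ.+-identityʳ r₁) (≡.sym s≡r₁))

  component : Fin dim → K.Carrier → Carrier
  component k x = canonical x k

  component-isRingHomomorphism : ∀ k → RingMorphisms.IsRingHomomorphism K.rawRing (CommutativeRing.rawRing commutativeRing) (component k)
  component-isRingHomomorphism k with splitAt r₁ k
  ... | inj₁ i = RealEmbedding.re-isRingHomomorphism (realσ i) (real i)
  ... | inj₂ i = contradiction i (absurd r₂≡0)

  -- The real embeddings are, up to a permutation, the twists φ ∘ θⁱ. So the inner product of two
  -- images is Σ φ(θⁱ(x y)), the trace of x y.
  canonical-· : ∀ x y → canonical x · canonical y ≈ φ (K.sum {s} (λ i → iterate θ (x K.* y) (toℕ i)))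
  canonical-· x y = begin
    canonical x · canonical y ≈⟨ ++-· (λ k → ρ k x) (λ k → ρ k y) (τ x) (τ y) (≡.cong (ℕ._* 2) r₂≡0) ⟩
    sum {r₁} (λ k → ρ k x * ρ k y) ≈⟨ sum-cong-≋ {r₁} (λ k → sym (RingMorphisms.IsRingHomomorphism.*-homo (RealEmbedding.re-isRingHomomorphism (realσ k) (real k)) x y)) ⟩
    sum {r₁} (λ k → ρ k (x K.* y)) ≈⟨ sum-permute {s} {r₁} (λ k → ρ k (x K.* y)) (proj₁ π) ⟩
    sum {s} (λ i → ρ (proj₁ π Perm.⟨$⟩ʳ i) (x K.* y)) ≈⟨ sum-cong-≋ {s} (λ i → trans (reflexive (≡.cong (λ k → ρ k (x K.* y)) (proj₂ π i))) (sym (proj₁ (proj₂ (twist-real (toℕ i)) (x K.* y))))) ⟩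
    sum {s} (λ i → φ (iterate θ (x K.* y) (toℕ i))) ≈⟨ φ.sum-homo {s} (λ i → iterate θ (x K.* y) (toℕ i)) ⟨
    φ (K.sum {s} (λ i → iterate θ (x K.* y) (toℕ i))) ∎
    where
    ρ : Fin r₁ → K.Carrier → Carrier
    ρ k = Embedding.re (realσ k)
    τ : K.Carrier → Vector Carrier (r₂ ℕ.* 2)
    τ x = concat (λ k → Embedding.re (complexσ k) x ∷ Embedding.im (complexσ k) x ∷ [])
    π = injective⇒permutation s≡r₁ index index-injective

-- Elements of 𝕂 from integer coordinates

module Coordinates (K : FieldOverℚ) (θ : ∣ K ∣ᶠ → ∣ K ∣ᶠ) (θ-hom : IsFieldEmbedding K K θ) (t : ∣ K ∣ᶠ) (p m s : ℕ)
  (trace-form : ∀ (k l : Fin s) → FieldOverℚ._≈_ K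
    (FieldOverℚ.sum K {s} (λ i → iterate θ (FieldOverℚ._*_ K (iterate θ t (toℕ k)) (iterate θ t (toℕ l))) (toℕ i)))
    (FieldOverℚ._-_ K (FieldOverℚ._*_ K (FieldOverℚ.fromℤ K (+ p)) (RingTheory.δ (FieldOverℚ.commutativeRing K) k l)) (FieldOverℚ.fromℤ K (+ m))))
  (p≡1+ms : p ≡ suc (m ℕ.* s)) where

  open FieldOverℚ K
  open RingTheory commutativeRing
  open FieldTheory K
  open IteratedEndomorphism K θ θ-hom
  open IntegralTraceForm p m s using (form; norm≤form)
  open SetoidReasoning (CommutativeRing.setoid commutativeRing)

  private
    τ : Fin s → Carrier
    τ i = iterate θ t (toℕ i)

  element : Vector ℤ s → Carrier
  element a = sum {s} (λ i → fromℤ (a i) * τ i)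

  trace : Carrier → Carrier
  trace x = sum {s} (λ i → iterate θ x (toℕ i))

  trace-cong : ∀ {x y} → x ≈ y → trace x ≈ trace y
  trace-cong x≈y = sum-cong-≋ {s} (λ i → Iterate.⟦⟧-cong (toℕ i) x≈y)

  private
    trace-sum : ∀ {n} (v : Vector Carrier n) → trace (sum v) ≈ sum (λ i → trace (v i))
    trace-sum {n} v = trans (sum-cong-≋ {s} (λ i → Iterate.sum-homo (toℕ i) v)) (∑-comm {s} {n} (λ i k → iterate θ (v k) (toℕ i)))

    trace-scale : ∀ z x → trace (fromℤ z * x) ≈ fromℤ z * trace x
    trace-scale z x = trans (sum-cong-≋ {s} (λ i → trans (Iterate.*-homo (toℕ i) (fromℤ z) x) (*-congʳ (Iterate.fromℤ-homo (toℕ i) z))))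
      (sym (*-distribˡ-sum {s} (fromℤ z) (λ i → iterate θ x (toℕ i))))

  trace-element-* : ∀ a b → trace (element a * element b) ≈ fromℤ (form a b)
  trace-element-* a b = begin
    trace (element a * element b)
      ≈⟨ trace-cong (trans (*-distribʳ-sum {s} (element b) (λ k → A k * τ k)) (sum-cong-≋ {s} (λ k → trans (*-assoc (A k) (τ k) (element b)) (*-congˡ (trans
           (*-distribˡ-sum {s} (τ k) (λ l → B l * τ l)) (sum-cong-≋ {s} (λ l → Solver.solve 3 (λ t b u → t :* (b :* u) := b :* (t :* u)) refl (τ k) (B l) (τ l)))))))) ⟩
    trace (sum {s} (λ k → A k * sum {s} (λ l → B l * (τ k * τ l))))
      ≈⟨ trans (trace-sum {s} (λ k → A k * sum {s} (λ l → B l * (τ k * τ l)))) (sum-cong-≋ {s} (λ k → trans (trace-scale (a k) (sum {s} (λ l → B l * (τ k * τ l)))) (*-congˡ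
           (trans (trace-sum {s} (λ l → B l * (τ k * τ l))) (sum-cong-≋ {s} (λ l → trans (trace-scale (b l) (τ k * τ l)) (*-congˡ (trace-form k l)))))))) ⟩
    sum {s} (λ k → A k * sum {s} (λ l → B l * (P * δ k l - M)))
      ≈⟨ sum-cong-≋ {s} (λ k → trans (*-congˡ (inner k)) (Solver.solve 5 (λ a P b M S → a :* (P :* b :- M :* S) := P :* (a :* b) :- M :* S :* a) refl (A k) P (B k) M (sum {s} B))) ⟩
    sum {s} (λ k → P * (A k * B k) - M * sum {s} B * A k)
      ≈⟨ trans (sum-sub {s} (λ k → P * (A k * B k)) (λ k → M * sum {s} B * A k)) (+-cong (sym (*-distribˡ-sum {s} P (λ k → A k * B k))) (-‿cong (sym (*-distribˡ-sum {s} (M * sum {s} B) A)))) ⟩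
    P * sum {s} (λ k → A k * B k) - M * sum {s} B * sum {s} A
      ≈⟨ +-cong (*-congˡ (trans (sum-cong-≋ {s} (λ k → sym (fromℤ-* (a k) (b k)))) (sym (fromℤ-sum {s} (λ k → a k ℤ.* b k)))))
                (-‿cong (trans (Solver.solve 3 (λ M S T → M :* S :* T := M :* (T :* S)) refl M (sum {s} B) (sum {s} A))
                  (*-congˡ (trans (*-cong (sym (fromℤ-sum {s} a)) (sym (fromℤ-sum {s} b))) (sym (fromℤ-* (sumℤ a) (sumℤ b))))))) ⟩
    P * fromℤ (a ·ℤ b) - M * fromℤ (sumℤ a ℤ.* sumℤ b)
      ≈⟨ +-cong (sym (fromℤ-* (+ p) (a ·ℤ b))) (-‿cong (sym (fromℤ-* (+ m) (sumℤ a ℤ.* sumℤ b)))) ⟩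
    fromℤ (+ p ℤ.* (a ·ℤ b)) - fromℤ (+ m ℤ.* (sumℤ a ℤ.* sumℤ b))
      ≈⟨ fromℤ-sub (+ p ℤ.* (a ·ℤ b)) (+ m ℤ.* (sumℤ a ℤ.* sumℤ b)) ⟨
    fromℤ (form a b) ∎
    where
    open Solver using (_:=_; _:*_; _:-_)
    A B : Fin s → Carrier
    A k = fromℤ (a k)
    B k = fromℤ (b k)
    P M : Carrier
    P = fromℤ (+ p)
    M = fromℤ (+ m)
    inner : ∀ k → sum {s} (λ l → B l * (P * δ k l - M)) ≈ P * B k - M * sum {s} B
    inner k = begin
      sum {s} (λ l → B l * (P * δ k l - M)) ≈⟨ sum-cong-≋ {s} (λ l → Solver.solve 4 (λ b P d M → b :* (P :* d :- M) := d :* (P :* b) :- M :* b) refl (B l) P (δ k l) M) ⟩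
      sum {s} (λ l → δ k l * (P * B l) - M * B l) ≈⟨ sum-sub {s} (λ l → δ k l * (P * B l)) (λ l → M * B l) ⟩
      sum {s} (λ l → δ k l * (P * B l)) - sum {s} (λ l → M * B l) ≈⟨ +-cong (sum-δˡ {s} (λ l → P * B l) k) (-‿cong (sym (*-distribˡ-sum {s} M B))) ⟩
      P * B k - M * sum {s} B ∎

  -- If τᵢ = τₖ with i ≠ k, then τᵢ² and τᵢ τₖ have the same trace; but these traces are p - m and
  -- -m.
  conjugates-distinct : ∀ (i k : Fin s) → τ i ≈ τ k → i ≡ k
  conjugates-distinct i k τᵢ≈τₖ = helper (i Fin.≟ k)
    where
    equal : fromℤ (+ p) * δ i i - fromℤ (+ m) ≈ fromℤ (+ p) * δ i k - fromℤ (+ m)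
    equal = trans (sym (trace-form i i)) (trans (trace-cong (*-congˡ τᵢ≈τₖ)) (trace-form i k))
    helper : Dec (i ≡ k) → i ≡ k
    helper (yes i≡k) = i≡k
    helper (no i≢k)  = contradiction (begin
      fromℤ (+ p) ≈⟨ *-identityʳ _ ⟨
      fromℤ (+ p) * 1# ≈⟨ *-congˡ (δ-diag i) ⟨
      fromℤ (+ p) * δ i i ≈⟨ +-cancelʳ (- fromℤ (+ m)) (fromℤ (+ p) * δ i i) (fromℤ (+ p) * δ i k) equal ⟩
      fromℤ (+ p) * δ i k ≈⟨ trans (*-congˡ (δ-off i≢k)) (zeroʳ _) ⟩
      0# ∎) (fromℤ-nonzero {+ p} (λ p≡0 → ℕ.1+n≢0 (≡.trans (≡.sym p≡1+ms) (ℤ.+-injective p≡0))))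

  -- The trace of the square of the element is the value of a positive definite form at `a`. This
  -- gives uniqueness of coordinates.
  element≈0 : ∀ a → element a ≈ 0# → IsZero a
  element≈0 a a≈0 = norm≡0 a (ℤ.≤-trans (norm≤form p≡1+ms a) (ℤ.≤-reflexive (fromℤ-injective {form a a} {+ 0} (begin
    fromℤ (form a a) ≈⟨ trace-element-* a a ⟨
    trace (element a * element a) ≈⟨ trace-cong (trans (*-congʳ a≈0) (zeroˡ _)) ⟩
    trace 0# ≈⟨ sum-zero {s} (λ i → Iterate.0#-homo (toℕ i)) ⟩
    0# ∎))))

  element-cong : ∀ {a b} → a ≗ b → element a ≈ element b
  element-cong a≗b = sum-cong-≋ {s} (λ i → *-congʳ (reflexive (≡.cong fromℤ (a≗b i))))

  element-injective : ∀ a b → element a ≈ element b → a ≗ b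
  element-injective a b a≈b k = ℤ.i-j≡0⇒i≡j (a k) (b k) (element≈0 (λ i → a i ℤ.- b i) (begin
    sum {s} (λ i → fromℤ (a i ℤ.- b i) * τ i) ≈⟨ sum-cong-≋ {s} (λ i → trans (*-congʳ (fromℤ-sub (a i) (b i))) (Solver.solve 3 (λ a b t → (a :- b) :* t := a :* t :- b :* t) refl (fromℤ (a i)) (fromℤ (b i)) (τ i))) ⟩
    sum {s} (λ i → fromℤ (a i) * τ i - fromℤ (b i) * τ i) ≈⟨ sum-sub {s} (λ i → fromℤ (a i) * τ i) (λ i → fromℤ (b i) * τ i) ⟩
    element a - element b ≈⟨ x≈y⇒x-y≈0 a≈b ⟩
    0# ∎) k)
    where open Solver using (_:=_; _:*_; _:-_)

  element-linComb : ∀ {n} (e : Vector ℤ n) (B : Vector (Vector ℤ s) n) → element (linCombℤ e B) ≈ sum {n} (λ i → fromℤ (e i) * element (B i))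
  element-linComb {n} e B = begin
    sum {s} (λ k → fromℤ (linCombℤ e B k) * τ k) ≈⟨ sum-cong-≋ {s} (λ k → *-congʳ (trans (fromℤ-sum {n} (λ i → e i ℤ.* B i k)) (sum-cong-≋ {n} (λ i → fromℤ-* (e i) (B i k))))) ⟩
    sum {s} (λ k → sum {n} (λ i → fromℤ (e i) * fromℤ (B i k)) * τ k) ≈⟨ sum-cong-≋ {s} (λ k → *-distribʳ-sum {n} (τ k) (λ i → fromℤ (e i) * fromℤ (B i k))) ⟩
    sum {s} (λ k → sum {n} (λ i → fromℤ (e i) * fromℤ (B i k) * τ k)) ≈⟨ ∑-comm {s} {n} (λ k i → fromℤ (e i) * fromℤ (B i k) * τ k) ⟩
    sum {n} (λ i → sum {s} (λ k → fromℤ (e i) * fromℤ (B i k) * τ k)) ≈⟨ sum-cong-≋ {n} (λ i → trans (sum-cong-≋ {s} (λ k → *-assoc (fromℤ (e i)) (fromℤ (B i k)) (τ k))) (sym (*-distribˡ-sum {s} (fromℤ (e i)) (λ k → fromℤ (B i k) * τ k)))) ⟩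
    sum {n} (λ i → fromℤ (e i) * element (B i)) ∎

-- The lattice in ℝˢ and its center density

module CenterDensity (ℝ : RealNumbers) (K : FieldOverℚ) (θ : ∣ K ∣ᶠ → ∣ K ∣ᶠ) (θ-hom : IsFieldEmbedding K K θ) (t : ∣ K ∣ᶠ)
  (N : ℕ) (p-prime : Prime (suc N)) (β : ℤ) (β-order : HasOrder (suc N) β N)
  (m s : ℕ) (N≡ms : N ≡ m ℕ.* s) (2∤s : ¬ (2 ∣ₙ s))
  (trace-form : ∀ (k l : Fin s) → FieldOverℚ._≈_ K
    (FieldOverℚ.sum K {s} (λ i → iterate θ (FieldOverℚ._*_ K (iterate θ t (toℕ k)) (iterate θ t (toℕ l))) (toℕ i)))
    (FieldOverℚ._-_ K (FieldOverℚ._*_ K (FieldOverℚ.fromℤ K (+ suc N)) (RingTheory.δ (FieldOverℚ.commutativeRing K) k l)) (FieldOverℚ.fromℤ K (+ m))))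
  (integral : ∀ (a : Vector ℤ s) {x} → Modules.HasCoordinates K θ t (suc N) s (β ℤ.^ m) x a → IsAlgebraicInteger K x) where

  private
    p = suc N
    module K = FieldOverℚ K
  open RealNumbers ℝ
  open RealOrder ℝ
  open RealProperties ℝ using (2#; 1/2^½_; √-pos⇒#0)
  open Lattices ℝ
  open RingTheory commutativeRing
  open Determinant commutativeRing
  open CanonicalEmbedding ℝ K using (image; Embeddings)
  open Coordinates K θ θ-hom t p m s trace-form (≡.cong suc N≡ms)
  open CoordinateLattice N p-prime β β-order m s N≡ms 2∤s
  open IntegralTraceForm p m s using (form; LatticeBasis)
  open Modules K θ t p s (β ℤ.^ m) using (𝓜̃)
  open IsStrictPartialOrder isStrictPartialOrder using (<-respʳ-≈; asym)
  open SetoidReasoning (CommutativeRing.setoid commutativeRing)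

  module _ (c : K.Carrier → Vector Carrier s)
    (c-hom : ∀ k → RingMorphisms.IsRingHomomorphism K.rawRing (CommutativeRing.rawRing commutativeRing) (λ x → c x k))
    (c-· : ∀ a b → c (element a) · c (element b) ≈ fromℤ (form a b)) where
    private
      module c (k : Fin s) = RingHomomorphism K.commutativeRing commutativeRing (λ x → c x k) (c-hom k)

      Λ : Vector Carrier s → Set
      Λ = image c 𝓜̃

      D : ℕ
      D = proj₁ lattice-basis

      0<D : 0 ℕ.< D
      0<D = proj₁ (proj₂ lattice-basis)

      D-bound = proj₁ (proj₂ (proj₂ lattice-basis))

      L : LatticeBasis InLattice D
      L = proj₂ (proj₂ (proj₂ lattice-basis))

      module L = LatticeBasis L

      b : Vector (Vector Carrier s) s
      b i = c (element (L.basis i))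

      c-linComb : ∀ e → c (element (linCombℤ e L.basis)) ≋ linComb (fromℤ ∘ e) b
      c-linComb e k = trans (c.⟦⟧-cong k (element-linComb {s} e L.basis)) (trans (c.sum-homo k {s} (λ i → K.fromℤ (e i) K.* element (L.basis i)))
        (sum-cong-≋ {s} (λ i → trans (c.*-homo k (K.fromℤ (e i)) (element (L.basis i))) (*-congʳ (c.fromℤ-homo k (e i))))))

      -- The congruences modulo p and the parity condition come with two separate coordinate vectors
      -- of x. They agree by uniqueness of coordinates, so the parity passes from one to the other.
      in-lattice : ∀ {x} → 𝓜̃ x → ∃ λ a → InLattice a × x K.≈ element a
      in-lattice ((_ , a , x≈a , a∈𝓜) , a′ , x≈a′ , even) = a , (a∈𝓜 ,
        ≡.subst (λ z → z ≡ + 0 [mod 2 ]) (ℤ-Ring.sum-cong-≋ {s} (element-injective a′ a (K.trans (K.sym x≈a′) x≈a))) even) , x≈a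

      lattice∈𝓜̃ : ∀ a → InLattice a → 𝓜̃ (element a)
      lattice∈𝓜̃ a (a∈𝓜 , even) = (integral a K.refl , a , K.refl , a∈𝓜) , a , K.refl , even

      image-coordinates : ∀ {v} → Λ v → ∃ λ a → InLattice a × v ≋ c (element a)
      image-coordinates (x , x∈ , v≋cx) = proj₁ coordinates , proj₁ (proj₂ coordinates) ,
        λ k → trans (v≋cx k) (c.⟦⟧-cong k (proj₂ (proj₂ coordinates)))
        where coordinates = in-lattice x∈

      gram≈ : ∀ i k → gram b i k ≈ fromℤ (form (L.basis i) (L.basis k))
      gram≈ i k = c-· (L.basis i) (L.basis k)

      det-gram : det (gram b) ≈ fromℤ (+ D)
      det-gram = trans (det-cong s gram≈) (trans (sym (det-fromℤ s (λ i k → form (L.basis i) (L.basis k)))) (reflexive (≡.cong fromℤ L.discriminant)))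

      0<det : 0# < det (gram b)
      0<det = <-respʳ-≈ (sym det-gram) (fromℤ-mono-< {+ 0} {+ D} (ℤ.+<+ 0<D))

      -- A relation among the vectors is also a relation among the rows of their Gram matrix, whose
      -- determinant D is invertible in ℝ.
      independent : ∀ r → linComb r b ≋ 𝟎 → r ≋ 𝟎
      independent r rb≈0 i = begin
        r i ≈⟨ *-identityʳ (r i) ⟨
        r i * 1# ≈⟨ *-congˡ (x*inverse≈1 det#0) ⟨
        r i * (det (gram b) * inverse _ det#0) ≈⟨ *-assoc (r i) (det (gram b)) (inverse _ det#0) ⟨
        r i * det (gram b) * inverse _ det#0 ≈⟨ *-congʳ (cramer s (gram b) r combination i) ⟩
        0# * inverse _ det#0 ≈⟨ zeroˡ _ ⟩
        0# ∎
        where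
        det#0 : det (gram b) # 0#
        det#0 = #-sym (<⇒# 0<det)
        combination : linComb r (gram b) ≋ 𝟎
        combination k = begin
          sum {s} (λ i → r i * (b i · b k)) ≈⟨ sum-cong-≋ {s} (λ i → trans (*-distribˡ-sum {s} (r i) (λ l → b i l * b k l)) (sum-cong-≋ {s} (λ l → sym (*-assoc (r i) (b i l) (b k l))))) ⟩
          sum {s} (λ i → sum {s} (λ l → r i * b i l * b k l)) ≈⟨ ∑-comm {s} {s} (λ i l → r i * b i l * b k l) ⟩
          sum {s} (λ l → sum {s} (λ i → r i * b i l * b k l)) ≈⟨ sum-cong-≋ {s} (λ l → *-distribʳ-sum {s} (b k l) (λ i → r i * b i l)) ⟨
          sum {s} (λ l → linComb r b l * b k l) ≈⟨ sum-zero {s} (λ l → trans (*-congʳ (rb≈0 l)) (zeroˡ (b k l))) ⟩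
          0# ∎

      image⇒combination : ∀ {v} → Λ v → ∃ λ e → v ≋ linComb (fromℤ ∘ e) b
      image⇒combination {v} v∈Λ = e , λ k → trans (v≋ca k) (trans (c.⟦⟧-cong k (element-cong (proj₂ spanned))) (c-linComb e k))
        where
        a : Vector ℤ s
        a = proj₁ (image-coordinates v∈Λ)
        v≋ca : v ≋ c (element a)
        v≋ca = proj₂ (proj₂ (image-coordinates v∈Λ))
        spanned : ∃ λ e → ∀ k → a k ≡ linCombℤ e L.basis k
        spanned = L.spans (proj₁ (proj₂ (image-coordinates v∈Λ)))
        e : Vector ℤ s
        e = proj₁ spanned

      combination⇒image : ∀ {v} e → v ≋ linComb (fromℤ ∘ e) b → Λ v
      combination⇒image e v≋eb = element a , lattice∈𝓜̃ a (L.contains e (λ _ → ≡.refl)) , λ k → trans (v≋eb k) (sym (c-linComb e k))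
        where
        a : Vector ℤ s
        a = linCombℤ e L.basis

      full-rank : IsFullRankBasis Λ b
      full-rank = record
        { generates   = λ v → mk⇔ image⇒combination (λ (e , v≋eb) → combination⇒image e v≋eb)
        ; independent = independent
        }

      a₀ : Vector ℤ s
      a₀ = proj₁ shortest

      M : ℕ
      M = proj₁ (proj₂ shortest)

      a₀∈ : InLattice a₀
      a₀∈ = proj₁ (proj₂ (proj₂ shortest))

      a₀≢0 : ¬ IsZero a₀
      a₀≢0 = proj₁ (proj₂ (proj₂ (proj₂ shortest)))

      form-a₀ : form a₀ a₀ ≡ + M
      form-a₀ = proj₁ (proj₂ (proj₂ (proj₂ (proj₂ shortest))))

      minimal : ∀ a → InLattice a → ¬ IsZero a → + M ℤ.≤ form a a
      minimal = proj₂ (proj₂ (proj₂ (proj₂ (proj₂ shortest))))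

      0<M : 0 ℕ.< M
      0<M = form-positive a₀ a₀≢0 form-a₀

      v₀ : Vector Carrier s
      v₀ = c (element a₀)

      v₀·v₀ : v₀ · v₀ ≈ fromℤ (+ M)
      v₀·v₀ = trans (c-· a₀ a₀) (reflexive (≡.cong fromℤ form-a₀))

      0<v₀·v₀ : 0# < v₀ · v₀
      0<v₀·v₀ = <-respʳ-≈ (sym v₀·v₀) (fromℤ-mono-< {+ 0} {+ M} (ℤ.+<+ 0<M))

      c-zero : ∀ a → IsZero a → c (element a) ≋ 𝟎
      c-zero a a≡0 k = trans (c.⟦⟧-cong k (RingTheory.sum-zero K.commutativeRing {s} (λ i → K.trans (K.*-congʳ (K.reflexive (≡.cong K.fromℤ (a≡0 i)))) (K.zeroˡ _)))) (c.0#-homo k)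

      v₀≢0 : ¬ (v₀ ≋ 𝟎)
      v₀≢0 v₀≋0 = #-irrefl (sum-zero {s} (λ k → trans (*-congʳ (v₀≋0 k)) (zeroˡ (v₀ k)))) (#-sym (<⇒# 0<v₀·v₀))

      shortest-vector : ∀ w → Λ w → ¬ (w ≋ 𝟎) → ‖ v₀ ‖ ≤ ‖ w ‖
      shortest-vector w w∈Λ w≢0 = √-mono-≤ (asym 0<v₀·v₀) 0≤w·w v₀·v₀≤w·w
        where
        a = proj₁ (image-coordinates w∈Λ)
        a∈ = proj₁ (proj₂ (image-coordinates w∈Λ))
        w≋ca = proj₂ (proj₂ (image-coordinates w∈Λ))
        w·w : w · w ≈ fromℤ (form a a)
        w·w = trans (sum-cong-≋ {s} (λ k → *-cong (w≋ca k) (w≋ca k))) (c-· a a)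
        M≤ : + M ℤ.≤ form a a
        M≤ = minimal a a∈ (λ a≡0 → w≢0 (λ k → trans (w≋ca k) (c-zero a a≡0 k)))
        v₀·v₀≤w·w : v₀ · v₀ ≤ w · w
        v₀·v₀≤w·w w<v = fromℤ-mono-≤ M≤ (<-respˡ-≈ w·w (<-respʳ-≈ v₀·v₀ w<v))
          where open IsStrictPartialOrder isStrictPartialOrder using (<-respˡ-≈)
        0≤w·w : 0# ≤ w · w
        0≤w·w w<0 = v₀·v₀≤w·w (IsStrictPartialOrder.trans isStrictPartialOrder w<0 0<v₀·v₀)

      2#0 : 2# # 0#
      2#0 = #-sym (<⇒# 0<2)

      ρ : Carrier
      ρ = inverse 2# 2#0 * ‖ v₀ ‖

      2ρ : 2# * ρ ≈ ‖ v₀ ‖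
      2ρ = trans (sym (*-assoc 2# (inverse 2# 2#0) ‖ v₀ ‖)) (trans (*-congʳ (x*inverse≈1 2#0)) (*-identityˡ ‖ v₀ ‖))

      0<ρ : 0# < ρ
      0<ρ = *-pos 0<½ (√-pos 0<v₀·v₀)
        where
        0<½ : 0# < inverse 2# 2#0
        0<½ = inverse-pos 2#0 0<2

      vol#0 : vol b # 0#
      vol#0 = √-pos⇒#0 0<det

      4ρ² : (2# * ρ) * (2# * ρ) ≈ fromℤ (+ M)
      4ρ² = trans (*-cong 2ρ 2ρ) (trans (√-square (asym 0<v₀·v₀)) v₀·v₀)

    density-of-image : ∃ λ δ → IsCenterDensity (image c 𝓜̃) δ × 1/2^½ (s ℕ.+ 2) ≤ δ
    density-of-image = ρ ^ s * inverse (vol b) vol#0 , record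
      { basis           = b
      ; isFullRankBasis = full-rank
      ; ρ               = ρ
      ; isPackingRadius = v₀ , (element a₀ , lattice∈𝓜̃ a₀ a₀∈ , λ _ → refl) , v₀≢0 , shortest-vector , 2ρ
      ; vol#0           = vol#0
      ; δ≈ρⁿ/vol        = refl
      } , density-bound s M D 0<M (D-bound a₀ a₀∈ form-a₀ 0<M) 0<det det-gram refl vol#0 0<ρ 4ρ²

  -- The canonical embedding lands in dimension r₁ + 2 r₂, which is only provably equal to s.
  -- Stating the result for an arbitrary map that is componentwise a homomorphism and carries the
  -- form to the inner product allows the equality to be matched away.
  density-in-dimension : ∀ {d} → d ≡ s → (c : K.Carrier → Vector Carrier d) →
    (∀ k → RingMorphisms.IsRingHomomorphism K.rawRing (CommutativeRing.rawRing commutativeRing) (λ x → c x k)) →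
    (∀ a b → c (element a) · c (element b) ≈ fromℤ (form a b)) →
    ∃ λ δ → IsCenterDensity (image c 𝓜̃) δ × 1/2^½ (s ℕ.+ 2) ≤ δ
  density-in-dimension ≡.refl = density-of-image

  center-density : (σ : Embeddings s) →
    ∃ λ δ → IsCenterDensity (image (Embeddings.canonical σ) 𝓜̃) δ × 1/2^½ (s ℕ.+ 2) ≤ δ
  center-density σ = density-in-dimension dim≡s (Embeddings.canonical σ) component-isRingHomomorphism
    (λ a b → trans (canonical-· (element a) (element b)) (trans (φ.⟦⟧-cong (trace-element-* a b)) (φ.fromℤ-homo (form a b))))
    where open TotallyReal ℝ K s 2∤s θ θ-hom t conjugates-distinct σ

open import Data.Integer.Base using (ℤ; _%ℕ_) renaming (_^_ to _^ᶻ_)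
open import Data.Nat.Base using (ℕ; _∸_; _+_)
open import Data.Nat.Divisibility using (_∣_; quotient)
open import Data.Nat.Primality using (Prime; prime⇒nonZero)

mainTheorem3 :
  (p s : ℕ) (p-prime : Prime p) → ¬ (2 ∣ s) → (s∣p-1 : s ∣ p ∸ 1) →
  (ℝ : RealNumbers) →
  let open RealNumbers ℝ using (_≤_)
      open RealProperties ℝ using (1/2^½_)
      open Lattices ℝ using (IsCenterDensity)
  in
  -- 𝕃 = ℚ(ζ)
  (𝕃 : FieldOverℚ) (ζ : ∣ 𝕃 ∣ᶠ) →
  let open FieldOverℚ 𝕃 using (_≈_)
      open FieldOverℚ 𝕃 using (_^_)
  in
  IsPrimitiveRootOfUnity 𝕃 p ζ → (∀ x → Adjoin 𝕃 ζ x) →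
  -- 𝕂 ⊆ 𝕃 via j, [𝕂 : ℚ] = s
  (𝕂 : FieldOverℚ) (j : ∣ 𝕂 ∣ᶠ → ∣ 𝕃 ∣ᶠ) → IsFieldEmbedding 𝕂 𝕃 j → HasDegree 𝕂 s →
  -- σᵤ(ζ) = ζᵘ, where the exponent is reduced mod p since u may be negative
  (u : ℤ) → GeneratesUnits p u →
  (σᵤ : ∣ 𝕃 ∣ᶠ → ∣ 𝕃 ∣ᶠ) → IsAutomorphism 𝕃 σᵤ →
  σᵤ ζ ≈ ζ ^ _%ℕ_ u p {{prime⇒nonZero p-prime}} →
  -- θ = σᵤ restricted to 𝕂, t = Tr(ζ) from 𝕃 to 𝕂
  (θ : ∣ 𝕂 ∣ᶠ → ∣ 𝕂 ∣ᶠ) → (∀ x → j (θ x) ≈ σᵤ (j x)) →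
  (t : ∣ 𝕂 ∣ᶠ) → Relative.IsTrace 𝕂 𝕃 j ζ t →
  (β : ℤ) → HasOrder p β (p ∸ 1) →
  (σ : CanonicalEmbedding.Embeddings ℝ 𝕂 s) →
  let open CanonicalEmbedding ℝ 𝕂 using (image)
      open Modules 𝕂 θ t p s (β ^ᶻ quotient s∣p-1) using (𝓜̃)
  in
  ∃ λ δ → IsCenterDensity (image (CanonicalEmbedding.Embeddings.canonical σ) 𝓜̃) δ × 1/2^½ (s + 2) ≤ δ
mainTheorem3 zero    s p-prime = contradiction p-prime ¬prime[0]
mainTheorem3 (suc N) s p-prime 2∤s s∣N ℝ 𝕃 ζ ζ-primitive 𝕃=ℚ⟨ζ⟩ 𝕂 j j-hom 𝕂-degree
  u u-generates σᵤ σᵤ-automorphism σᵤζ≈ζᵘ θ jθ≈σᵤj t t-trace β β-order =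
  CenterDensity.center-density ℝ 𝕂 θ θ-hom t N p-prime β β-order (quotient s∣N) s (_∣_.equality s∣N) 2∤s
    trace-form combination-integral
  where
  open Subfield N p-prime 𝕃 ζ ζ-primitive 𝕃=ℚ⟨ζ⟩ 𝕂 j j-hom u u-generates
    σᵤ σᵤ-automorphism σᵤζ≈ζᵘ θ jθ≈σᵤj t t-trace using (θ-hom; module TraceForm)
  open TraceForm (quotient s∣N) s (_∣_.equality s∣N) 2∤s 𝕂-degree using (trace-form; combination-integral)
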